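{- Let $n=p_1^{n_1}p_2^{n_2}\cdots p_r^{n_r}$, where $p_1<\cdots<p_r$ are primes and $n_i$ positive integers. Assume $r\in\{4,5\}$, $n_r=1$ and $2\phi(p_1p_2\cdots p_{r-1})<p_1p_2\cdots p_{r-1}$, and let $X$ be a minimum cut-set of $\mathcal{P}(C_n)$. Then $p_1\in\{2,3\}$ and: (i) If $r=4$, then $X\in\{Z_3^{n_3},Z_4^1\}$ and so $\kappa(\mathcal{P}(C_n))\in\{\beta_3^{n_3},\beta_4^1\}$. Furthermore, if $n_3=1$, then $X=Z_4^1$ and $\kappa(\mathcal{P}(C_n))=\beta_4^1$. (ii) If $r=5$ and $p_1=3$, then $X\in\{Z_4^{n_4},Z_5^1\}$ and so $\kappa(\mathcal{P}(C_n))\in\{\beta_4^{n_4},\beta_5^1\}$. Furthermore, if $n_4=1$, then $X=Z_5^1$ and $\kappa(\mathcal{P}(C_n))=\beta_5^1$.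
   Context: $[m]=\{1,\dots,m\}$, $\phi$ is Euler's totient function, $C_n$ is the cyclic group of order $n$. The power graph $\mathcal{P}(C_n)$ has vertex set $C_n$, two distinct vertices adjacent iff one is a power of the other. A cut-set is a vertex subset whose removal leaves a disconnected induced subgraph; a minimum cut-set is one of least size; $\kappa$ denotes vertex connectivity. For $d\mid n$, $E_d$ is the set of elements of order $d$ in $C_n$ and $S_d$ the subgroup of order $d$. For $a\in[r]$, $s\in[n_a]$: $Q_a^s=\bigcup_{i\in[r]\setminus\{a\}} S_{n/(p_ip_a^s)}$, $Z_a^s:=E_n\cup E_{n/p_a}\cup\cdots\cup E_{n/p_a^{s-1}}\cup Q_a^s$, and $$\beta_a^s:=\phi(n)+\frac{n}{p_1\cdots p_r}\cdot\frac{1}{p_a^{s-1}}\left[\frac{p_1\cdots p_r}{p_a}+\phi\left(\frac{p_1\cdots p_r}{p_a}\right)(p_a^{s-1}-2)\right].$$ -}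

module Defs where

open import Data.Nat using (ℕ; zero; suc; _+_; _*_; _∸_; _^_; _≤_; _<_; _≟_)
open import Data.Nat.DivMod using (_/_)
open import Data.Nat.Divisibility using (_∣_)
open import Data.Nat.GCD using (gcd)
open import Data.Fin using (Fin; toℕ)
open import Data.Fin.Subset using (Subset; _∈_; _∉_; ∣_∣)
open import Data.Integer as ℤ using (ℤ; +_)
open import Data.List using (length; filter; upTo)
open import Data.Product using (_×_; ∃-syntax)
open import Data.Sum using (_⊎_)
open import Relation.Binary.PropositionalEquality using (_≡_; _≢_)
open import Relation.Nullary using (¬_)

-- natural-number division, total (m div 0 = 0); only used with nonzero
-- divisors that divide exactly
_div_ : ℕ → ℕ → ℕ
m div zero = 0
m div suc d = m / suc d

φ : ℕ → ℕ
φ m = length (filter (λ k → gcd (suc k) m ≟ 1) (upTo m))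

prodTo : (ℕ → ℕ) → ℕ → ℕ
prodTo f zero = 1
prodTo f (suc r) = prodTo f r * f (suc r)

-- The cyclic group C_n, realised as ℤ/nℤ with carrier Fin n
-- (written additively: the k-th power of x is k·x mod n).

IsPowerOf : (n : ℕ) → Fin n → Fin n → Set
IsPowerOf n y x = ∃[ k ] ∃[ q ] k * toℕ x ≡ q * n + toℕ y

Adj : (n : ℕ) → Fin n → Fin n → Set
Adj n x y = x ≢ y × (IsPowerOf n y x ⊎ IsPowerOf n x y)

data Path (n : ℕ) (X : Subset n) : Fin n → Fin n → Set where
  stay : ∀ {u} → u ∉ X → Path n X u u
  step : ∀ {u w v} → u ∉ X → Adj n u w → Path n X w v → Path n X u v

CutSet : (n : ℕ) → Subset n → Set
CutSet n X = ∃[ u ] ∃[ v ] (u ∉ X × v ∉ X × ¬ Path n X u v)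

MinCutSet : (n : ℕ) → Subset n → Set
MinCutSet n X = CutSet n X × (∀ Y → CutSet n Y → ∣ X ∣ ≤ ∣ Y ∣)

IsConnectivity : (n : ℕ) → ℕ → Set
IsConnectivity n k = (∃[ Y ] (CutSet n Y × ∣ Y ∣ ≡ k)) × (∀ Y → CutSet n Y → k ≤ ∣ Y ∣)

HasOrder : (n : ℕ) → Fin n → ℕ → Set
HasOrder n x d = 0 < d × n ∣ d * toℕ x × (∀ k → 0 < k → n ∣ k * toℕ x → d ≤ k)

InE : (n : ℕ) → ℕ → Fin n → Set
InE n d x = HasOrder n x d

-- x ∈ S_d, the (unique) subgroup of order d of C_n : { x | x^d = e }
InS : (n : ℕ) → ℕ → Fin n → Set
InS n d x = n ∣ d * toℕ x

InZ : (n r : ℕ) (p : ℕ → ℕ) (a s : ℕ) → Fin n → Set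
InZ n r p a s x =
  (∃[ j ] (j < s × InE n (n div (p a ^ j)) x))
  ⊎ (∃[ i ] (1 ≤ i × i ≤ r × i ≢ a × InS n (n div (p i * p a ^ s)) x))

_≐_ : ∀ {n} → Subset n → (Fin n → Set) → Set
_≐_ {n} X P = ∀ (x : Fin n) → (x ∈ X → P x) × (P x → x ∈ X)

-- β_a^s (an integer; all divisions are exact)
β : (n r : ℕ) (p : ℕ → ℕ) (a s : ℕ) → ℤ
β n r p a s =
  + φ n ℤ.+ (+ ((n div P) div (p a ^ (s ∸ 1))))
     ℤ.* (+ (P div p a) ℤ.+ (+ φ (P div p a)) ℤ.* ((+ (p a ^ (s ∸ 1))) ℤ.- (+ 2)))
  where
  P = prodTo p r

{-# OPTIONS --safe #-}
-- Record the order of x ∈ C_n by the exponents of the primes p_i in gcd(x, n).  Adjacency becomes comparability in a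
-- product of chains in which every point weighs as much as its class of elements, and a cut-set contains the complement of
-- two nonempty families A, B without comparabilities between them; that complement has to be bounded below.
-- Slice the product along the grid of the last two chains (of p_{r−1} and p_r), so that every layer is a product L of
-- r − 2 chains.  The top layer carries so much weight that A and B cannot both meet it (two incomparable families of L
-- already leave out too much); say A misses it.  If A contains a point which is not the top of L in its layer, then B loses
-- too much of the top layer.  Hence A lies over the top of L, is a subset T of the grid, and the cost of every layer is
-- determined by T; the only T that are not too expensive are {(0,1)} and {(n_{r−1},0)}, which are Z_r^1 and Z_{r−1}^{n_{r−1}}.
module Submission where

open import Defs
open import Data.Bool using (Bool; true; false; not; _∨_; _∧_; _xor_)
open import Data.Bool.Properties using (∨-comm) renaming (_≟_ to _≟ᵇ_)
open import Data.Fin as Fin using (Fin; zero; suc; fromℕ; toℕ; fromℕ<)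
open import Data.Fin.Permutation using (Permutation′; permutation)
import Data.Fin.Properties as Fin
open import Data.List using (length; filter; applyUpTo)
open import Data.Nat hiding (_≟_)
import Data.Nat as ℕ
open import Data.Nat.Coprimality as Coprimality using (Coprime; coprime⇒gcd≡1; gcd≡1⇒coprime; coprime-divisor; coprime-Bézout)
open import Data.Nat.Divisibility
open import Data.Nat.DivMod using (m*n/n≡m; %-distribˡ-+; %-distribˡ-*; m%n%n≡m%n; [m+kn]%n≡m%n; m%n<n; m<n⇒m%n≡m; m≡m%n+[m/n]*n; +-distrib-/-∣ʳ)
open import Data.Nat.GCD
open import Data.Nat.Primality
open import Data.Nat.Properties hiding (_≟_)
open import Data.Nat.Tactic.RingSolver using (solve-∀)
open import Data.Product using (_×_; _,_; proj₁; proj₂; ∃-syntax)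
open import Data.Product.Properties using (≡-dec)
open import Data.Sum using (_⊎_; inj₁; inj₂; [_,_]′)
open import Function using (_∘_)
open import Relation.Binary.Definitions using (DecidableEquality; tri<; tri≈; tri>)
open import Relation.Binary.PropositionalEquality
open import Relation.Nullary using (¬_; Dec; yes; no; does; contradiction; ¬?)
open import Relation.Nullary.Decidable using (_×-dec_; _⊎-dec_; dec-true; dec-false; ¬¬-excluded-middle; decidable-stable)
open import Relation.Unary using (Decidable)
open import Algebra.Properties.CommutativeMonoid.Sum +-0-commutativeMonoid using (sum; sum-cong-≗; ∑-comm; ∑-distrib-+; sum-permute)

-- Weighted products of chains

-- The top weight and the total weight of `L` carry the factor ∏ p_i^(n_i - 1). The weight above
-- another point is only known up to a ratio, at least 1 + 1/q times the top weight for the largest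
-- prime q of `L`. So everything about `L` reduces to inequalities in the primes alone, and these
-- are tight. For p₁ = 2 the weight above a non-top point can be too small. But then the cut bound
-- of `L` is half of its total weight, and this balance forces a second loss in another layer. For
-- p₁ = 3 the bounds would fail for 3, 5, 7, 9, so the argument needs that three primes above 3 span
-- at least 6. For r = 5 and p₁ = 3 the cut bound of `L` depends on whether p₂ and p₃ are twins, and
-- twins are affordable only for p₂ ≤ 11. That bound comes from 2φ(p₁⋯p_{r-1}) < p₁⋯p_{r-1}, which
-- also excludes p₁ ≥ 5. In the grid one comparison can end in a tie with Z_r^1, for p_r = p_{r-1} +
-- 2 and total weight of `L` three times its top weight; it is broken separately.

⟦_⟧ : Bool → ℕ
⟦ true ⟧  = 1
⟦ false ⟧ = 0

⟦⟧-mono : ∀ {b c} → (b ≡ true → c ≡ true) → ⟦ b ⟧ ≤ ⟦ c ⟧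
⟦⟧-mono {false} _ = z≤n
⟦⟧-mono {true}  h rewrite h refl = ≤-refl

⟦⟧+⟦not⟧ : ∀ b → ⟦ b ⟧ + ⟦ not b ⟧ ≡ 1
⟦⟧+⟦not⟧ true  = refl
⟦⟧+⟦not⟧ false = refl

does-true : ∀ {A : Set} (d : Dec A) → does d ≡ true → A
does-true (yes a) _ = a

does-false : ∀ {A : Set} (d : Dec A) → does d ≡ false → ¬ A
does-false (no ¬a) _ = ¬a

true≢false : ∀ {b} → b ≡ true → b ≢ false
true≢false refl ()

not-true⇒false : ∀ {b} → b ≢ true → b ≡ false
not-true⇒false {true}  h = contradiction refl h
not-true⇒false {false} h = refl

-- `x ≽ y` is to mean that the elements of class y are powers of those of class x, so `top` is the
-- class of generators. Weights occur only inside `∑`, which need only be monotone and additive;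
-- `search` stands for finiteness.
record Space : Set₁ where
  infix 4 _≽_
  field
    Pt     : Set
    _≽_    : Pt → Pt → Set
    _≽?_   : ∀ x y → Dec (x ≽ y)
    ≽-refl : ∀ {x} → x ≽ x
    top    : Pt
    top-≽  : ∀ x → top ≽ x
    ≽-top  : ∀ {x} → x ≽ top → x ≡ top
    _≟_    : DecidableEquality Pt
    search : (f : Pt → Bool) → (∃[ x ] f x ≡ true) ⊎ (∀ x → f x ≡ false)
    ∑      : (Pt → ℕ) → ℕ
    ∑-mono : ∀ {f g} → (∀ x → f x ≤ g x) → ∑ f ≤ ∑ g
    ∑-+    : ∀ f g → ∑ (λ x → f x + g x) ≡ ∑ f + ∑ g

  top? : ∀ x → Dec (x ≡ top)
  top? x = x ≟ top

  ∑-cong : ∀ {f g} → (∀ x → f x ≡ g x) → ∑ f ≡ ∑ g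
  ∑-cong h = ≤-antisym (∑-mono (≤-reflexive ∘ h)) (∑-mono (≤-reflexive ∘ sym ∘ h))

  ∑-0 : ∑ (λ _ → 0) ≡ 0
  ∑-0 = sym (+-cancelˡ-≡ (∑ (λ _ → 0)) 0 _
    (trans (+-identityʳ _) (∑-+ (λ _ → 0) (λ _ → 0))))

  ∑-* : ∀ k f → ∑ (λ x → k * f x) ≡ k * ∑ f
  ∑-* zero    f = ∑-0
  ∑-* (suc k) f = trans (∑-+ f (λ x → k * f x)) (cong (∑ f +_) (∑-* k f))

  top-weight : ℕ
  top-weight = ∑ (λ x → ⟦ does (top? x) ⟧)

  rest-weight : ℕ
  rest-weight = ∑ (λ x → ⟦ not (does (top? x)) ⟧)

  ∑-1 : ∑ (λ _ → 1) ≡ top-weight + rest-weight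
  ∑-1 = trans (∑-cong (λ x → sym (⟦⟧+⟦not⟧ (does (top? x)))))
              (∑-+ _ _)

  up-weight : Pt → ℕ
  up-weight y = ∑ (λ x → ⟦ does (x ≽? y) ⟧)

  top-weight≤up-weight : ∀ y → top-weight ≤ up-weight y
  top-weight≤up-weight y = ∑-mono λ x → ⟦⟧-mono λ e →
    dec-true (x ≽? y) (subst (_≽ y) (sym (does-true (top? x) e)) (top-≽ y))

  Nonempty : (Pt → Bool) → Set
  Nonempty A = ∃[ x ] A x ≡ true

  Separated : (Pt → Bool) → (Pt → Bool) → Set
  Separated A B = ∀ x y → A x ≡ true → B y ≡ true → ¬ (x ≽ y) × ¬ (y ≽ x)

  separator : (Pt → Bool) → (Pt → Bool) → Pt → ℕ
  separator A B x = ⟦ not (A x ∨ B x) ⟧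

  CutBound : ℕ → Set
  CutBound γ = ∀ A B → Nonempty A → Nonempty B → Separated A B → γ ≤ ∑ (separator A B)

  -- Division-free form of: the weight above x is at least 1 + 1/q times the top weight.
  UpBound : ℕ → Set
  UpBound q = ∀ x → x ≢ top → (1 + q) * top-weight ≤ q * up-weight x

open Space using (Pt; CutBound; UpBound; Nonempty; Separated)

infixr 6 _⊗_
_⊗_ : Space → Space → Space
L ⊗ K = record
  { Pt     = Pt L × Pt K
  ; _≽_    = λ x y → (proj₁ x L.≽ proj₁ y) × (proj₂ x K.≽ proj₂ y)
  ; _≽?_   = λ x y → (proj₁ x L.≽? proj₁ y) ×-dec (proj₂ x K.≽? proj₂ y)
  ; ≽-refl = L.≽-refl , K.≽-refl
  ; top    = L.top , K.top
  ; top-≽  = λ x → L.top-≽ (proj₁ x) , K.top-≽ (proj₂ x)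
  ; ≽-top  = λ (p , q) → cong₂ _,_ (L.≽-top p) (K.≽-top q)
  ; _≟_    = ≡-dec L._≟_ K._≟_
  ; search = search′
  ; ∑      = λ f → K.∑ (λ k → L.∑ (λ l → f (l , k)))
  ; ∑-mono = λ h → K.∑-mono (λ k → L.∑-mono (λ l → h (l , k)))
  ; ∑-+    = λ f g → trans (K.∑-cong (λ k → L.∑-+ _ _)) (K.∑-+ _ _)
  }
  where
  module L = Space L
  module K = Space K
  found : (L.Pt → Bool) → Bool
  found g with L.search g
  ... | inj₁ _ = true
  ... | inj₂ _ = false
  found-true : ∀ g → found g ≡ true → ∃[ l ] g l ≡ true
  found-true g e with L.search g
  ... | inj₁ h = h
  found-false : ∀ g → found g ≡ false → ∀ l → g l ≡ false
  found-false g e with L.search g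
  ... | inj₂ h = h
  search′ : (f : L.Pt × K.Pt → Bool) → (∃[ x ] f x ≡ true) ⊎ (∀ x → f x ≡ false)
  search′ f with K.search (λ k → found (λ l → f (l , k)))
  ... | inj₁ (k , e)  = let l , e′ = found-true _ e in inj₁ ((l , k) , e′)
  ... | inj₂ none     = inj₂ λ { (l , k) → found-false _ (none k) l }

pow : ℕ → ℕ → ℕ
pow a m = suc a ^ m

-- The point j ∈ Fin (suc m) stands for the elements of order (suc a)^(m − j) in the cyclic group of order (suc a)^m, a prime power.
chainSum : ∀ a m → (Fin (suc m) → ℕ) → ℕ
chainSum a zero    f = f zero
chainSum a (suc m) f = a * pow a m * f zero + chainSum a m (f ∘ suc)

chainSum-mono : ∀ a m {f g} → (∀ x → f x ≤ g x) → chainSum a m f ≤ chainSum a m g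
chainSum-mono a zero    h = h zero
chainSum-mono a (suc m) h = +-mono-≤ (*-monoʳ-≤ (a * pow a m) (h zero)) (chainSum-mono a m (h ∘ suc))

chainSum-+ : ∀ a m f g → chainSum a m (λ x → f x + g x) ≡ chainSum a m f + chainSum a m g
chainSum-+ a zero    f g = refl
chainSum-+ a (suc m) f g rewrite chainSum-+ a m (f ∘ suc) (g ∘ suc) =
  lemma (a * pow a m) (f zero) (g zero) (chainSum a m (f ∘ suc)) (chainSum a m (g ∘ suc))
  where
  lemma : ∀ w x y u v → w * (x + y) + (u + v) ≡ w * x + u + (w * y + v)
  lemma = solve-∀

finSearch : ∀ {n} (f : Fin n → Bool) → (∃[ x ] f x ≡ true) ⊎ (∀ x → f x ≡ false)
finSearch {zero}  f = inj₂ λ ()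
finSearch {suc n} f with f zero in e
... | true = inj₁ (zero , e)
... | false with finSearch (f ∘ suc)
...   | inj₁ (x , e′) = inj₁ (suc x , e′)
...   | inj₂ h        = inj₂ λ { zero → e ; (suc x) → h x }

Chain : ℕ → ℕ → Space
Chain a m = record
  { Pt     = Fin (suc m)
  ; _≽_    = Fin._≤_
  ; _≽?_   = Fin._≤?_
  ; ≽-refl = ≤-refl
  ; top    = zero
  ; top-≽  = λ _ → z≤n
  ; ≽-top  = λ x≤0 → Fin.toℕ-injective (n≤0⇒n≡0 x≤0)
  ; _≟_    = Fin._≟_
  ; search = finSearch
  ; ∑      = chainSum a m
  ; ∑-mono = chainSum-mono a m
  ; ∑-+    = chainSum-+ a m
  }

chainSum-const : ∀ a m c → chainSum a m (λ _ → c) ≡ pow a m * c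
chainSum-const a zero    c = sym (+-identityʳ c)
chainSum-const a (suc m) c rewrite chainSum-const a m c = lemma a (pow a m) c
  where
  lemma : ∀ a w c → a * w * c + w * c ≡ (w + a * w) * c
  lemma = solve-∀

chain-top-weight : ∀ a m → Space.top-weight (Chain a (suc m)) ≡ a * pow a m
chain-top-weight a m rewrite Space.∑-0 (Chain a m) | *-identityʳ (a * pow a m) = +-identityʳ _

chain-rest-weight : ∀ a m → Space.rest-weight (Chain a (suc m)) ≡ pow a m
chain-rest-weight a m rewrite *-zeroʳ (a * pow a m) = trans (chainSum-const a m 1) (*-identityʳ _)

chain-separated : ∀ a m A B → Nonempty (Chain a m) A → Nonempty (Chain a m) B → ¬ Separated (Chain a m) A B
chain-separated a m A B (x , p) (y , q) sep with Fin.≤-total x y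
... | inj₁ x≤y = proj₁ (sep _ _ p q) x≤y
... | inj₂ y≤x = proj₂ (sep _ _ p q) y≤x

chain-cutBound : ∀ a m γ → CutBound (Chain a m) γ
chain-cutBound a m γ A B nA nB sep = contradiction sep (chain-separated a m A B nA nB)

-- Above a lower point lie at least the two uppermost points. The second weighs 1/(a + 1) of the
-- first, or 1/a of it if the chain has just two points.
chain-upBound : ∀ a m → UpBound (Chain a (suc m)) (suc a)
chain-upBound a m zero    x≢ = contradiction refl x≢
chain-upBound a m (suc j) x≢ rewrite chain-top-weight a m = begin
  (2 + a) * (a * pow a m)                        ≡⟨ lemma a (pow a m) ⟩
  suc a * (a * pow a m * 1) + a * pow a m ≤⟨ +-monoʳ-≤ (suc a * (a * pow a m * 1)) (second m j) ⟩
  suc a * (a * pow a m * 1) + suc a * chainSum a m _ ≡⟨ sym (*-distribˡ-+ (suc a) (a * pow a m * 1) _) ⟩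
  suc a * (a * pow a m * 1 + chainSum a m _)     ∎
  where
  open ≤-Reasoning
  lemma : ∀ a w → (2 + a) * (a * w) ≡ suc a * (a * w * 1) + a * w
  lemma = solve-∀
  lemma′ : ∀ a w → a * (w + a * w) ≡ suc a * (a * w * 1)
  lemma′ = solve-∀
  second : ∀ m (j : Fin (suc m)) → a * pow a m ≤ suc a * chainSum a m (λ x → ⟦ does (suc x Fin.≤? suc j) ⟧)
  second zero    zero = *-monoˡ-≤ 1 (n≤1+n a)
  second (suc m) j = begin
    a * pow a (suc m)             ≡⟨ lemma′ a (pow a m) ⟩
    suc a * (a * pow a m * 1)     ≤⟨ *-monoʳ-≤ (suc a) (m≤m+n _ _) ⟩
    suc a * (a * pow a m * 1 + _) ∎

-- With d the excess of the up-weight over the top weight t, the bound reads t ≤ q d, which is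
-- monotone in q.
upBound-mono : ∀ L {q r} → q ≤ r → UpBound L q → UpBound L r
upBound-mono L {q} {r} q≤r h x ne = begin
  (1 + r) * t             ≡⟨ refl ⟩
  t + r * t               ≤⟨ +-monoˡ-≤ (r * t) key ⟩
  r * d + r * t           ≡⟨ sym (*-distribˡ-+ r d t) ⟩
  r * (d + t)             ≡⟨ cong (r *_) d+t ⟩
  r * u                   ∎
  where
  open ≤-Reasoning
  open Space L
  t = top-weight
  u = up-weight x
  d = u ∸ t
  d+t : d + t ≡ u
  d+t = m∸n+n≡m (top-weight≤up-weight x)
  key : t ≤ r * d
  key = ≤-trans (+-cancelʳ-≤ (q * t) t (q * d) (begin
      t + q * t       ≤⟨ h x ne ⟩
      q * u           ≡⟨ cong (q *_) (sym d+t) ⟩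
      q * (d + t)     ≡⟨ *-distribˡ-+ q d t ⟩
      q * d + q * t   ∎)) (*-monoˡ-≤ d q≤r)

module _ (L K : Space) where
  private
    module L = Space L
    module K = Space K
    module P = Space (L ⊗ K)

  ∑-product : ∀ (f : L.Pt → ℕ) (g : K.Pt → ℕ) → P.∑ (λ x → g (proj₂ x) * f (proj₁ x)) ≡ K.∑ g * L.∑ f
  ∑-product f g = trans (K.∑-cong (λ k → trans (L.∑-* (g k) f) (*-comm (g k) (L.∑ f))))
                  (trans (K.∑-* (L.∑ f) g) (*-comm (L.∑ f) (K.∑ g)))

  ⊗-top-weight : P.top-weight ≡ K.top-weight * L.top-weight
  ⊗-top-weight = trans (P.∑-cong λ { (l , k) → pointwise l k (L.top? l) (K.top? k) }) (∑-product _ _)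
    where
    pointwise : ∀ l k (l? : Dec (l ≡ L.top)) (k? : Dec (k ≡ K.top)) → ⟦ does (P.top? (l , k)) ⟧ ≡ ⟦ does k? ⟧ * ⟦ does l? ⟧
    pointwise l k (yes p) (yes q) = cong ⟦_⟧ (dec-true (P.top? (l , k)) (cong₂ _,_ p q))
    pointwise l k (no ne) (yes _) = cong ⟦_⟧ (dec-false (P.top? (l , k)) (ne ∘ cong proj₁))
    pointwise l k (no ne) (no _) = cong ⟦_⟧ (dec-false (P.top? (l , k)) (ne ∘ cong proj₁))
    pointwise l k (yes _) (no ne) = cong ⟦_⟧ (dec-false (P.top? (l , k)) (ne ∘ cong proj₂))

  -- Some coordinate differs from its top. Count only the points above in that coordinate whose
  -- other coordinate is the top.
  ⊗-upBound : ∀ {q} → UpBound L q → UpBound K q → UpBound (L ⊗ K) q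
  ⊗-upBound {q} hL hK (l , k) ne with L.top? l
  ... | no l≢ = begin
    (1 + q) * P.top-weight                     ≡⟨ cong ((1 + q) *_) ⊗-top-weight ⟩
    (1 + q) * (K.top-weight * L.top-weight) ≡⟨ swap (1 + q) K.top-weight L.top-weight ⟩
    K.top-weight * ((1 + q) * L.top-weight)    ≤⟨ *-monoʳ-≤ K.top-weight (hL l l≢) ⟩
    K.top-weight * (q * L.up-weight l) ≡⟨ sym (swap q K.top-weight (L.up-weight l)) ⟩
    q * (K.top-weight * L.up-weight l) ≡⟨ cong (q *_) (sym (∑-product _ _)) ⟩
    q * P.∑ (λ x → ⟦ does (K.top? (proj₂ x)) ⟧ * ⟦ does (proj₁ x L.≽? l) ⟧)
                                               ≤⟨ *-monoʳ-≤ q (P.∑-mono pointwise) ⟩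
    q * P.up-weight (l , k)                    ∎
    where
    open ≤-Reasoning
    swap : ∀ x y z → x * (y * z) ≡ y * (x * z)
    swap = solve-∀
    pointwise : ∀ x → ⟦ does (K.top? (proj₂ x)) ⟧ * ⟦ does (proj₁ x L.≽? l) ⟧ ≤ ⟦ does (x P.≽? (l , k)) ⟧
    pointwise (x , y) with K.top? y | x L.≽? l
    ... | no _     | _ = z≤n
    ... | yes refl | no _ = z≤n
    ... | yes refl | yes x≽l rewrite dec-true (K.top K.≽? k) (K.top-≽ k) = ≤-refl
  ... | yes refl = begin
    (1 + q) * P.top-weight                     ≡⟨ cong ((1 + q) *_) ⊗-top-weight ⟩
    (1 + q) * (K.top-weight * L.top-weight) ≡⟨ sym (*-assoc (1 + q) K.top-weight L.top-weight) ⟩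
    (1 + q) * K.top-weight * L.top-weight ≤⟨ *-monoˡ-≤ L.top-weight (hK k (λ { refl → ne refl })) ⟩
    q * K.up-weight k * L.top-weight ≡⟨ *-assoc q (K.up-weight k) L.top-weight ⟩
    q * (K.up-weight k * L.top-weight) ≡⟨ cong (q *_) (sym (∑-product _ _)) ⟩
    q * P.∑ (λ x → ⟦ does (proj₂ x K.≽? k) ⟧ * ⟦ does (L.top? (proj₁ x)) ⟧)
                                               ≤⟨ *-monoʳ-≤ q (P.∑-mono pointwise) ⟩
    q * P.up-weight (L.top , k)                ∎
    where
    open ≤-Reasoning
    pointwise : ∀ x → ⟦ does (proj₂ x K.≽? k) ⟧ * ⟦ does (L.top? (proj₁ x)) ⟧ ≤ ⟦ does (x P.≽? (L.top , k)) ⟧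
    pointwise (x , y) with y K.≽? k | L.top? x
    ... | no _   | _    = z≤n
    ... | yes _  | no _ = z≤n
    ... | yes yk | yes refl rewrite dec-true (L.top L.≽? L.top) (L.top-≽ L.top) = ≤-refl

module Layers (L K : Space) (A B : Pt (L ⊗ K) → Bool) (sep : Separated (L ⊗ K) A B) where
  private
    module L = Space L
    module K = Space K

  layer : K.Pt → ℕ
  layer k = L.∑ (λ l → Space.separator (L ⊗ K) A B (l , k))

  Empty : (Pt (L ⊗ K) → Bool) → K.Pt → Set
  Empty C k = ∀ l → C (l , k) ≡ false

  OnlyTop : K.Pt → Set
  OnlyTop k = ∀ l → l ≢ L.top → A (l , k) ≡ false

  above-false : ∀ {l k l₀ k₀} → A (l₀ , k₀) ≡ true → l L.≽ l₀ → k K.≽ k₀ → B (l , k) ≡ false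
  above-false p l≽ k≽ = not-true⇒false λ q → proj₂ (sep _ _ p q) (l≽ , k≽)

  below-false : ∀ {l k l₀ k₀} → A (l₀ , k₀) ≡ true → l₀ L.≽ l → k₀ K.≽ k → B (l , k) ≡ false
  below-false p l≽ k≽ = not-true⇒false λ q → proj₁ (sep _ _ p q) (l≽ , k≽)

  layer-cut : ∀ {γ} → CutBound L γ → ∀ k {l l′} → A (l , k) ≡ true → B (l′ , k) ≡ true → γ ≤ layer k
  layer-cut cb k {l} {l′} p q =
    cb (λ l → A (l , k)) (λ l → B (l , k)) (l , p) (l′ , q)
       (λ _ _ p q → (λ r → proj₁ (sep _ _ p q) (r , K.≽-refl)) , (λ r → proj₂ (sep _ _ p q) (r , K.≽-refl)))

  private
    by-indicator : ∀ k (f : L.Pt → Bool) → (∀ l → f l ≡ true → A (l , k) ≡ false × B (l , k) ≡ false) →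
                   L.∑ (λ l → ⟦ f l ⟧) ≤ layer k
    by-indicator k f h = L.∑-mono λ l → ⟦⟧-mono λ e →
      let p , q = h l e in cong not (cong₂ _∨_ p q)

  -- `B` contains nothing above a point of `A`, and `A` misses the layer, so the whole up-set of
  -- `l₀` lies outside both.
  layer-above : ∀ {l₀ k₀ k} → A (l₀ , k₀) ≡ true → k K.≽ k₀ → Empty A k → L.up-weight l₀ ≤ layer k
  layer-above {l₀} p k≽ h = by-indicator _ _ λ l e → h l , above-false p (does-true (l L.≽? l₀) e) k≽

  layer-above-top : ∀ {l₀ k₀ k} → A (l₀ , k₀) ≡ true → k K.≽ k₀ → Empty A k → L.top-weight ≤ layer k
  layer-above-top p k≽ h = ≤-trans (L.top-weight≤up-weight _) (layer-above p k≽ h)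

  -- The entire layer lies below a point of `A`, so `B` misses it, and `A` can keep at most its top.
  layer-below : ∀ {k₀ k} → A (L.top , k₀) ≡ true → k₀ K.≽ k → OnlyTop k → L.rest-weight ≤ layer k
  layer-below p k≽ h = by-indicator _ _ λ l e →
    h l (λ l≡ → true≢false e (cong not (dec-true (L.top? l) l≡))) , below-false p (L.top-≽ l) k≽

  layer-full : ∀ {k} → Empty A k → Empty B k → L.top-weight + L.rest-weight ≤ layer k
  layer-full {k} hA hB = ≤-trans (≤-reflexive (sym L.∑-1)) (by-indicator k (λ _ → true) λ l _ → hA l , hB l)

  layer-below-full : ∀ {k₀ k} → A (L.top , k₀) ≡ true → k₀ K.≽ k → Empty A k → L.top-weight + L.rest-weight ≤ layer k
  layer-below-full p k≽ h = layer-full h λ l → below-false p (L.top-≽ l) k≽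

  -- Each l is lost in layer k or in the top layer: if (l , k) is in `A`, the point over it in the
  -- top layer is barred from `B` and, by assumption, not in `A`.
  layer-A-only : ∀ {k} → Empty A K.top → Empty B k → L.top-weight + L.rest-weight ≤ layer k + layer K.top
  layer-A-only {k} hA hB = begin
    L.top-weight + L.rest-weight         ≡⟨ sym L.∑-1 ⟩
    L.∑ (λ _ → 1)                        ≤⟨ L.∑-mono pointwise ⟩
    L.∑ (λ l → f (l , k) + f (l , K.top)) ≡⟨ L.∑-+ (λ l → f (l , k)) (λ l → f (l , K.top)) ⟩
    layer k + layer K.top                ∎
    where
    open ≤-Reasoning
    f : Pt (L ⊗ K) → ℕ
    f = Space.separator (L ⊗ K) A B
    pointwise : ∀ l → 1 ≤ f (l , k) + f (l , K.top)
    pointwise l with A (l , k) in e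
    ... | false rewrite hB l = s≤s z≤n
    ... | true rewrite hA l | above-false e L.≽-refl (K.top-≽ k) = ≤-refl

separator-comm : ∀ L A B x → Space.separator L A B x ≡ Space.separator L B A x
separator-comm L A B x = cong (⟦_⟧ ∘ not) (∨-comm (A x) (B x))

separated-sym : ∀ L {A B} → Separated L A B → Separated L B A
separated-sym L sep x y p q = let u , v = sep y x q p in v , u

pow-pos : ∀ a m → 1 ≤ pow a m
pow-pos a m = m^n>0 (suc a) m

chainSum-≥ : ∀ a m {f c} → (∀ j → c ≤ f j) → pow a m * c ≤ chainSum a m f
chainSum-≥ a m {f} {c} h = ≤-trans (≤-reflexive (sym (chainSum-const a m c))) (chainSum-mono a m h)

-- The last point is the class of the identity and weighs 1, so an excess d there counts exactly
-- once.
chainSum-last : ∀ a m {f c d} → (∀ j → c ≤ f j) → c + d ≤ f (fromℕ m) → pow a m * c + d ≤ chainSum a m f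
chainSum-last a zero {c = c} {d} h h′ = subst (λ z → z + d ≤ _) (sym (*-identityˡ c)) h′
chainSum-last a (suc m) {f} {c} {d} h h′ = begin
  suc a * pow a m * c + d                    ≡⟨ lemma a (pow a m) c d ⟩
  a * pow a m * c + (pow a m * c + d) ≤⟨ +-mono-≤ (*-monoʳ-≤ (a * pow a m) (h zero)) (chainSum-last a m (h ∘ suc) h′) ⟩
  a * pow a m * f zero + chainSum a m (f ∘ suc) ∎
  where
  open ≤-Reasoning
  lemma : ∀ a w c d → suc a * w * c + d ≡ a * w * c + (w * c + d)
  lemma = solve-∀

chainSum-last-strict : ∀ a m {f c d j₀} → 1 ≤ a → (∀ j → c ≤ f j) → c + d ≤ f (fromℕ m) → j₀ ≢ fromℕ m → c < f j₀ →
                       pow a m * c + d < chainSum a m f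
chainSum-last-strict a zero {j₀ = zero} _ h h′ ne lt = contradiction refl ne
chainSum-last-strict a (suc m) {f} {c} {d} {j₀} 1≤a h h′ ne lt = begin-strict
  suc a * pow a m * c + d                       ≡⟨ lemma a (pow a m) c d ⟩
  a * pow a m * c + (pow a m * c + d)           <⟨ gain j₀ ne lt ⟩
  a * pow a m * f zero + chainSum a m (f ∘ suc) ∎
  where
  open ≤-Reasoning
  lemma : ∀ a w c d → suc a * w * c + d ≡ a * w * c + (w * c + d)
  lemma = solve-∀
  gain : ∀ j → j ≢ fromℕ (suc m) → c < f j →
           a * pow a m * c + (pow a m * c + d) < a * pow a m * f zero + chainSum a m (f ∘ suc)
  gain zero _ lt = +-mono-<-≤ (*-monoʳ-< _ {{>-nonZero (*-mono-≤ 1≤a (pow-pos a m))}} lt) (chainSum-last a m (h ∘ suc) h′)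
  gain (suc j) ne lt = +-mono-≤-< (*-monoʳ-≤ (a * pow a m) (h zero))
                           (chainSum-last-strict a m 1≤a (h ∘ suc) h′ (ne ∘ cong suc) lt)

chainSum-> : ∀ a m {f c j₀} → 1 ≤ a → (∀ j → c ≤ f j) → c < f j₀ → pow a m * c < chainSum a m f
chainSum-> a zero    {c = c} {zero} _ h lt = subst (_< _) (sym (*-identityˡ c)) lt
chainSum-> a (suc m) {f} {c} {j₀} 1≤a h lt = begin-strict
  suc a * pow a m * c                           ≡⟨ lemma a (pow a m) c ⟩
  a * pow a m * c + pow a m * c                 <⟨ gain j₀ lt ⟩
  a * pow a m * f zero + chainSum a m (f ∘ suc) ∎
  where
  open ≤-Reasoning
  lemma : ∀ a w c → suc a * w * c ≡ a * w * c + w * c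
  lemma = solve-∀
  gain : ∀ j → c < f j → a * pow a m * c + pow a m * c < a * pow a m * f zero + chainSum a m (f ∘ suc)
  gain zero lt = +-mono-<-≤ (*-monoʳ-< _ {{>-nonZero (*-mono-≤ 1≤a (pow-pos a m))}} lt) (chainSum-≥ a m (h ∘ suc))
  gain (suc j) lt = +-mono-≤-< (*-monoʳ-≤ (a * pow a m) (h zero)) (chainSum-> a m 1≤a (h ∘ suc) lt)

-- The points below j weigh at most 1/a of what j weighs, so the excess δ of j pays for the deficit a δ of the points below it.
chainSum-deep : ∀ a m {f Y κ δ} j₀ → 1 ≤ a →
  (∀ j → j Fin.< j₀ → Y + κ + a * δ ≤ f j) → Y + κ + a * δ + δ ≤ f j₀ → (∀ j → j₀ Fin.< j → Y ≤ f j) →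
  pow a m * (Y + a * δ) + κ ≤ chainSum a m f
chainSum-deep a zero {f} {Y} {κ} {δ} zero _ _ h _ =
  ≤-trans (≤-reflexive (lemma a Y κ δ)) (≤-trans (m≤m+n _ δ) h)
  where
  lemma : ∀ a Y κ δ → 1 * (Y + a * δ) + κ ≡ Y + κ + a * δ
  lemma = solve-∀
chainSum-deep a (suc m) {f} {Y} {κ} {δ} zero 1≤a _ h h′ = begin
  suc a * pow a m * (Y + a * δ) + κ ≤⟨ +-monoʳ-≤ (suc a * pow a m * (Y + a * δ)) (m≤n*m κ (a * pow a m) {{>-nonZero (*-mono-≤ 1≤a (pow-pos a m))}}) ⟩
  suc a * pow a m * (Y + a * δ) + a * pow a m * κ ≡⟨ lemma a (pow a m) Y κ δ ⟩
  a * pow a m * (Y + κ + a * δ + δ) + pow a m * Y ≤⟨ +-mono-≤ (*-monoʳ-≤ (a * pow a m) h) (chainSum-≥ a m (λ j → h′ (suc j) (s≤s z≤n))) ⟩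
  a * pow a m * f zero + chainSum a m (f ∘ suc) ∎
  where
  open ≤-Reasoning
  lemma : ∀ a w Y κ δ → suc a * w * (Y + a * δ) + a * w * κ ≡ a * w * (Y + κ + a * δ + δ) + w * Y
  lemma = solve-∀
chainSum-deep a (suc m) {f} {Y} {κ} {δ} (suc j₀) 1≤a h₁ h₂ h₃ = begin
  suc a * pow a m * (Y + a * δ) + κ ≡⟨ lemma a (pow a m) Y κ δ ⟩
  a * pow a m * (Y + a * δ) + (pow a m * (Y + a * δ) + κ) ≤⟨ +-mono-≤ (*-monoʳ-≤ (a * pow a m) (≤-trans (+-monoˡ-≤ (a * δ) (m≤m+n Y κ)) (h₁ zero (s≤s z≤n))))
                                                                         (chainSum-deep a m j₀ 1≤a (λ j lt → h₁ (suc j) (s≤s lt)) h₂ (λ j lt → h₃ (suc j) (s≤s lt))) ⟩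
  a * pow a m * f zero + chainSum a m (f ∘ suc) ∎
  where
  open ≤-Reasoning
  lemma : ∀ a w Y κ δ → suc a * w * (Y + a * δ) + κ ≡ a * w * (Y + a * δ) + (w * (Y + a * δ) + κ)
  lemma = solve-∀

module TopLayers (L K : Space) (A B : Pt (L ⊗ K) → Bool) (sep : Separated (L ⊗ K) A B)
                 (only-top : ∀ l k → l ≢ Space.top L → A (l , k) ≡ false) where
  private
    module L = Space L
    module K = Space K
  open Layers L K A B sep

  τ ρ : ℕ
  τ = L.top-weight
  ρ = L.rest-weight

  empty : ∀ {k} → A (L.top , k) ≡ false → Empty A k
  empty {k} e l with L.top? l
  ... | yes refl = e
  ... | no ne    = only-top l k ne

  inside : ∀ {k} → A (L.top , k) ≡ true → ρ ≤ layer k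
  inside e = layer-below e K.≽-refl λ l → only-top l _

  outside-above : ∀ {k₀ k} → A (L.top , k₀) ≡ true → A (L.top , k) ≡ false → k K.≽ k₀ → τ ≤ layer k
  outside-above p e k≽ = layer-above-top p k≽ (empty e)

  outside-below : ∀ {k₀ k} → A (L.top , k₀) ≡ true → A (L.top , k) ≡ false → k₀ K.≽ k → τ + ρ ≤ layer k
  outside-below p e k≽ = layer-below-full p k≽ (empty e)

  above : ∀ {k₀ k} → A (L.top , k₀) ≡ true → k K.≽ k₀ → τ ⊓ ρ ≤ layer k
  above {k = k} p k≽ with A (L.top , k) in e
  ... | true  = ≤-trans (m⊓n≤n τ ρ) (inside e)
  ... | false = ≤-trans (m⊓n≤m τ ρ) (outside-above p e k≽)

  below : ∀ {k₀ k} → A (L.top , k₀) ≡ true → k₀ K.≽ k → ρ ≤ layer k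
  below p k≽ = layer-below p k≽ λ l → only-top l _

all-top : ∀ L K (A : Pt (L ⊗ K) → Bool) →
          (∃[ l ] ∃[ k ] l ≢ Space.top L × A (l , k) ≡ true) ⊎ (∀ l k → l ≢ Space.top L → A (l , k) ≡ false)
all-top L K A with Space.search (L ⊗ K) (λ x → A x ∧ not (does (Space.top? L (proj₁ x))))
... | inj₁ ((l , k) , e) = inj₁ (l , k , split e)
  where
  split : A (l , k) ∧ not (does (Space.top? L l)) ≡ true → l ≢ Space.top L × A (l , k) ≡ true
  split e with A (l , k) | Space.top? L l
  ... | true | no ne = ne , refl
... | inj₂ h = inj₂ λ l k ne → split l k ne (h (l , k))
  where
  split : ∀ l k → l ≢ Space.top L → A (l , k) ∧ not (does (Space.top? L l)) ≡ false → A (l , k) ≡ false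
  split l k ne e with A (l , k) | Space.top? L l
  ... | false | _     = refl
  ... | true  | yes p = contradiction p ne

-- One more chain in a cut bound, by slicing along it. `hcut` is for two families that meet the top
-- layer, `hup` for one that misses it and has a non-top point, `htop` for one that lies over the
-- top of `L`: it costs the top weight in the top layer and the rest weight in every other.
module _ (L : Space) (a m γ₀ γ : ℕ) (cb : CutBound L γ₀)
  (rest≤top : Space.rest-weight L ≤ Space.top-weight L)
  (hcut : γ ≤ a * pow a m * γ₀)
  (hfull : γ ≤ a * pow a m * (Space.top-weight L + Space.rest-weight L))
  (hup : ∀ l → l ≢ Space.top L → γ ≤ a * pow a m * Space.up-weight L l)
  (htop : γ ≤ a * pow a m * Space.top-weight L + pow a m * Space.rest-weight L)
  where
  private
    module L = Space L

    C : Space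
    C = Chain a (suc m)

    half : ∀ A B → Separated (L ⊗ C) A B → Nonempty (L ⊗ C) A → (∀ l → A (l , zero) ≡ false) →
           γ ≤ Space.∑ (L ⊗ C) (Space.separator (L ⊗ C) A B)
    half A B sep ((l₀ , k₀) , p) hA with all-top L C A
    ... | inj₁ (l , k , ne , q) =
      ≤-trans (hup l ne) (≤-trans (*-monoʳ-≤ (a * pow a m) (Layers.layer-above L C A B sep q z≤n hA)) (m≤m+n _ _))
    ... | inj₂ only-top = ≤-trans htop (+-mono-≤ (*-monoʳ-≤ (a * pow a m) (outside-above p′ (hA L.top) z≤n))
                                                 (chainSum-≥ a m (λ j → rest≤ (suc j))))
      where
      open TopLayers L C A B sep only-top
      open Layers L C A B sep using (layer)
      p′ : A (L.top , k₀) ≡ true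
      p′ with L.top? l₀
      ... | yes refl = p
      ... | no ne    = contradiction (only-top l₀ k₀ ne) (true≢false p)
      rest≤ : ∀ k → ρ ≤ layer k
      rest≤ k with Fin.≤-total k k₀
      -- Over a point of `A` a layer costs ρ or τ according to whether `A` meets it; `rest≤top`
      -- makes ρ the smaller.
      ... | inj₁ k≤ = ≤-trans (≤-reflexive (sym (m≥n⇒m⊓n≡n rest≤top))) (above p′ k≤)
      ... | inj₂ k≥ = below p′ k≥

  ⊗-chain-cutBound : CutBound (L ⊗ C) γ
  ⊗-chain-cutBound A B nA nB sep with L.search (λ l → A (l , zero)) | L.search (λ l → B (l , zero))
  ... | inj₂ hA | _ = half A B sep nA hA
  ... | inj₁ _ | inj₂ hB = ≤-trans (half B A (separated-sym (L ⊗ C) sep) nB hB)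
                             (≤-reflexive (Space.∑-cong (L ⊗ C) (separator-comm (L ⊗ C) B A)))
  ... | inj₁ (_ , p) | inj₁ (_ , q) = ≤-trans hcut
      (≤-trans (*-monoʳ-≤ (a * pow a m) (Layers.layer-cut L C A B sep cb zero p q)) (m≤m+n _ _))

-- The grid of the last two chains

-- The top carries the share a/(a + 1) of the total weight `pow a m`, or all of it in a chain of one
-- point.
chainSum-zero : ∀ a m f → a * pow a m * f zero ≤ suc a * chainSum a m f
chainSum-zero a zero f = ≤-trans (≤-reflexive (cong (_* f zero) (*-identityʳ a))) (*-monoˡ-≤ (f zero) (n≤1+n a))
chainSum-zero a (suc m) f = begin
  a * (suc a * pow a m) * f zero            ≡⟨ lemma a (pow a m) (f zero) ⟩
  suc a * (a * pow a m * f zero)            ≤⟨ *-monoʳ-≤ (suc a) (m≤m+n _ _) ⟩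
  suc a * (a * pow a m * f zero + _)        ∎
  where
  open ≤-Reasoning
  lemma : ∀ a w x → a * (suc a * w) * x ≡ suc a * (a * w * x)
  lemma = solve-∀

chainSum-at-last : ∀ a m {f c d} → (∀ j → j ≢ fromℕ m → f j ≡ c) → f (fromℕ m) ≡ d → chainSum a m f + c ≡ pow a m * c + d
chainSum-at-last a zero {f} {c} {d} h h′ = trans (cong (_+ c) h′) (trans (+-comm d c) (cong (_+ d) (sym (*-identityˡ c))))
chainSum-at-last a (suc m) {f} {c} {d} h h′ = begin
  a * pow a m * f zero + chainSum a m (f ∘ suc) + c ≡⟨ cong (λ x → a * pow a m * x + chainSum a m (f ∘ suc) + c) (h zero λ ()) ⟩
  a * pow a m * c + chainSum a m (f ∘ suc) + c ≡⟨ +-assoc (a * pow a m * c) _ c ⟩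
  a * pow a m * c + (chainSum a m (f ∘ suc) + c) ≡⟨ cong (a * pow a m * c +_) (chainSum-at-last a m (λ j ne → h (suc j) (ne ∘ Fin.suc-injective)) h′) ⟩
  a * pow a m * c + (pow a m * c + d) ≡⟨ lemma a (pow a m) c d ⟩
  suc a * pow a m * c + d                                  ∎
  where
  open ≡-Reasoning
  lemma : ∀ a w c d → a * w * c + (w * c + d) ≡ suc a * w * c + d
  lemma = solve-∀

deepest : ∀ {n} (f : Fin n → Bool) j → f j ≡ true → ∃[ j₀ ] f j₀ ≡ true × (∀ j → j₀ Fin.< j → f j ≡ false)
deepest {suc n} f j e with finSearch (f ∘ suc)
... | inj₁ (j₁ , e₁) = let j₀ , e₀ , h = deepest (f ∘ suc) j₁ e₁ in suc j₀ , e₀ , λ { (suc j) (s≤s lt) → h j lt }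
... | inj₂ h with j
...   | zero  = zero , e , λ { (suc j) _ → h j }
...   | suc i = contradiction (h i) (true≢false e)

false-or-true : ∀ b → b ≡ false ⊎ b ≡ true
false-or-true false = inj₁ refl
false-or-true true  = inj₂ refl

-- Here a = p_{r−1} − 1, m = n_{r−1} − 1 and b = p_r − 1; the size of Z_r^1 is z times pow a m.
record GridHyps (L : Space) (a m b : ℕ) : Set where
  open Space L using (top; top-weight; rest-weight; up-weight)
  τ : ℕ
  τ = top-weight
  ρ : ℕ
  ρ = rest-weight
  z : ℕ
  z = a * (b * τ + ρ) + (τ + ρ)
  field
    4≤a   : 4 ≤ a
    2+a≤b : 2 + a ≤ b
    1≤τ   : 1 ≤ τ
    ρ≤2τ  : ρ ≤ 2 * τ
    τ≤2ρ  : τ ≤ 2 * ρ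
    γ     : ℕ
    bound : CutBound L γ
    hγ    : z < a * b * γ
    -- In the first case the loss u in the top layer already exceeds the size of Z_r^1. The second
    -- is for p₁ = 2, where the missing amount is supplied either by τ in the upper layer of the
    -- next column, whose share of the weight is a/(a + 1), or by γ, half of τ + ρ, in the lower
    -- layer of the top column.
    hup   : ∀ l → l ≢ top → ∀ u → up-weight l ≤ u →
            z < a * b * u ⊎
            (2 * γ ≡ τ + ρ × τ ≤ ρ × suc a * z < suc a * (a * b * u) + a * b * τ × 2 * z < 2 * (a * b * u) + a * (τ + ρ))

module Grid (L : Space) (a m b : ℕ) where
  private
    module L = Space L
  K : Space
  K = Chain a (suc m) ⊗ Chain b 1
  G : Space
  G = L ⊗ K
  module G = Space G
  M : ℕ
  M = pow a m

  -- ζr is Z_r^1 and ζm is Z_{r−1}^{n_{r−1}}: membership in the two candidate cut-sets.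
  ζr ζm : G.Pt → Bool
  ζr (l , j , v) = not (does (v Fin.≟ zero)) xor (does (j Fin.≟ zero) ∧ does (L.top? l))
  ζm (l , j , v) = does (j Fin.≟ fromℕ (suc m)) xor (does (v Fin.≟ zero) ∧ does (L.top? l))

  Avoids : (ζ A : G.Pt → Bool) → Set
  Avoids ζ A = ∀ x → ζ x ≡ true → A x ≡ false

  module Columns (hyps : GridHyps L a m b) (A B : G.Pt → Bool) (sep : Separated G A B) where
    open GridHyps hyps
    open Layers L K A B sep

    total : ℕ
    total = G.∑ (G.separator A B)

    -- The two layers over j, weighted as in the chain of p_r; only the chain of p_{r-1} is left to
    -- sum over.
    col : Fin (suc (suc m)) → ℕ
    col j = b * layer (j , zero) + layer (j , suc zero)

    total≡ : total ≡ chainSum a (suc m) col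
    total≡ = begin
      b * 1 * chainSum a (suc m) hi + chainSum a (suc m) lo ≡⟨ cong (λ x → x * chainSum a (suc m) hi + chainSum a (suc m) lo) (*-identityʳ b) ⟩
      b * chainSum a (suc m) hi + chainSum a (suc m) lo ≡⟨ cong (_+ chainSum a (suc m) lo) (sym (Space.∑-* (Chain a (suc m)) b hi)) ⟩
      chainSum a (suc m) (λ j → b * hi j) + chainSum a (suc m) lo ≡⟨ sym (chainSum-+ a (suc m) (λ j → b * hi j) lo) ⟩
      chainSum a (suc m) col                                       ∎
      where
      open ≡-Reasoning
      hi lo : Fin (suc (suc m)) → ℕ
      hi j = layer (j , zero)
      lo j = layer (j , suc zero)

    1≤a : 1 ≤ a
    1≤a = ≤-trans (s≤s z≤n) 4≤a

    M>0 : NonZero M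
    M>0 = >-nonZero (pow-pos a m)

    -- The top column weighs a M and all the others together M.
    two-levels : ∀ x y → x ≤ col zero → (∀ j → y ≤ col (suc j)) → z < a * x + y → M * z < total
    two-levels x y hx hy lt = begin-strict
      M * z                             <⟨ *-monoʳ-< M {{M>0}} lt ⟩
      M * (a * x + y)                   ≡⟨ lemma M a x y ⟩
      a * M * x + M * y ≤⟨ +-mono-≤ (*-monoʳ-≤ (a * M) hx) (chainSum-≥ a m hy) ⟩
      a * M * col zero + chainSum a m (col ∘ suc) ≡⟨ sym total≡ ⟩
      total ∎
      where
      open ≤-Reasoning
      lemma : ∀ M a x y → M * (a * x + y) ≡ a * M * x + M * y
      lemma = solve-∀

    by-top-layer : ∀ {x} → x ≤ layer (zero , zero) → z < a * b * x → M * z < total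
    by-top-layer {x} hx lt = two-levels (b * x) 0 (≤-trans (*-monoʳ-≤ b hx) (m≤m+n _ _)) (λ _ → z≤n)
      (≤-trans lt (≤-reflexive (trans (*-assoc a b x) (sym (+-identityʳ _)))))

  module Half (hyps : GridHyps L a m b) (A B : G.Pt → Bool) (sep : Separated G A B)
              (hA : ∀ l → A (l , zero , zero) ≡ false) where
    open GridHyps hyps
    open Layers L K A B sep
    open Columns hyps A B sep

    -- A loss of γ, or a large enough up-weight, in the top layer settles the matter. Otherwise the
    -- small loss u < γ there forces a loss of γ in every layer that `A` meets, and this pays the
    -- difference.
    not-only-top : ∀ {l k} → l ≢ L.top → A (l , k) ≡ true → M * z < total
    not-only-top {l₀} {j₀ , v₀} ne p
      with hup l₀ ne (layer (zero , zero)) (layer-above p (z≤n , z≤n) hA) | γ ≤? layer (zero , zero)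
    ... | _ | yes γ≤u = by-top-layer γ≤u hγ
    ... | inj₁ lt | no _ = by-top-layer ≤-refl lt
    ... | inj₂ (γ½ , τ≤ρ , h₁ , h₂) | no γ≰u = rest j₀ v₀ p
      where
      open ≤-Reasoning
      u : ℕ
      u = layer (zero , zero)
      γ≤layer : ∀ {l k} → A (l , k) ≡ true → γ ≤ layer k
      γ≤layer {l} {k} q with L.search (λ l → B (l , k))
      ... | inj₁ (_ , q′) = layer-cut bound k q q′
      -- With no `B` in the layer, it and the top layer together lose τ + ρ = 2γ, of which the top
      -- layer covers less than γ.
      ... | inj₂ hB = +-cancelʳ-≤ γ γ (layer k) (begin
        γ + γ           ≡⟨ cong (γ +_) (sym (+-identityʳ γ)) ⟩
        2 * γ           ≡⟨ γ½ ⟩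
        τ + ρ           ≤⟨ layer-A-only hA hB ⟩
        layer k + u     ≤⟨ +-monoʳ-≤ (layer k) (<⇒≤ (≰⇒> γ≰u)) ⟩
        layer k + γ     ∎)
      τ≤γ : τ ≤ γ
      τ≤γ = *-cancelˡ-≤ 2 (begin
        2 * τ      ≡⟨ cong (τ +_) (+-identityʳ τ) ⟩
        τ + τ      ≤⟨ +-monoʳ-≤ τ τ≤ρ ⟩
        τ + ρ      ≡⟨ sym γ½ ⟩
        2 * γ      ∎)
      rest : ∀ j₀ v₀ → A (l₀ , j₀ , v₀) ≡ true → M * z < total
      rest zero zero p = contradiction (hA l₀) (true≢false p)
      rest zero (suc zero) p = two-levels (b * u + γ) 0 (+-monoʳ-≤ (b * u) (γ≤layer p)) (λ _ → z≤n)
        (*-cancelˡ-< 2 z _ (begin-strict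
          2 * z                                <⟨ h₂ ⟩
          2 * (a * b * u) + a * (τ + ρ) ≡⟨ cong (λ s → 2 * (a * b * u) + a * s) (sym γ½) ⟩
          2 * (a * b * u) + a * (2 * γ)        ≡⟨ lemma a b u γ ⟩
          2 * (a * (b * u + γ) + 0)            ∎))
        where
        lemma : ∀ a b u γ → 2 * (a * b * u) + a * (2 * γ) ≡ 2 * (a * (b * u + γ) + 0)
        lemma = solve-∀
      rest (suc j₀) v₀ p = *-cancelˡ-< (suc a) (M * z) total (begin-strict
          suc a * (M * z) ≡⟨ swap (suc a) M z ⟩
          M * (suc a * z) <⟨ *-monoʳ-< M {{M>0}} h₁ ⟩
          M * (suc a * (a * b * u) + a * b * τ) ≡⟨ lemma M a b u τ ⟩
          suc a * (a * M * (b * u)) + a * M * (b * τ) ≤⟨ +-mono-≤ (*-monoʳ-≤ (suc a) (*-monoʳ-≤ (a * M) (m≤m+n (b * u) _)))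
                                                                        (≤-trans (*-monoʳ-≤ (a * M) col₁) (chainSum-zero a m (col ∘ suc))) ⟩
          suc a * (a * M * col zero) + suc a * chainSum a m (col ∘ suc) ≡⟨ sym (*-distribˡ-+ (suc a) (a * M * col zero) _) ⟩
          suc a * (a * M * col zero + chainSum a m (col ∘ suc)) ≡⟨ cong (suc a *_) (sym total≡) ⟩
          suc a * total                                            ∎)
        where
        swap : ∀ x y z → x * (y * z) ≡ y * (x * z)
        swap = solve-∀
        lemma : ∀ M a b u τ → M * (suc a * (a * b * u) + a * b * τ) ≡ suc a * (a * M * (b * u)) + a * M * (b * τ)
        lemma = solve-∀
        -- This layer lies above the given point of `A`: it loses τ if `A` misses it and γ ≥ τ if
        -- `A` meets it.
        layer₁ : τ ≤ layer (suc zero , zero)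
        layer₁ with L.search (λ l → A (l , suc zero , zero))
        ... | inj₁ (_ , q) = ≤-trans τ≤γ (γ≤layer q)
        ... | inj₂ h = layer-above-top p (s≤s z≤n , z≤n) h
        col₁ : b * τ ≤ col (suc zero)
        col₁ = ≤-trans (*-monoʳ-≤ b layer₁) (m≤m+n _ _)

    module OnlyTop (only-top : ∀ l k → l ≢ L.top → A (l , k) ≡ false) where
      open TopLayers L K A B sep only-top hiding (τ; ρ)
      open ≤-Reasoning

      last : Fin (suc (suc m))
      last = fromℕ (suc m)

      T : Fin 2 → Fin (suc (suc m)) → Bool
      T v j = A (L.top , j , v)

      -- `c-hi` is what Z_{r-1}^{n_{r-1}} costs in each column but the last, `c-lo` what it costs in
      -- the last.
      c-hi c-lo μ : ℕ
      c-hi = b * τ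
      c-lo = b * ρ + (τ + ρ)
      μ = τ ⊓ ρ

      1≤ρ : 1 ≤ ρ
      1≤ρ with ρ in e
      ... | suc _ = s≤s z≤n
      ... | zero = contradiction (≤-trans 1≤τ (≤-trans τ≤2ρ (≤-reflexive (cong (2 *_) e)))) λ ()

      a<b : a < b
      a<b = ≤-trans (s≤s (n≤1+n a)) 2+a≤b

      4≤b : 4 ≤ b
      4≤b = ≤-trans 4≤a (<⇒≤ a<b)

      aρ<bρ : a * ρ < b * ρ
      aρ<bρ = *-monoˡ-< ρ {{>-nonZero 1≤ρ}} a<b

      -- A surplus μ in the top column outweighs a shortage τ in all the other columns.
      τ<aμ : τ < a * μ
      τ<aμ with ⊓-sel τ ρ
      ... | inj₁ e rewrite e = begin-strict
        τ          <⟨ m<m+n τ 1≤τ ⟩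
        τ + τ      ≡⟨ cong (τ +_) (sym (+-identityʳ τ)) ⟩
        2 * τ      ≤⟨ *-monoˡ-≤ τ (≤-trans (s≤s (s≤s z≤n)) 4≤a) ⟩
        a * τ      ∎
      ... | inj₂ e rewrite e = begin-strict
        τ          ≤⟨ τ≤2ρ ⟩
        2 * ρ      <⟨ m<n+m (2 * ρ) 1≤ρ ⟩
        3 * ρ      ≤⟨ *-monoˡ-≤ ρ (≤-trans (s≤s (s≤s (s≤s z≤n))) 4≤a) ⟩
        a * ρ      ∎

      split : ∀ v j → T v j ≡ false ⊎ T v j ≡ true
      split v j = false-or-true (T v j)

      T-zero : T zero zero ≡ false
      T-zero = hA L.top

      -- `Zm` is the size of Z_{r-1}^{n_{r-1}}: `c-lo` in the last column, which weighs 1, and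
      -- `c-hi` in the rest, written without subtraction.
      module _ {Zm : ℕ} (Zm≡ : Zm + c-hi ≡ suc a * M * c-hi + c-lo) where

        Zm-gap : ∀ {d} → c-hi + d ≡ c-lo → Zm ≡ suc a * M * c-hi + d
        Zm-gap {d} e = +-cancelʳ-≡ c-hi Zm _ (trans Zm≡ (trans (cong (suc a * M * c-hi +_) (sym e)) (lemma (suc a * M * c-hi) c-hi d)))
          where
          lemma : ∀ w x d → w + (x + d) ≡ w + d + x
          lemma = solve-∀

        -- Columns in or below T cost `c-lo`, the others `c-hi`. If `c-lo` ≤ `c-hi`, every column
        -- but the top one costs at least `c-lo`, and the total exceeds Z_r^1 because a < b.
        -- Otherwise every column costs at least `c-hi` and the last one `c-lo`, which is `Zm`, and
        -- any point of T off the last column adds to it.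
        module T₀-only (j₀ : Fin (suc (suc m))) (p₀ : T zero j₀ ≡ true) (T₁-empty : ∀ j → T (suc zero) j ≡ false) where

          col-below : ∀ j → j₀ Fin.≤ j → c-lo ≤ col j
          col-below j le = +-mono-≤ (*-monoʳ-≤ b (below p₀ (le , z≤n))) (outside-below p₀ (T₁-empty j) (le , z≤n))

          col-inside : ∀ j → T zero j ≡ true → c-lo ≤ col j
          col-inside j p = +-mono-≤ (*-monoʳ-≤ b (inside p)) (outside-below p (T₁-empty j) (≤-refl , z≤n))

          col-above : ∀ j → T zero j ≡ false → j Fin.≤ j₀ → c-hi ≤ col j
          col-above j h le = ≤-trans (*-monoʳ-≤ b (outside-above p₀ h (le , z≤n))) (m≤m+n _ _)

          col-zero : c-hi ≤ col zero
          col-zero = col-above zero T-zero z≤n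

          col-either : ∀ j → c-hi ≤ col j ⊎ c-lo ≤ col j
          col-either j with split zero j | Fin.≤-total j j₀
          ... | inj₂ p | _       = inj₂ (col-inside j p)
          ... | _      | inj₂ ge = inj₂ (col-below j ge)
          ... | inj₁ h | inj₁ le = inj₁ (col-above j h le)

          result : M * z < total ⊎ Zm < total ⊎ Avoids ζm A × Avoids ζm B
          result with c-lo ≤? c-hi
          ... | yes lo≤hi = inj₁ (two-levels c-hi c-lo col-zero
                  (λ j → [ ≤-trans lo≤hi , (λ x → x) ]′ (col-either (suc j))) (begin-strict
                    a * (b * τ + ρ) + (τ + ρ)                ≡⟨ lemma a b τ ρ ⟩
                    a * (b * τ) + (a * ρ + (τ + ρ)) <⟨ +-monoʳ-< (a * (b * τ)) (+-monoˡ-< (τ + ρ) aρ<bρ) ⟩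
                    a * c-hi + c-lo                          ∎))
            where
            lemma : ∀ a b τ ρ → a * (b * τ + ρ) + (τ + ρ) ≡ a * (b * τ) + (a * ρ + (τ + ρ))
            lemma = solve-∀
          ... | no lo≰hi with m≤n⇒∃[o]m+o≡n (<⇒≤ (≰⇒> lo≰hi)) | finSearch (λ j → T zero j ∧ not (does (j Fin.≟ last)))
          ...   | d , hi+d≡lo | inj₁ (j₁ , e) = inj₂ (inj₁ (begin-strict
                    Zm                          ≡⟨ Zm-gap hi+d≡lo ⟩
                    suc a * M * c-hi + d <⟨ chainSum-last-strict a (suc m) 1≤a all-hi
                                                     (≤-trans (≤-reflexive hi+d≡lo) (col-below last (Fin.≤fromℕ j₀)))
                                                     (proj₂ (sep′ e)) (<-≤-trans (≰⇒> lo≰hi) (col-inside j₁ (proj₁ (sep′ e)))) ⟩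
                    chainSum a (suc m) col      ≡⟨ sym total≡ ⟩
                    total                       ∎))
            where
            sep′ : T zero j₁ ∧ not (does (j₁ Fin.≟ last)) ≡ true → T zero j₁ ≡ true × j₁ ≢ last
            sep′ e with T zero j₁ | j₁ Fin.≟ last
            ... | true | no ne = refl , ne
            all-hi : ∀ j → c-hi ≤ col j
            all-hi j = [ (λ x → x) , ≤-trans (<⇒≤ (≰⇒> lo≰hi)) ]′ (col-either j)
          ...   | _ | inj₂ none = inj₂ (inj₂ (avoidA , avoidB))
            where
            none′ : ∀ j → j ≢ last → T zero j ≡ false
            none′ j ne with none j
            ... | e with T zero j | j Fin.≟ last
            ... | false | _     = refl
            ... | true  | yes q = contradiction q ne
            p-last : T zero last ≡ true
            p-last with j₀ Fin.≟ last
            ... | yes refl = p₀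
            ... | no ne    = contradiction (none′ j₀ ne) (true≢false p₀)
            avoidA : Avoids ζm A
            avoidA (l , j , v) e with L.top? l
            ... | no ne = only-top l (j , v) ne
            avoidA (l , j , suc zero) e | yes refl = T₁-empty j
            avoidA (l , j , zero) e | yes refl with j Fin.≟ last
            ... | no ne = none′ j ne
            avoidB : Avoids ζm B
            avoidB (l , j , v) e with j Fin.≟ last
            ... | yes refl = below-false p-last (L.top-≽ l) (≤-refl , z≤n)
            avoidB (l , j , v) e | no _ with L.top? l
            avoidB (l , j , zero) e | no _ | yes refl = above-false p-last L.≽-refl (Fin.≤fromℕ j , z≤n)

        -- The point of T in the second row can save τ in the columns at or below the first row of
        -- T, but it makes the top column dearer by μ; `τ<aμ` decides.
        module T₀-T₁ (j₀ : Fin (suc (suc m))) (p₀ : T zero j₀ ≡ true) (j₁ : Fin (suc (suc m))) (p₁ : T (suc zero) j₁ ≡ true) where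

          low : ∀ j → μ ≤ layer (j , suc zero)
          low j with Fin.≤-total j j₁
          ... | inj₁ le = above p₁ (le , ≤-refl)
          ... | inj₂ ge = ≤-trans (m⊓n≤n τ ρ) (below p₁ (ge , ≤-refl))

          col-below : ∀ j → j₀ Fin.≤ j → b * ρ + ρ ≤ col j
          col-below j le = +-mono-≤ (*-monoʳ-≤ b (below p₀ (le , z≤n))) (below p₀ (le , z≤n))

          col-above : ∀ j → T zero j ≡ false → j Fin.≤ j₀ → c-hi + μ ≤ col j
          col-above j h le = +-mono-≤ (*-monoʳ-≤ b (outside-above p₀ h (le , z≤n))) (low j)

          col-inside : ∀ j → T zero j ≡ true → b * ρ + ρ ≤ col j
          col-inside j p = +-mono-≤ (*-monoʳ-≤ b (inside p)) (below p (≤-refl , z≤n))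

          col-either : ∀ j → c-hi ≤ col j ⊎ b * ρ + ρ ≤ col j
          col-either j with split zero j | Fin.≤-total j j₀
          ... | inj₂ p | _       = inj₂ (col-inside j p)
          ... | _      | inj₂ ge = inj₂ (col-below j ge)
          ... | inj₁ h | inj₁ le = inj₁ (≤-trans (m≤m+n c-hi μ) (col-above j h le))

          col-zero : c-hi + μ ≤ col zero
          col-zero = col-above zero T-zero z≤n

          c-lo≡ : ∀ b τ ρ → b * ρ + (τ + ρ) ≡ b * ρ + ρ + τ
          c-lo≡ = solve-∀

          result : M * z < total ⊎ Zm < total
          result with c-lo ≤? c-hi
          ... | yes lo≤hi = inj₁ (two-levels (c-hi + μ) (b * ρ + ρ) col-zero
                  (λ j → [ ≤-trans (≤-trans (m≤m+n (b * ρ + ρ) τ) (≤-trans (≤-reflexive (sym (c-lo≡ b τ ρ))) lo≤hi)) , (λ x → x) ]′ (col-either (suc j)))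
                  (begin-strict
                    a * (b * τ + ρ) + (τ + ρ)                ≡⟨ lemma a b τ ρ ⟩
                    a * (b * τ) + τ + (a * ρ + ρ) <⟨ +-mono-< (+-monoʳ-< (a * (b * τ)) τ<aμ) (+-monoˡ-< ρ aρ<bρ) ⟩
                    a * (b * τ) + a * μ + (b * ρ + ρ) ≡⟨ cong (_+ (b * ρ + ρ)) (sym (*-distribˡ-+ a (b * τ) μ)) ⟩
                    a * (c-hi + μ) + (b * ρ + ρ)             ∎))
            where
            lemma : ∀ a b τ ρ → a * (b * τ + ρ) + (τ + ρ) ≡ a * (b * τ) + τ + (a * ρ + ρ)
            lemma = solve-∀
          ... | no lo≰hi with m≤n⇒∃[o]m+o≡n (<⇒≤ (≰⇒> lo≰hi))
          -- Adding τ to every column but the top one restores the costs `c-hi` and `c-lo`; M τ is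
          -- the price of this on both sides.
          ...   | d , hi+d≡lo = inj₂ (+-cancelʳ-< (M * τ) Zm total (begin-strict
                    Zm + M * τ ≡⟨ cong (_+ M * τ) (Zm-gap hi+d≡lo) ⟩
                    suc a * M * c-hi + d + M * τ <⟨ +-monoʳ-< (suc a * M * c-hi + d) (*-monoʳ-< M {{M>0}} τ<aμ) ⟩
                    suc a * M * c-hi + d + M * (a * μ) ≡⟨ lemma a M c-hi d μ ⟩
                    a * M * (c-hi + μ) + (M * c-hi + d) ≤⟨ +-mono-≤ (*-monoʳ-≤ (a * M) col-zero)
                                                                              (chainSum-last a m {f = λ j → col (suc j) + τ} all-hi last-lo) ⟩
                    a * M * col zero + chainSum a m (λ j → col (suc j) + τ) ≡⟨ cong (a * M * col zero +_) (trans (chainSum-+ a m (col ∘ suc) (λ _ → τ))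
                                                                                 (cong (chainSum a m (col ∘ suc) +_) (chainSum-const a m τ))) ⟩
                    a * M * col zero + (chainSum a m (col ∘ suc) + M * τ) ≡⟨ sym (+-assoc (a * M * col zero) _ _) ⟩
                    a * M * col zero + chainSum a m (col ∘ suc) + M * τ ≡⟨ cong (_+ M * τ) (sym total≡) ⟩
                    total + M * τ                                        ∎))
            where
            lemma : ∀ a M c d μ → suc a * M * c + d + M * (a * μ) ≡ a * M * (c + μ) + (M * c + d)
            lemma = solve-∀
            all-hi : ∀ j → c-hi ≤ col (suc j) + τ
            all-hi j with col-either (suc j)
            ... | inj₁ h = ≤-trans h (m≤m+n _ τ)
            ... | inj₂ h = ≤-trans (<⇒≤ (≰⇒> lo≰hi)) (≤-trans (≤-reflexive (c-lo≡ b τ ρ)) (+-monoˡ-≤ τ h))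
            last-lo : c-hi + d ≤ col (suc (fromℕ m)) + τ
            last-lo = ≤-trans (≤-reflexive hi+d≡lo) (≤-trans (≤-reflexive (c-lo≡ b τ ρ)) (+-monoˡ-≤ τ (col-below last (Fin.≤fromℕ j₀))))

        module T₁-only (T₀-empty : ∀ j → T zero j ≡ false) where

          b2 : 2 ≤ b
          b2 = ≤-trans (s≤s (s≤s z≤n)) 4≤b

          τ+ρ<bτ+ρ : τ + ρ < b * τ + ρ
          τ+ρ<bτ+ρ = +-monoˡ-< ρ (begin-strict
            τ          <⟨ m<m+n τ 1≤τ ⟩
            τ + τ      ≡⟨ cong (τ +_) (sym (+-identityʳ τ)) ⟩
            2 * τ      ≤⟨ *-monoˡ-≤ τ b2 ⟩
            b * τ      ∎)

          col-inside : ∀ j → T (suc zero) j ≡ true → b * τ + ρ ≤ col j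
          col-inside j p = +-mono-≤ (*-monoʳ-≤ b (outside-above p (T₀-empty j) (≤-refl , z≤n))) (inside p)

          col-below : ∀ {j j₁} → T (suc zero) j₁ ≡ true → T (suc zero) j ≡ false → j₁ Fin.≤ j → τ + ρ ≤ col j
          col-below p h le = ≤-trans (outside-below p h (le , ≤-refl)) (m≤n+m _ _)

          -- b τ + ρ in the top column and τ + ρ in each other column add up to M z. A further point
          -- of T raises its own column to b τ + ρ.
          at-zero : T (suc zero) zero ≡ true → M * z < total ⊎ Avoids ζr A × Avoids ζr B
          at-zero p₁ with finSearch (λ j → T (suc zero) (suc j))
          ... | inj₁ (j₂ , p₂) = inj₁ (begin-strict
            M * z ≡⟨ lemma M a (b * τ + ρ) (τ + ρ) ⟩
            a * M * (b * τ + ρ) + M * (τ + ρ) <⟨ +-mono-≤-< (*-monoʳ-≤ (a * M) (col-inside zero p₁))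
                                                           (chainSum-> a m 1≤a nontop (<-≤-trans τ+ρ<bτ+ρ (col-inside (suc j₂) p₂))) ⟩
            a * M * col zero + chainSum a m (col ∘ suc) ≡⟨ sym total≡ ⟩
            total                                      ∎)
            where
            lemma : ∀ M a x y → M * (a * x + y) ≡ a * M * x + M * y
            lemma = solve-∀
            nontop : ∀ j → τ + ρ ≤ col (suc j)
            nontop j with split (suc zero) (suc j)
            ... | inj₁ h = col-below p₁ h z≤n
            ... | inj₂ p = ≤-trans (<⇒≤ τ+ρ<bτ+ρ) (col-inside (suc j) p)
          ... | inj₂ none = inj₂ (avoidA , avoidB)
            where
            avoidA : Avoids ζr A
            avoidA (l , j , v) e with L.top? l
            ... | no ne = only-top l (j , v) ne
            avoidA (l , j , zero) e | yes refl = T₀-empty j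
            avoidA (l , suc j , suc zero) e | yes refl = none j
            avoidB : Avoids ζr B
            avoidB (l , j , suc zero) e = below-false p₁ (L.top-≽ l) (z≤n , ≤-refl)
            avoidB (l , j , zero) e with L.top? l
            avoidB (l , zero , zero) e | yes refl = above-false p₁ L.≽-refl (z≤n , z≤n)

          -- Now the top column costs b τ + τ instead of b τ + ρ. This is a gain for ρ < τ;
          -- otherwise the deficit δ = ρ - τ, weighted by a M, has to be recovered from the columns
          -- down to the deepest point of T.
          module Below (T₁-zero : T (suc zero) zero ≡ false) (j₁ : Fin (suc m)) (p₁ : T (suc zero) (suc j₁) ≡ true)
                       (deep : ∀ j → j₁ Fin.< j → T (suc zero) (suc j) ≡ false) where

            col-zero : b * τ + τ ≤ col zero
            col-zero = +-mono-≤ (*-monoʳ-≤ b (outside-above p₁ T-zero (z≤n , z≤n))) (outside-above p₁ T₁-zero (z≤n , ≤-refl))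

            col-above : ∀ j → j Fin.≤ j₁ → b * τ + μ ≤ col (suc j)
            col-above j le = +-mono-≤ (*-monoʳ-≤ b (outside-above p₁ (T₀-empty (suc j)) (s≤s le , z≤n))) (above p₁ (s≤s le , ≤-refl))

            col-deep : ∀ j → j₁ Fin.< j → τ + ρ ≤ col (suc j)
            col-deep j lt = col-below p₁ (deep j lt) (s≤s (<⇒≤ lt))

            dense : ρ < τ → M * z < total
            dense ρ<τ = two-levels (b * τ + τ) (τ + ρ) col-zero nontop
                (+-monoˡ-< (τ + ρ) (*-monoʳ-< a {{>-nonZero 1≤a}} (+-monoʳ-< (b * τ) ρ<τ)))
              where
              nontop : ∀ j → τ + ρ ≤ col (suc j)
              nontop j with j Fin.≤? j₁
              ... | no nle = col-deep j (≰⇒> nle)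
              ... | yes le = ≤-trans (<⇒≤ τ+ρ<bτ+ρ) (≤-trans (≤-reflexive (cong (b * τ +_) (sym (m≥n⇒m⊓n≡n (<⇒≤ ρ<τ))))) (col-above j le))

            module Sparse (δ : ℕ) (τ+δ : τ + δ ≡ ρ) where

              μ≡τ : μ ≡ τ
              μ≡τ = m≤n⇒m⊓n≡m (≤-trans (m≤m+n τ δ) (≤-reflexive τ+δ))

              -- A column over the deepest point of T exceeds τ + ρ by a δ, its share of the
              -- deficit, because δ ≤ τ and a + 2 ≤ b; κ is what remains.
              slack : ∃[ κ ] τ + ρ + κ + a * δ ≡ b * τ + τ
              slack with m≤n⇒∃[o]m+o≡n {τ + ρ + a * δ} {b * τ + τ} (begin
                τ + ρ + a * δ ≡⟨ cong (λ r → τ + r + a * δ) (sym τ+δ) ⟩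
                τ + (τ + δ) + a * δ         ≡⟨ lemma τ δ a ⟩
                2 * τ + suc a * δ ≤⟨ +-monoʳ-≤ (2 * τ) (*-monoʳ-≤ (suc a) δ≤τ) ⟩
                2 * τ + suc a * τ           ≡⟨ lemma′ τ a ⟩
                (2 + a) * τ + τ             ≤⟨ +-monoˡ-≤ τ (*-monoˡ-≤ τ 2+a≤b) ⟩
                b * τ + τ                   ∎)
                where
                lemma : ∀ τ δ a → τ + (τ + δ) + a * δ ≡ 2 * τ + suc a * δ
                lemma = solve-∀
                lemma′ : ∀ τ a → 2 * τ + suc a * τ ≡ (2 + a) * τ + τ
                lemma′ = solve-∀
                δ≤τ : δ ≤ τ
                δ≤τ = +-cancelˡ-≤ τ δ τ (≤-trans (≤-reflexive τ+δ) (≤-trans ρ≤2τ (≤-reflexive (cong (τ +_) (+-identityʳ τ)))))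
              ... | κ , e = κ , trans (swap (τ + ρ) κ (a * δ)) e
                where
                swap : ∀ x y z → x + y + z ≡ x + z + y
                swap = solve-∀

              κ : ℕ
              κ = proj₁ slack

              excess : chainSum a m (col ∘ suc) ≥ M * (τ + ρ + a * δ) + κ
              excess = chainSum-deep a m j₁ 1≤a
                (λ j lt → ≤-trans (≤-reflexive (trans (proj₂ slack) (cong (b * τ +_) (sym μ≡τ)))) (col-above j (<⇒≤ lt)))
                (≤-trans (≤-reflexive (trans (cong (_+ δ) (proj₂ slack)) (trans (+-assoc (b * τ) τ δ) (cong (b * τ +_) τ+δ)))) (col-inside (suc j₁) p₁))
                col-deep

              total≥ : M * z + κ ≤ total
              total≥ = begin
                M * z + κ ≡⟨ cong (λ r → M * (a * (b * τ + r) + (τ + ρ)) + κ) (sym τ+δ) ⟩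
                M * (a * (b * τ + (τ + δ)) + (τ + ρ)) + κ ≡⟨ lemma M a (b * τ) τ δ (τ + ρ) κ ⟩
                a * M * (b * τ + τ) + (M * (τ + ρ + a * δ) + κ) ≤⟨ +-mono-≤ (*-monoʳ-≤ (a * M) col-zero) excess ⟩
                a * M * col zero + chainSum a m (col ∘ suc) ≡⟨ sym total≡ ⟩
                total                                                        ∎
                where
                lemma : ∀ M a x τ δ y κ → M * (a * (x + (τ + δ)) + y) + κ ≡ a * M * (x + τ) + (M * (y + a * δ) + κ)
                lemma = solve-∀

              -- Only κ = 0 leaves equality with M z possible. Then b = a + 2 and ρ = 2 τ. For m = 0
              -- the two columns are computed exactly and exceed M z; for m > 0 the other candidate
              -- `Zm` is smaller than M z.
              result : M * z < total ⊎ Zm < total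
              result with κ in κ≡
              ... | suc κ′ = inj₁ (<-≤-trans (m<m+n (M * z) (s≤s z≤n)) (subst (λ k → M * z + k ≤ total) κ≡ total≥))
              ... | zero with tie
                where
                -- No slack forces equality in ρ ≤ 2 τ and in a + 2 ≤ b.
                tie : b ≡ 2 + a × δ ≡ τ
                tie = b≡ , δ≡
                  where
                  δ≤τ : δ ≤ τ
                  δ≤τ = +-cancelˡ-≤ τ δ τ (≤-trans (≤-reflexive τ+δ) (≤-trans ρ≤2τ (≤-reflexive (cong (τ +_) (+-identityʳ τ)))))
                  key : 2 * τ + suc a * δ ≡ b * τ + τ
                  key = trans (lemma τ δ a) (trans (cong (λ r → τ + r + 0 + a * δ) τ+δ) (subst (λ k → τ + ρ + k + a * δ ≡ b * τ + τ) κ≡ (proj₂ slack)))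
                    where
                    lemma : ∀ τ δ a → 2 * τ + suc a * δ ≡ τ + (τ + δ) + 0 + a * δ
                    lemma = solve-∀
                  lemma′ : ∀ τ a → 2 * τ + suc a * τ ≡ (2 + a) * τ + τ
                  lemma′ = solve-∀
                  b≡ : b ≡ 2 + a
                  b≡ = ≤-antisym (*-cancelʳ-≤ b (2 + a) τ {{>-nonZero 1≤τ}} (+-cancelʳ-≤ τ (b * τ) ((2 + a) * τ) (begin
                      b * τ + τ              ≡⟨ sym key ⟩
                      2 * τ + suc a * δ ≤⟨ +-monoʳ-≤ (2 * τ) (*-monoʳ-≤ (suc a) δ≤τ) ⟩
                      2 * τ + suc a * τ      ≡⟨ lemma′ τ a ⟩
                      (2 + a) * τ + τ        ∎))) 2+a≤b
                  δ≡ : δ ≡ τ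
                  δ≡ = *-cancelˡ-≡ δ τ (suc a) (+-cancelˡ-≡ (2 * τ) _ _ (trans key (trans (cong (λ b → b * τ + τ) b≡) (sym (lemma′ τ a)))))
              ... | b≡ , δ≡ = by-length m j₁ Mz≤ Zm≡ one-step
                where
                ρ≡ : ρ ≡ 2 * τ
                ρ≡ = trans (sym τ+δ) (trans (cong (τ +_) δ≡) (cong (τ +_) (sym (+-identityʳ τ))))
                Mz≤ : M * z ≤ total
                Mz≤ = ≤-trans (m≤m+n (M * z) κ) total≥
                by-length : ∀ m → (j₁ : Fin (suc m)) → pow a m * z ≤ total → Zm + c-hi ≡ suc a * pow a m * c-hi + c-lo →
                            (m ≡ 0 → a * (b * τ + τ) + (b * τ + ρ) ≤ total) → pow a m * z < total ⊎ Zm < total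
                by-length zero _ _ _ h = inj₁ (begin-strict
                    1 * z ≡⟨ cong (1 *_) (cong₂ (λ b r → a * (b * τ + r) + (τ + r)) b≡ ρ≡) ⟩
                    1 * (a * ((2 + a) * τ + 2 * τ) + (τ + 2 * τ)) <⟨ m<m+n _ 1≤τ ⟩
                    1 * (a * ((2 + a) * τ + 2 * τ) + (τ + 2 * τ)) + τ ≡⟨ lemma a τ ⟩
                    a * ((2 + a) * τ + τ) + ((2 + a) * τ + 2 * τ) ≡⟨ sym (cong₂ (λ b r → a * (b * τ + τ) + (b * τ + r)) b≡ ρ≡) ⟩
                    a * (b * τ + τ) + (b * τ + ρ) ≤⟨ h refl ⟩
                    total                                                       ∎)
                  where
                  lemma : ∀ a τ → 1 * (a * ((2 + a) * τ + 2 * τ) + (τ + 2 * τ)) + τ ≡ a * ((2 + a) * τ + τ) + ((2 + a) * τ + 2 * τ)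
                  lemma = solve-∀
                by-length (suc m) _ Mz≤total Zm≡ _ = inj₂ (<-≤-trans (+-cancelʳ-< c-hi Zm (pow a (suc m) * z) (begin-strict
                    Zm + c-hi ≡⟨ Zm≡ ⟩
                    suc a * W * c-hi + c-lo ≡⟨ cong₂ (λ b r → suc a * W * (b * τ) + (b * r + (τ + r))) b≡ ρ≡ ⟩
                    suc a * W * ((2 + a) * τ) + ((2 + a) * (2 * τ) + (τ + 2 * τ)) <⟨ m<m+n _ 1≤τ ⟩
                    suc a * W * ((2 + a) * τ) + ((2 + a) * (2 * τ) + (τ + 2 * τ)) + τ ≡⟨ lemma (suc a * W) a τ ⟩
                    suc a * W * ((2 + a) * τ) + (2 + a) * τ + ((2 + a) + 4) * τ ≤⟨ +-monoʳ-≤ (suc a * W * ((2 + a) * τ) + (2 + a) * τ) (*-monoˡ-≤ τ enough) ⟩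
                    suc a * W * ((2 + a) * τ) + (2 + a) * τ + suc a * W * τ ≡⟨ lemma′ a W τ ⟩
                    W * (a * ((2 + a) * τ + 2 * τ) + (τ + 2 * τ)) + (2 + a) * τ ≡⟨ sym (cong₂ (λ b r → W * (a * (b * τ + r) + (τ + r)) + b * τ) b≡ ρ≡) ⟩
                    W * z + c-hi ∎)) Mz≤total)
                  where
                  W : ℕ
                  W = pow a (suc m)
                  lemma : ∀ X a τ → X * ((2 + a) * τ) + ((2 + a) * (2 * τ) + (τ + 2 * τ)) + τ ≡ X * ((2 + a) * τ) + (2 + a) * τ + ((2 + a) + 4) * τ
                  lemma = solve-∀
                  lemma′ : ∀ a W τ → suc a * W * ((2 + a) * τ) + (2 + a) * τ + suc a * W * τ ≡ W * (a * ((2 + a) * τ + 2 * τ) + (τ + 2 * τ)) + (2 + a) * τ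
                  lemma′ = solve-∀
                  lemma″ : ∀ a → (2 + a) + a ≡ suc a * 2
                  lemma″ = solve-∀
                  -- Here the exponent in W is positive, so W ≥ 2, and a ≥ 4 gives a + 6 ≤ 2 (a +
                  -- 1).
                  enough : (2 + a) + 4 ≤ suc a * W
                  enough = begin
                    (2 + a) + 4       ≤⟨ +-monoʳ-≤ (2 + a) 4≤a ⟩
                    (2 + a) + a       ≡⟨ lemma″ a ⟩
                    suc a * 2 ≤⟨ *-monoʳ-≤ (suc a) (*-mono-≤ (s≤s 1≤a) (pow-pos a m)) ⟩
                    suc a * W         ∎
                one-step : m ≡ 0 → a * (b * τ + τ) + (b * τ + ρ) ≤ total
                one-step refl = one-step′ j₁ p₁
                  where
                  one-step′ : ∀ j → T (suc zero) (suc j) ≡ true → _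
                  one-step′ zero p = begin
                    a * (b * τ + τ) + (b * τ + ρ) ≤⟨ +-mono-≤ (*-monoʳ-≤ a col-zero) (col-inside (suc zero) p) ⟩
                    a * col zero + col (suc zero) ≡⟨ cong (λ a → a * col zero + col (suc zero)) (sym (*-identityʳ a)) ⟩
                    a * 1 * col zero + col (suc zero)    ≡⟨ sym total≡ ⟩
                    total                                ∎

        outcome : ∀ {j₀ v₀} → A (L.top , j₀ , v₀) ≡ true →
                  M * z < total ⊎ Zm < total ⊎ Avoids ζr A × Avoids ζr B ⊎ Avoids ζm A × Avoids ζm B
        outcome {j₀} {v₀} p with finSearch (T zero) | finSearch (T (suc zero))
        ... | inj₁ (i , q) | inj₁ (k , r) with T₀-T₁.result i q k r
        ...   | inj₁ h = inj₁ h
        ...   | inj₂ h = inj₂ (inj₁ h)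
        outcome p | inj₁ (i , q) | inj₂ h with T₀-only.result i q h
        ...   | inj₁ h = inj₁ h
        ...   | inj₂ (inj₁ h) = inj₂ (inj₁ h)
        ...   | inj₂ (inj₂ h) = inj₂ (inj₂ (inj₂ h))
        outcome {j₀} {zero} p | inj₂ h | _ = contradiction (h j₀) (true≢false p)
        outcome {j₀} {suc zero} p | inj₂ h | _ with split (suc zero) zero
        ... | inj₂ q with T₁-only.at-zero h q
        ...   | inj₁ lt = inj₁ lt
        ...   | inj₂ av = inj₂ (inj₂ (inj₁ av))
        outcome {zero} {suc zero} p | inj₂ h | _ | inj₁ q = contradiction q (true≢false p)
        outcome {suc j₀} {suc zero} p | inj₂ h | _ | inj₁ q with deepest (λ j → T (suc zero) (suc j)) j₀ p
        ... | j₁ , p₁ , deep with τ ≤? ρ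
        ...   | no τ≰ρ = inj₁ (T₁-only.Below.dense h q j₁ p₁ deep (≰⇒> τ≰ρ))
        ...   | yes τ≤ρ with m≤n⇒∃[o]m+o≡n τ≤ρ
        ...     | δ , e with T₁-only.Below.Sparse.result h q j₁ p₁ deep δ e
        ...       | inj₁ lt = inj₁ lt
        ...       | inj₂ lt = inj₂ (inj₁ lt)

    half : ∀ {Zm x} → A x ≡ true → Zm + b * τ ≡ suc a * M * (b * τ) + (b * ρ + (τ + ρ)) →
           M * z < total ⊎ Zm < total ⊎ Avoids ζr A × Avoids ζr B ⊎ Avoids ζm A × Avoids ζm B
    half {x = l , k} p Zm≡ with all-top L K A
    ... | inj₁ (l , k , ne , p) = inj₁ (not-only-top ne p)
    ... | inj₂ only-top with L.top? l
    ...     | yes refl = OnlyTop.outcome only-top Zm≡ p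
    ...     | no ne    = contradiction (only-top l k ne) (true≢false p)

  module _ (hyps : GridHyps L a m b) where
    open GridHyps hyps

    ζr-weight : G.∑ (λ x → ⟦ ζr x ⟧) ≡ M * z
    ζr-weight = trans (cong₂ _+_ (cong (λ x → b * 1 * (a * M * τ + x)) (none (λ _ → L.∑ (λ _ → 0)) (λ _ → L.∑-0)))
                                 (cong (a * M * ρ +_) (trans (chainSum-const a m (L.∑ (λ _ → 1))) (cong (M *_) L.∑-1))))
                      (lemma M a b τ ρ)
      where
      none : ∀ f → (∀ j → f j ≡ 0) → chainSum a m f ≡ 0
      none f h = trans (Space.∑-cong (Chain a m) h) (Space.∑-0 (Chain a m))
      lemma : ∀ M a b τ ρ → b * 1 * (a * M * τ + 0) + (a * M * ρ + M * (τ + ρ)) ≡ M * (a * (b * τ + ρ) + (τ + ρ))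
      lemma = solve-∀

    ζm-weight : G.∑ (λ x → ⟦ ζm x ⟧) + b * τ ≡ suc a * M * (b * τ) + (b * ρ + (τ + ρ))
    ζm-weight = trans (lemma b τ hi lo) (trans (cong₂ (λ x y → b * x + y) hi≡ lo≡) (lemma′ b (suc a * M) τ ρ))
      where
      layer : Fin 2 → Fin (suc (suc m)) → ℕ
      layer v j = L.∑ (λ l → ⟦ ζm (l , j , v) ⟧)
      hi lo : ℕ
      hi = chainSum a (suc m) (layer zero)
      lo = chainSum a (suc m) (layer (suc zero))
      hi≡ : hi + τ ≡ suc a * M * τ + ρ
      hi≡ = chainSum-at-last a (suc m) off on
        where
        off : ∀ j → j ≢ fromℕ (suc m) → layer zero j ≡ τ
        off j ne rewrite dec-false (j Fin.≟ fromℕ (suc m)) ne = refl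
        on : layer zero (fromℕ (suc m)) ≡ ρ
        on rewrite dec-true (fromℕ (suc m) Fin.≟ fromℕ (suc m)) refl = refl
      lo≡ : lo + 0 ≡ suc a * M * 0 + (τ + ρ)
      lo≡ = chainSum-at-last a (suc m) off on
        where
        off : ∀ j → j ≢ fromℕ (suc m) → layer (suc zero) j ≡ 0
        off j ne rewrite dec-false (j Fin.≟ fromℕ (suc m)) ne = L.∑-0
        on : layer (suc zero) (fromℕ (suc m)) ≡ τ + ρ
        on rewrite dec-true (fromℕ (suc m) Fin.≟ fromℕ (suc m)) refl = L.∑-1
      lemma : ∀ b τ hi lo → b * 1 * hi + lo + b * τ ≡ b * (hi + τ) + (lo + 0)
      lemma = solve-∀
      lemma′ : ∀ b W τ ρ → b * (W * τ + ρ) + (W * 0 + (τ + ρ)) ≡ W * (b * τ) + (b * ρ + (τ + ρ))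
      lemma′ = solve-∀

    -- Two families in the top layer lose γ there. Otherwise `Half` applies to the family that
    -- misses it, and all outcomes are symmetric in `A` and `B`.
    separation : ∀ A B → Separated G A B → Nonempty G A → Nonempty G B →
      M * z < G.∑ (G.separator A B) ⊎ G.∑ (λ x → ⟦ ζm x ⟧) < G.∑ (G.separator A B) ⊎
      Avoids ζr A × Avoids ζr B ⊎ Avoids ζm A × Avoids ζm B
    separation A B sep nA nB with L.search (λ l → A (l , zero , zero)) | L.search (λ l → B (l , zero , zero))
    ... | inj₂ hA | _ = Half.half hyps A B sep hA (proj₂ nA) ζm-weight
    ... | inj₁ (_ , p) | inj₁ (_ , q) = inj₁ (Columns.by-top-layer hyps A B sep (Layers.layer-cut L K A B sep bound (zero , zero) p q) hγ)
    ... | inj₁ _ | inj₂ hB rewrite G.∑-cong (separator-comm G A B)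
        with Half.half hyps B A (separated-sym G sep) hB (proj₂ nB) ζm-weight
    ...   | inj₁ lt = inj₁ lt
    ...   | inj₂ (inj₁ lt) = inj₂ (inj₁ lt)
    ...   | inj₂ (inj₂ (inj₁ (x , y))) = inj₂ (inj₂ (inj₁ (y , x)))
    ...   | inj₂ (inj₂ (inj₂ (x , y))) = inj₂ (inj₂ (inj₂ (y , x)))

-- Elements of the cyclic group as points of a product of chains

∑< : ℕ → (ℕ → ℕ) → ℕ
∑< n f = sum {n} (f ∘ toℕ)

∑<-cong : ∀ n {f g : ℕ → ℕ} → (∀ x → f x ≡ g x) → ∑< n f ≡ ∑< n g
∑<-cong n h = sum-cong-≗ {n} (h ∘ toℕ)

∑<-const : ∀ n c → ∑< n (λ _ → c) ≡ n * c
∑<-const zero    c = refl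
∑<-const (suc n) c = cong (c +_) (∑<-const n c)

∑<-++ : ∀ m n (f : ℕ → ℕ) → ∑< (m + n) f ≡ ∑< m f + ∑< n (λ x → f (m + x))
∑<-++ zero    n f = refl
∑<-++ (suc m) n f = trans (cong (f 0 +_) (∑<-++ m n (f ∘ suc))) (sym (+-assoc (f 0) _ _))

∑<-blocks : ∀ n p (f : ℕ → ℕ) → ∑< (n * p) f ≡ ∑< n (λ k → ∑< p (λ i → f (k * p + i)))
∑<-blocks zero    p f = refl
∑<-blocks (suc n) p f = trans (∑<-++ p (n * p) f) (cong (∑< p f +_)
  (trans (∑<-blocks n p (λ x → f (p + x)))
         (∑<-cong n λ k → ∑<-cong p λ i → cong f (sym (+-assoc p (k * p) i)))))

-- k ↦ k a + i permutes the residues modulo b when a is coprime to b.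
module Residues (a b : ℕ) .{{_ : NonZero b}} (cop : Coprime a b) where
  private
    infix 4 _≈_
    _≈_ : ℕ → ℕ → Set
    x ≈ y = x % b ≡ y % b

    +-≈ : ∀ {x y u v} → x ≈ y → u ≈ v → x + u ≈ y + v
    +-≈ {x} {y} {u} {v} p q = trans (%-distribˡ-+ x u b) (trans (cong₂ (λ s t → (s + t) % b) p q) (sym (%-distribˡ-+ y v b)))

    *-≈ : ∀ {x y u v} → x ≈ y → u ≈ v → x * u ≈ y * v
    *-≈ {x} {y} {u} {v} p q = trans (%-distribˡ-* x u b) (trans (cong₂ (λ s t → (s * t) % b) p q) (sym (%-distribˡ-* y v b)))

    %-≈ : ∀ x → x % b ≈ x
    %-≈ x = m%n%n≡m%n x b

    pred-b : ℕ
    pred-b = pred b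

    b≡ : suc pred-b ≡ b
    b≡ = suc-pred b

    inverse : ∃[ a′ ] a * a′ ≈ 1
    inverse with coprime-Bézout cop
    ... | Bézout.+- x y eq = x , trans (cong (_% b) (trans (*-comm a x) (sym eq))) ([m+kn]%n≡m%n 1 y b)
    -- Here 1 + x a = y b, so the inverse is -x, written as x (b - 1).
    ... | Bézout.-+ x y eq = x * pred-b , (begin
      (a * (x * pred-b)) % b                    ≡⟨ sym ([m+kn]%n≡m%n _ 1 b) ⟩
      (a * (x * pred-b) + 1 * b) % b ≡⟨ cong (λ c → (a * (x * pred-b) + 1 * c) % b) (sym b≡) ⟩
      (a * (x * pred-b) + 1 * suc pred-b) % b   ≡⟨ cong (_% b) (lemma a x pred-b) ⟩
      (1 + pred-b * (1 + x * a)) % b ≡⟨ cong (λ c → (1 + pred-b * c) % b) eq ⟩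
      (1 + pred-b * (y * b)) % b ≡⟨ cong (λ c → (1 + c) % b) (sym (*-assoc pred-b y b)) ⟩
      (1 + pred-b * y * b) % b                  ≡⟨ [m+kn]%n≡m%n 1 (pred-b * y) b ⟩
      1 % b                                     ∎)
      where
      open ≡-Reasoning
      lemma : ∀ a x c → a * (x * c) + 1 * suc c ≡ 1 + c * (1 + x * a)
      lemma = solve-∀

    a′ : ℕ
    a′ = proj₁ inverse

    residue : ℕ → Fin b
    residue x = fromℕ< (m%n<n x b)

    residue-≈ : ∀ {x} (y : Fin b) → x ≈ toℕ y → residue x ≡ y
    residue-≈ {x} y e = Fin.toℕ-injective (trans (Fin.toℕ-fromℕ< _) (trans e (m<n⇒m%n≡m (Fin.toℕ<n y))))

    toℕ-residue : ∀ x → toℕ (residue x) ≡ x % b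
    toℕ-residue x = Fin.toℕ-fromℕ< _

    perm : ℕ → Permutation′ b
    perm i = permutation (λ k → residue (toℕ k * a + i)) (λ y → residue ((toℕ y + i * pred-b) * a′))
      (λ y → residue-≈ y (begin
        (toℕ (residue ((toℕ y + i * pred-b) * a′)) * a + i) % b ≡⟨ cong (λ x → (x * a + i) % b) (toℕ-residue _) ⟩
        ((toℕ y + i * pred-b) * a′ % b * a + i) % b ≡⟨ +-≈ (*-≈ {u = a} (%-≈ ((toℕ y + i * pred-b) * a′)) refl) refl ⟩
        ((toℕ y + i * pred-b) * a′ * a + i) % b ≡⟨ cong (_% b) (lemma₁ (toℕ y + i * pred-b) a a′ i) ⟩
        ((toℕ y + i * pred-b) * (a * a′) + i) % b ≡⟨ +-≈ (*-≈ {toℕ y + i * pred-b} refl (proj₂ inverse)) refl ⟩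
        ((toℕ y + i * pred-b) * 1 + i) % b ≡⟨ cong (_% b) (lemma₂ (toℕ y) i pred-b) ⟩
        (toℕ y + i * suc pred-b) % b ≡⟨ cong (λ c → (toℕ y + i * c) % b) b≡ ⟩
        (toℕ y + i * b) % b ≡⟨ [m+kn]%n≡m%n (toℕ y) i b ⟩
        toℕ y % b                                                ∎))
      (λ k → residue-≈ k (begin
        ((toℕ (residue (toℕ k * a + i)) + i * pred-b) * a′) % b ≡⟨ cong (λ x → ((x + i * pred-b) * a′) % b) (toℕ-residue _) ⟩
        (((toℕ k * a + i) % b + i * pred-b) * a′) % b ≡⟨ *-≈ (+-≈ {u = i * pred-b} (%-≈ (toℕ k * a + i)) refl) refl ⟩
        ((toℕ k * a + i + i * pred-b) * a′) % b ≡⟨ cong (_% b) (lemma₃ (toℕ k) a a′ i pred-b) ⟩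
        (toℕ k * (a * a′) + i * a′ * suc pred-b) % b ≡⟨ cong (λ c → (toℕ k * (a * a′) + i * a′ * c) % b) b≡ ⟩
        (toℕ k * (a * a′) + i * a′ * b) % b ≡⟨ [m+kn]%n≡m%n _ (i * a′) b ⟩
        (toℕ k * (a * a′)) % b ≡⟨ *-≈ {toℕ k} refl (proj₂ inverse) ⟩
        (toℕ k * 1) % b ≡⟨ cong (_% b) (*-identityʳ (toℕ k)) ⟩
        toℕ k % b                                                ∎))
      where
      open ≡-Reasoning
      lemma₁ : ∀ y a a′ i → y * a′ * a + i ≡ y * (a * a′) + i
      lemma₁ = solve-∀
      lemma₂ : ∀ y i c → (y + i * c) * 1 + i ≡ y + i * suc c
      lemma₂ = solve-∀
      lemma₃ : ∀ k a a′ i c → (k * a + i + i * c) * a′ ≡ k * (a * a′) + i * a′ * suc c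
      lemma₃ = solve-∀

  ∑<-residues : ∀ (h : ℕ → ℕ) → (∀ x → h (x % b) ≡ h x) → ∀ i → ∑< b (λ k → h (k * a + i)) ≡ ∑< b h
  ∑<-residues h per i = sym (trans (sum-permute {b} (h ∘ toℕ) (perm i))
    (sum-cong-≗ {b} λ k → trans (cong h (toℕ-residue (toℕ k * a + i))) (per (toℕ k * a + i))))

periodic-* : ∀ {A : Set} (h : ℕ → A) n → (∀ x → h (x + n) ≡ h x) → ∀ k x → h (x + k * n) ≡ h x
periodic-* h n per zero    x = cong h (+-identityʳ x)
periodic-* h n per (suc k) x = trans (cong h (sym (+-assoc x n (k * n)))) (trans (periodic-* h n per k (x + n)) (per x))

periodic-% : ∀ {A : Set} (h : ℕ → A) n .{{_ : NonZero n}} → (∀ x → h (x + n) ≡ h x) → ∀ x → h (x % n) ≡ h x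
periodic-% h n per x = trans (sym (periodic-* h n per (x / n) (x % n))) (cong h (sym (m≡m%n+[m/n]*n x n)))

-- The product is the gcd of gcd(d, a) d and gcd(d, a) b, and the latter is gcd(b d, b a), a
-- multiple of d.
∣*⇒∣gcd*gcd : ∀ d a b → d ∣ a * b → d ∣ gcd d a * gcd d b
∣*⇒∣gcd*gcd d a b d∣ab = subst (d ∣_) (sym (c*gcd[m,n]≡gcd[cm,cn] (gcd d a) d b))
  (gcd-greatest (n∣m*n (gcd d a))
    (subst (d ∣_) (trans (sym (c*gcd[m,n]≡gcd[cm,cn] b d a)) (*-comm b (gcd d a)))
      (gcd-greatest (n∣m*n b) (subst (d ∣_) (*-comm a b) d∣ab))))

gcd-*-∣ : ∀ x a b → gcd x (a * b) ∣ gcd x a * gcd x b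
gcd-*-∣ x a b = ∣-trans (∣*⇒∣gcd*gcd d a b (gcd[m,n]∣n x (a * b)))
  (*-pres-∣ (gcd-greatest (∣-trans (gcd[m,n]∣m d a) d∣x) (gcd[m,n]∣n d a))
            (gcd-greatest (∣-trans (gcd[m,n]∣m d b) d∣x) (gcd[m,n]∣n d b)))
  where
  d = gcd x (a * b)
  d∣x = gcd[m,n]∣m x (a * b)

coprime-*-∣ : ∀ {u v y} → Coprime u v → u ∣ y → v ∣ y → u * v ∣ y
coprime-*-∣ {u} {v} cop (divides-refl q) v∣y =
  subst (u * v ∣_) (*-comm u q) (*-monoʳ-∣ u (coprime-divisor (Coprimality.sym cop) (subst (v ∣_) (*-comm q u) v∣y)))

coprime-gcd : ∀ {a b} x → Coprime a b → Coprime (gcd x a) (gcd x b)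
coprime-gcd {a} {b} x cop (d∣a , d∣b) = cop (∣-trans d∣a (gcd[m,n]∣n x a) , ∣-trans d∣b (gcd[m,n]∣n x b))

gcd-* : ∀ {a b} x → Coprime a b → gcd x (a * b) ≡ gcd x a * gcd x b
gcd-* {a} {b} x cop = ∣-antisym (gcd-*-∣ x a b) (gcd-greatest
  (coprime-*-∣ (coprime-gcd x cop) (gcd[m,n]∣m x a) (gcd[m,n]∣m x b))
  (*-pres-∣ (gcd[m,n]∣n x a) (gcd[m,n]∣n x b)))

prime∤⇒gcd≡1 : ∀ {p x} → Prime p → ¬ p ∣ x → ∀ m → gcd x (p ^ m) ≡ 1
prime∤⇒gcd≡1 {x = x} pp p∤x zero = gcd-zeroʳ x
prime∤⇒gcd≡1 {p} {x} pp p∤x (suc m) = ∣1⇒≡1 (subst (gcd x (p ^ suc m) ∣_)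
    (cong₂ _*_ gcd-p (prime∤⇒gcd≡1 pp p∤x m)) (gcd-*-∣ x p (p ^ m)))
  where
  gcd-p : gcd x p ≡ 1
  gcd-p with prime⇒irreducible pp (gcd[m,n]∣n x p)
  ... | inj₁ e = e
  ... | inj₂ e = contradiction (subst (_∣ x) e (gcd[m,n]∣m x p)) p∤x

^-∣-^ : ∀ p {i j} → i ≤ j → p ^ i ∣ p ^ j
^-∣-^ p {i} {j} i≤j = divides (p ^ (j ∸ i)) (trans (cong (p ^_) (sym (m∸n+n≡m i≤j))) (^-distribˡ-+-* p (j ∸ i) i))

-- The classes of C_n as points of `L`, where y is a power of x exactly when gcd(x, n) divides y.
-- Periodic on all of ℕ rather than defined on `Fin n`, so that maps for coprime moduli apply to the
-- same argument.
record Model (n : ℕ) (L : Space) : Set where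
  open Space L using (_≽_; top; ∑)
  field
    θ        : ℕ → Pt L
    periodic : ∀ x → θ (x + n) ≡ θ x
    ∑-θ      : ∀ f → ∑< n (f ∘ θ) ≡ ∑ f
    ∣⇒≽      : ∀ {x y} → gcd x n ∣ y → θ x ≽ θ y
    ≽⇒∣      : ∀ {x y} → θ x ≽ θ y → gcd x n ∣ y
    top⇒1    : ∀ {x} → θ x ≡ top → gcd x n ≡ 1
    1⇒top    : ∀ {x} → gcd x n ≡ 1 → θ x ≡ top

-- The Chinese remainder theorem for sums: for x = k a + i the first coordinate depends on i only,
-- and for fixed i the second runs through all residues modulo b.
_⊗ᴹ_∣_ : ∀ {a b L K} → Model a L → Model b K → Coprime a b → .{{_ : NonZero b}} → Model (a * b) (L ⊗ K)
_⊗ᴹ_∣_ {a} {b} {L} {K} A B cop = record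
  { θ        = λ x → A.θ x , B.θ x
  ; periodic = λ x → cong₂ _,_ (trans (cong (λ c → A.θ (x + c)) (*-comm a b)) (periodic-* A.θ a A.periodic b x))
                               (periodic-* B.θ b B.periodic a x)
  ; ∑-θ      = λ f → begin
      ∑< (a * b) (λ x → f (A.θ x , B.θ x)) ≡⟨ cong (λ n → ∑< n (λ x → f (A.θ x , B.θ x))) (*-comm a b) ⟩
      ∑< (b * a) (λ x → f (A.θ x , B.θ x)) ≡⟨ ∑<-blocks b a (λ x → f (A.θ x , B.θ x)) ⟩
      ∑< b (λ k → ∑< a (λ i → f (A.θ (k * a + i) , B.θ (k * a + i)))) ≡⟨ ∑<-cong b (λ k → ∑<-cong a (λ i → cong (λ l → f (l , B.θ (k * a + i))) (A-shift k i))) ⟩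
      ∑< b (λ k → ∑< a (λ i → f (A.θ i , B.θ (k * a + i)))) ≡⟨ ∑-comm {b} {a} (λ k i → f (A.θ (toℕ i) , B.θ (toℕ k * a + toℕ i))) ⟩
      ∑< a (λ i → ∑< b (λ k → f (A.θ i , B.θ (k * a + i)))) ≡⟨ ∑<-cong a (λ i → ∑<-residues (λ y → f (A.θ i , B.θ y)) (λ x → cong (λ k → f (A.θ i , k)) (periodic-% B.θ b B.periodic x)) i) ⟩
      ∑< a (λ i → ∑< b (λ k → f (A.θ i , B.θ k))) ≡⟨ sym (∑-comm {b} {a} (λ k i → f (A.θ (toℕ i) , B.θ (toℕ k)))) ⟩
      ∑< b (λ k → ∑< a (λ i → f (A.θ i , B.θ k))) ≡⟨ ∑<-cong b (λ k → A.∑-θ (λ l → f (l , B.θ k))) ⟩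
      ∑< b (λ k → Space.∑ L (λ l → f (l , B.θ k))) ≡⟨ B.∑-θ (λ k → Space.∑ L (λ l → f (l , k))) ⟩
      Space.∑ (L ⊗ K) f                                               ∎
  ; ∣⇒≽ = λ {x} {y} d → A.∣⇒≽ (∣-trans (∣m⇒∣m*n _ ∣-refl) (subst (_∣ y) (gcd-* x cop) d))
                           , B.∣⇒≽ (∣-trans (∣n⇒∣m*n (gcd x a) ∣-refl) (subst (_∣ y) (gcd-* x cop) d))
  ; ≽⇒∣ = λ {x} {y} (p , q) → subst (_∣ y) (sym (gcd-* x cop)) (coprime-*-∣ (coprime-gcd x cop) (A.≽⇒∣ p) (B.≽⇒∣ q))
  ; top⇒1 = λ {x} e → trans (gcd-* x cop) (cong₂ _*_ (A.top⇒1 (cong proj₁ e)) (B.top⇒1 (cong proj₂ e)))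
  ; 1⇒top = λ {x} e → cong₂ _,_ (A.1⇒top (m*n≡1⇒m≡1 _ _ (trans (sym (gcd-* x cop)) e)))
                                   (B.1⇒top (m*n≡1⇒n≡1 (gcd x a) _ (trans (sym (gcd-* x cop)) e)))
  }
  where
  module A = Model A
  module B = Model B
  open ≡-Reasoning
  open Residues a b cop
  A-shift : ∀ k i → A.θ (k * a + i) ≡ A.θ i
  A-shift k i = trans (cong A.θ (+-comm (k * a) i)) (periodic-* A.θ a A.periodic k i)

-- The exponent of p = a + 1 in x, capped at m; 0 has depth m.
depth : ∀ a m → ℕ → Fin (suc m)
depth a zero    x = zero
depth a (suc m) x with suc a ∣? x
... | yes _ = suc (depth a m (x / suc a))
... | no _  = zero

module PrimePower (a : ℕ) (pp : Prime (suc a)) where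
  private
    p : ℕ
    p = suc a

  depth-+ : ∀ m x → depth a m (x + p ^ m) ≡ depth a m x
  depth-+ zero    x = refl
  depth-+ (suc m) x with p ∣? x | p ∣? x + p ^ suc m
  ... | yes _ | yes _ = cong suc (trans (cong (depth a m) (trans (+-distrib-/-∣ʳ x (m∣m*n (p ^ m))) (cong (x / p +_) (trans (cong (_/ p) (*-comm p (p ^ m))) (m*n/n≡m (p ^ m) p))))) (depth-+ m (x / p)))
  ... | no _    | no _  = refl
  ... | yes p∣x | no ¬d = contradiction (∣m∣n⇒∣m+n p∣x (m∣m*n (p ^ m))) ¬d
  ... | no ¬d | yes d = contradiction (∣m+n∣m⇒∣n (subst (p ∣_) (+-comm x _) d) (m∣m*n (p ^ m))) ¬d

  depth-multiple : ∀ m k → depth a (suc m) (k * p) ≡ suc (depth a m k)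
  depth-multiple m k with p ∣? k * p
  ... | yes _ = cong (suc ∘ depth a m) (m*n/n≡m k p)
  ... | no ¬d = contradiction (n∣m*n k) ¬d

  depth-nonmultiple : ∀ m {x} → ¬ p ∣ x → depth a (suc m) x ≡ zero
  depth-nonmultiple m {x} ¬d with p ∣? x
  ... | yes d = contradiction d ¬d
  ... | no _  = refl

  -- Each block of p consecutive numbers has one multiple of p, which passes to m - 1, and a
  -- nonmultiples of depth 0.
  ∑-depth : ∀ m f → ∑< (p ^ m) (f ∘ depth a m) ≡ chainSum a m f
  ∑-depth zero    f = +-identityʳ (f zero)
  ∑-depth (suc m) f = begin
    ∑< (p * p ^ m) (f ∘ depth a (suc m)) ≡⟨ cong (λ n → ∑< n (f ∘ depth a (suc m))) (*-comm p (p ^ m)) ⟩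
    ∑< (p ^ m * p) (f ∘ depth a (suc m)) ≡⟨ ∑<-blocks (p ^ m) p (f ∘ depth a (suc m)) ⟩
    ∑< (p ^ m) (λ k → ∑< p (λ i → f (depth a (suc m) (k * p + i)))) ≡⟨ ∑<-cong (p ^ m) block ⟩
    ∑< (p ^ m) (λ k → f (suc (depth a m k)) + a * f zero) ≡⟨ ∑-distrib-+ {p ^ m} (λ k → f (suc (depth a m (toℕ k)))) (λ _ → a * f zero) ⟩
    ∑< (p ^ m) (λ k → f (suc (depth a m k))) + ∑< (p ^ m) (λ _ → a * f zero) ≡⟨ cong₂ _+_ (∑-depth m (f ∘ suc)) (∑<-const (p ^ m) (a * f zero)) ⟩
    chainSum a m (f ∘ suc) + p ^ m * (a * f zero) ≡⟨ lemma (chainSum a m (f ∘ suc)) (p ^ m) a (f zero) ⟩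
    a * p ^ m * f zero + chainSum a m (f ∘ suc)                              ∎
    where
    open ≡-Reasoning
    lemma : ∀ s w a x → s + w * (a * x) ≡ a * w * x + s
    lemma = solve-∀
    block : ∀ k → ∑< p (λ i → f (depth a (suc m) (k * p + i))) ≡ f (suc (depth a m k)) + a * f zero
    block k = cong₂ _+_ (cong f (trans (cong (depth a (suc m)) (+-identityʳ (k * p))) (depth-multiple m k)))
      (trans (sum-cong-≗ {a} λ i → cong f (depth-nonmultiple m (λ d →
               >⇒∤ (s≤s (Fin.toℕ<n i)) (∣m+n∣m⇒∣n d (n∣m*n k)))))
             (∑<-const a (f zero)))

  gcd-depth : ∀ m x → gcd x (p ^ m) ≡ p ^ toℕ (depth a m x)
  gcd-depth zero    x = gcd-zeroʳ x
  gcd-depth (suc m) x with p ∣? x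
  ... | no ¬d = prime∤⇒gcd≡1 pp ¬d (suc m)
  ... | yes (divides-refl q) = trans (cong (λ y → gcd y (p ^ suc m)) (*-comm q p))
      (trans (sym (c*gcd[m,n]≡gcd[cm,cn] p q (p ^ m)))
      (cong (p *_) (trans (gcd-depth m q) (cong (λ y → p ^ toℕ (depth a m y)) (sym (m*n/n≡m q p))))))

  1<p : 1 < p
  1<p = nonTrivial⇒n>1 p {{prime⇒nonTrivial pp}}

  model : ∀ m → Model (p ^ m) (Chain a m)
  model m = record
    { θ        = depth a m
    ; periodic = depth-+ m
    ; ∑-θ      = ∑-depth m
    ; ∣⇒≽      = λ {x} {y} d → ≮⇒≥ λ lt → <⇒≱ (^-monoʳ-< p 1<p lt)
                   (∣⇒≤ {{m^n≢0 p (toℕ (depth a m y))}} (subst₂ _∣_ (gcd-depth m x) (gcd-depth m y) (gcd-greatest d (gcd[m,n]∣n x (p ^ m)))))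
    ; ≽⇒∣ = λ {x} {y} le → ∣-trans (subst₂ _∣_ (sym (gcd-depth m x)) (sym (gcd-depth m y)) (^-∣-^ p le)) (gcd[m,n]∣m y (p ^ m))
    ; top⇒1    = λ {x} e → trans (gcd-depth m x) (cong (λ j → p ^ toℕ j) e)
    ; 1⇒top = λ {x} e → Fin.toℕ-injective (n≤0⇒n≡0 (≮⇒≥ λ lt → <⇒≢ (^-monoʳ-< p 1<p lt) (sym (trans (sym (gcd-depth m x)) e))))
    }

∑<-shift : ∀ n (h : ℕ → ℕ) → h n ≡ h 0 → ∑< n (h ∘ suc) ≡ ∑< n h
∑<-shift n h e = +-cancelˡ-≡ (h 0) _ _ (begin
  ∑< (suc n) h                              ≡⟨ cong (λ k → ∑< k h) (+-comm 1 n) ⟩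
  ∑< (n + 1) h                              ≡⟨ ∑<-++ n 1 h ⟩
  ∑< n h + (h (n + 0) + 0) ≡⟨ cong (∑< n h +_) (trans (+-identityʳ _) (trans (cong h (+-identityʳ n)) e)) ⟩
  ∑< n h + h 0                              ≡⟨ +-comm (∑< n h) (h 0) ⟩
  h 0 + ∑< n h                              ∎)
  where open ≡-Reasoning

length-filter : ∀ {P : ℕ → Set} (P? : Decidable P) g n → length (filter P? (applyUpTo g n)) ≡ ∑< n (λ k → ⟦ does (P? (g k)) ⟧)
length-filter P? g zero    = refl
length-filter P? g (suc n) with P? (g 0)
... | yes _ = cong suc (length-filter P? (g ∘ suc) n)
... | no _  = length-filter P? (g ∘ suc) n

-- `φ` counts over 1, ..., n and the model over 0, ..., n - 1; periodicity identifies the ends.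
φ-model : ∀ {n L} → Model n L → φ n ≡ Space.top-weight L
φ-model {n} {L} Mod = trans (length-filter (λ k → gcd (suc k) n ℕ.≟ 1) (λ k → k) n)
  (trans (∑<-cong n (λ k → cong ⟦_⟧ (agree (suc k))))
  (trans (∑<-shift n (λ x → ⟦ does (Space.top? L (θ x)) ⟧) (cong (λ l → ⟦ does (Space.top? L l) ⟧) (periodic 0)))
         (∑-θ _)))
  where
  open Model Mod
  agree : ∀ x → does (gcd x n ℕ.≟ 1) ≡ does (Space.top? L (θ x))
  agree x with Space.top? L (θ x)
  ... | yes e = dec-true (gcd x n ℕ.≟ 1) (top⇒1 e)
  ... | no ne = dec-false (gcd x n ℕ.≟ 1) (ne ∘ 1⇒top)

-- Reduction of the hypotheses of the grid theorem to inequalities between the primes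

≤-witness : ∀ {m n} k → m + k ≡ n → m ≤ n
≤-witness {m} k e = ≤-trans (m≤m+n m k) (≤-reflexive e)

grid-z : ℕ → ℕ → ℕ → ℕ → ℕ
grid-z a b t s = a * (b * t + s) + (t + s)

-- The conditions of `GridHyps` are homogeneous in the weights of `L`, so w = ∏ p_i^(n_i - 1)
-- cancels. Up-weights enter through their lower bound (1 + 1/q) w t, whence the factor q.
scaled-hyps : ∀ L a m b w t s g q → 1 ≤ w → 1 ≤ q →
  Space.top-weight L ≡ w * t → Space.top-weight L + Space.rest-weight L ≡ w * (t + s) →
  UpBound L q → CutBound L (w * g) →
  4 ≤ a → 2 + a ≤ b → 1 ≤ t → s ≤ 2 * t → t ≤ 2 * s → grid-z a b t s < a * b * g →
  q * grid-z a b t s < a * b * ((1 + q) * t) ⊎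
  (2 * g ≡ t + s × t ≤ s ×
   q * (suc a * grid-z a b t s) < suc a * (a * b * ((1 + q) * t)) + q * (a * b * t) ×
   q * (2 * grid-z a b t s) < 2 * (a * b * ((1 + q) * t)) + q * (a * (t + s))) →
  GridHyps L a m b
scaled-hyps L a m b w t s g q 1≤w 1≤q τ≡ τ+ρ≡ up cut 4≤a 2+a≤b 1≤t s≤2t t≤2s hγ hup = record
  { 4≤a   = 4≤a
  ; 2+a≤b = 2+a≤b
  ; 1≤τ   = subst (1 ≤_) (sym τ≡) (*-mono-≤ 1≤w 1≤t)
  ; ρ≤2τ = subst₂ _≤_ (sym ρ≡) (trans (lemma₁ w 2 t) (cong (2 *_) (sym τ≡))) (*-monoʳ-≤ w s≤2t)
  ; τ≤2ρ = subst₂ _≤_ (sym τ≡) (trans (lemma₁ w 2 s) (cong (2 *_) (sym ρ≡))) (*-monoʳ-≤ w t≤2s)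
  ; γ     = w * g
  ; bound = cut
  ; hγ    = subst₂ _<_ (sym z≡) (lemma₁ w (a * b) g) (*-monoʳ-< w hγ)
  ; hup = λ l ne u le → [ inj₁ ∘ dense u (scaled-up l ne u le) , inj₂ ∘ sparse u (scaled-up l ne u le) ]′ hup
  }
  where
  open ≤-Reasoning
  instance
    w≢0 : NonZero w
    w≢0 = >-nonZero 1≤w
    q≢0 : NonZero q
    q≢0 = >-nonZero 1≤q
  τ ρ z : ℕ
  τ = Space.top-weight L
  ρ = Space.rest-weight L
  z = a * (b * τ + ρ) + (τ + ρ)
  ρ≡ : ρ ≡ w * s
  ρ≡ = +-cancelˡ-≡ τ ρ (w * s) (trans τ+ρ≡ (trans (*-distribˡ-+ w t s) (cong (_+ w * s) (sym τ≡))))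
  lemma₁ : ∀ w x y → w * (x * y) ≡ x * (w * y)
  lemma₁ = solve-∀
  lemma₂ : ∀ a b w t s → a * (b * (w * t) + w * s) + (w * t + w * s) ≡ w * (a * (b * t + s) + (t + s))
  lemma₂ = solve-∀
  lemma₃ : ∀ q X u → X * (q * u) ≡ q * (X * u)
  lemma₃ = solve-∀
  z≡ : z ≡ w * grid-z a b t s
  z≡ = trans (cong₂ (λ τ ρ → a * (b * τ + ρ) + (τ + ρ)) τ≡ ρ≡) (lemma₂ a b w t s)
  scaled-up : ∀ l → l ≢ Space.top L → ∀ u → Space.up-weight L l ≤ u → w * ((1 + q) * t) ≤ q * u
  scaled-up l ne u le = begin
    w * ((1 + q) * t)            ≡⟨ lemma₁ w (1 + q) t ⟩
    (1 + q) * (w * t)            ≡⟨ cong ((1 + q) *_) (sym τ≡) ⟩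
    (1 + q) * τ                  ≤⟨ up l ne ⟩
    q * Space.up-weight L l      ≤⟨ *-monoʳ-≤ q le ⟩
    q * u                        ∎
  qz : ∀ k → q * (k * z) ≡ w * (q * (k * grid-z a b t s))
  qz k = trans (cong (λ z → q * (k * z)) z≡) (lemma₄ q k w (grid-z a b t s))
    where
    lemma₄ : ∀ q k w z → q * (k * (w * z)) ≡ w * (q * (k * z))
    lemma₄ = solve-∀
  dense : ∀ u → w * ((1 + q) * t) ≤ q * u → q * grid-z a b t s < a * b * ((1 + q) * t) → z < a * b * u
  dense u le h = *-cancelˡ-< q z _ (begin-strict
    q * z                          ≡⟨ cong (q *_) z≡ ⟩
    q * (w * grid-z a b t s)       ≡⟨ lemma₁ q w _ ⟩
    w * (q * grid-z a b t s)       <⟨ *-monoʳ-< w h ⟩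
    w * (a * b * ((1 + q) * t))    ≡⟨ lemma₁ w (a * b) _ ⟩
    a * b * (w * ((1 + q) * t))    ≤⟨ *-monoʳ-≤ (a * b) le ⟩
    a * b * (q * u)                ≡⟨ lemma₃ q (a * b) u ⟩
    q * (a * b * u)                ∎)
  weighted : ∀ k X Y u → w * ((1 + q) * t) ≤ q * u → q * (k * grid-z a b t s) < X * ((1 + q) * t) + q * Y → k * z < X * u + w * Y
  weighted k X Y u le h = *-cancelˡ-< q (k * z) _ (begin-strict
    q * (k * z)                              ≡⟨ qz k ⟩
    w * (q * (k * grid-z a b t s))           <⟨ *-monoʳ-< w h ⟩
    w * (X * ((1 + q) * t) + q * Y)          ≡⟨ lemma₅ w X ((1 + q) * t) q Y ⟩
    X * (w * ((1 + q) * t)) + q * (w * Y) ≤⟨ +-monoˡ-≤ (q * (w * Y)) (*-monoʳ-≤ X le) ⟩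
    X * (q * u) + q * (w * Y)                ≡⟨ lemma₆ X q u (w * Y) ⟩
    q * (X * u + w * Y)                      ∎)
    where
    lemma₅ : ∀ w X c q Y → w * (X * c + q * Y) ≡ X * (w * c) + q * (w * Y)
    lemma₅ = solve-∀
    lemma₆ : ∀ X q u Y → X * (q * u) + q * Y ≡ q * (X * u + Y)
    lemma₆ = solve-∀
  sparse : ∀ u → w * ((1 + q) * t) ≤ q * u →
    2 * g ≡ t + s × t ≤ s ×
      q * (suc a * grid-z a b t s) < suc a * (a * b * ((1 + q) * t)) + q * (a * b * t) ×
      q * (2 * grid-z a b t s) < 2 * (a * b * ((1 + q) * t)) + q * (a * (t + s)) →
    2 * (w * g) ≡ τ + ρ × τ ≤ ρ × suc a * z < suc a * (a * b * u) + a * b * τ × 2 * z < 2 * (a * b * u) + a * (τ + ρ)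
  sparse u le (e , t≤s , h₁ , h₂) =
      trans (sym (lemma₁ w 2 g)) (trans (cong (w *_) e) (sym τ+ρ≡))
    , subst₂ _≤_ (sym τ≡) (sym ρ≡) (*-monoʳ-≤ w t≤s)
    , subst₂ (λ x y → suc a * z < x + y) (*-assoc (suc a) (a * b) u) (trans (lemma₁ w (a * b) t) (cong (a * b *_) (sym τ≡)))
        (weighted (suc a) (suc a * (a * b)) (a * b * t) u le (subst (λ x → q * (suc a * grid-z a b t s) < x + q * (a * b * t)) (sym (*-assoc (suc a) (a * b) ((1 + q) * t))) h₁))
    , subst₂ (λ x y → 2 * z < x + y) (*-assoc 2 (a * b) u) (trans (lemma₁ w a (t + s)) (cong (a *_) (sym τ+ρ≡)))
        (weighted 2 (2 * (a * b)) (a * (t + s)) u le (subst (λ x → q * (2 * grid-z a b t s) < x + q * (a * (t + s))) (sym (*-assoc 2 (a * b) ((1 + q) * t))) h₂))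

-- Cut bounds for products of two and three chains

two-chains-cutBound : ∀ a₁ m₁ a₂ m₂ → 1 ≤ a₁ → suc a₁ ≤ a₁ * a₂ →
  CutBound (Chain a₁ (suc m₁) ⊗ Chain a₂ (suc m₂)) (pow a₁ m₁ * pow a₂ m₂ * (a₁ * a₂ + 1))
two-chains-cutBound a₁ m₁ a₂ m₂ 1≤a₁ h = ⊗-chain-cutBound C a₂ m₂ γ γ (chain-cutBound a₁ (suc m₁) γ)
  (subst₂ _≤_ (sym ρ≡) (sym τ≡) (m≤n*m M₁ a₁ {{>-nonZero 1≤a₁}}))
  (m≤n*m γ (a₂ * M₂) {{>-nonZero (*-mono-≤ 1≤a₂ (pow-pos a₂ m₂))}})
  (subst₂ (λ τ ρ → γ ≤ a₂ * M₂ * (τ + ρ)) (sym τ≡) (sym ρ≡) (≤-trans (*-monoʳ-≤ (M₁ * M₂) (+-monoʳ-≤ (a₁ * a₂) 1≤a₂)) (≤-reflexive (lemma₁ M₁ M₂ a₁ a₂))))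
  (λ l ne → *-cancelˡ-≤ (suc a₁) (begin
    suc a₁ * γ                                         ≡⟨ lemma₂ M₁ M₂ a₁ a₂ ⟩
    M₁ * M₂ * (a₁ * a₂ + a₁ * a₁ * a₂ + suc a₁) ≤⟨ *-monoʳ-≤ (M₁ * M₂) (+-monoʳ-≤ (a₁ * a₂ + a₁ * a₁ * a₂) h) ⟩
    M₁ * M₂ * (a₁ * a₂ + a₁ * a₁ * a₂ + a₁ * a₂)       ≡⟨ lemma₃ M₁ M₂ a₁ a₂ ⟩
    a₂ * M₂ * ((2 + a₁) * (a₁ * M₁)) ≡⟨ cong (λ τ → a₂ * M₂ * ((2 + a₁) * τ)) (sym τ≡) ⟩
    a₂ * M₂ * ((2 + a₁) * Space.top-weight C) ≤⟨ *-monoʳ-≤ (a₂ * M₂) (chain-upBound a₁ m₁ l ne) ⟩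
    a₂ * M₂ * (suc a₁ * Space.up-weight C l) ≡⟨ swap (a₂ * M₂) (suc a₁) _ ⟩
    suc a₁ * (a₂ * M₂ * Space.up-weight C l)           ∎))
  (subst₂ (λ τ ρ → γ ≤ a₂ * M₂ * τ + M₂ * ρ) (sym τ≡) (sym ρ≡) (≤-reflexive (lemma₄ M₁ M₂ a₁ a₂)))
  where
  open ≤-Reasoning
  C = Chain a₁ (suc m₁)
  M₁ M₂ γ : ℕ
  M₁ = pow a₁ m₁
  M₂ = pow a₂ m₂
  γ  = M₁ * M₂ * (a₁ * a₂ + 1)
  τ≡ : Space.top-weight C ≡ a₁ * M₁
  τ≡ = chain-top-weight a₁ m₁
  ρ≡ : Space.rest-weight C ≡ M₁
  ρ≡ = chain-rest-weight a₁ m₁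
  1≤a₂ : 1 ≤ a₂
  1≤a₂ = n≢0⇒n>0 λ { refl → contradiction (≤-trans h (≤-reflexive (*-zeroʳ a₁))) λ () }
  lemma₁ : ∀ M₁ M₂ a₁ a₂ → M₁ * M₂ * (a₁ * a₂ + a₂) ≡ a₂ * M₂ * (a₁ * M₁ + M₁)
  lemma₁ = solve-∀
  lemma₂ : ∀ M₁ M₂ a₁ a₂ → suc a₁ * (M₁ * M₂ * (a₁ * a₂ + 1)) ≡ M₁ * M₂ * (a₁ * a₂ + a₁ * a₁ * a₂ + suc a₁)
  lemma₂ = solve-∀
  lemma₃ : ∀ M₁ M₂ a₁ a₂ → M₁ * M₂ * (a₁ * a₂ + a₁ * a₁ * a₂ + a₁ * a₂) ≡ a₂ * M₂ * ((2 + a₁) * (a₁ * M₁))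
  lemma₃ = solve-∀
  lemma₄ : ∀ M₁ M₂ a₁ a₂ → M₁ * M₂ * (a₁ * a₂ + 1) ≡ a₂ * M₂ * (a₁ * M₁) + M₂ * M₁
  lemma₄ = solve-∀
  swap : ∀ x y z → x * (y * z) ≡ y * (x * z)
  swap = solve-∀

-- h is the excess over the totient. The cut of two chains in the top layer limits it by a₃, a
-- family over the top of `L` by a₁ + a₂ + 1; the better choice depends on the primes.
three-chains-cutBound : ∀ L w a₁ a₂ a₃ m₃ h → UpBound L (suc a₂) → CutBound L (w * (a₁ * a₂ + 1)) →
  Space.top-weight L ≡ w * (a₁ * a₂) → Space.rest-weight L ≡ w * (a₁ + a₂ + 1) →
  a₁ + a₂ + 1 ≤ a₁ * a₂ → h ≤ a₃ → h ≤ a₁ + a₂ + 1 →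
  CutBound (L ⊗ Chain a₃ (suc m₃)) (w * pow a₃ m₃ * (a₁ * a₂ * a₃ + h))
three-chains-cutBound L w a₁ a₂ a₃ m₃ h up cut τ≡ ρ≡ ρ≤τ h≤a₃ h≤ρ = ⊗-chain-cutBound L a₃ m₃ (w * (a₁ * a₂ + 1)) γ cut
  (subst₂ _≤_ (sym ρ≡) (sym τ≡) (*-monoʳ-≤ w ρ≤τ))
  (≤-trans γ≤ (≤-reflexive (lemma₁ w M a₁ a₂ a₃)))
  (subst₂ (λ τ ρ → γ ≤ a₃ * M * (τ + ρ)) (sym τ≡) (sym ρ≡) (≤-trans γ≤ (≤-witness _ (lemma₂ w M a₁ a₂ a₃))))
  (λ l ne → *-cancelˡ-≤ (suc a₂) (begin
    suc a₂ * γ                                           ≡⟨ lemma₃ w M a₁ a₂ a₃ h ⟩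
    w * M * (suc a₂ * (a₁ * a₂ * a₃) + suc a₂ * h) ≤⟨ *-monoʳ-≤ (w * M) (+-monoʳ-≤ (suc a₂ * (a₁ * a₂ * a₃)) (*-mono-≤ 1+a₂≤ h≤a₃)) ⟩
    w * M * (suc a₂ * (a₁ * a₂ * a₃) + a₁ * a₂ * a₃)     ≡⟨ lemma₄ w M a₁ a₂ a₃ ⟩
    a₃ * M * ((2 + a₂) * (w * (a₁ * a₂))) ≡⟨ cong (λ τ → a₃ * M * ((2 + a₂) * τ)) (sym τ≡) ⟩
    a₃ * M * ((2 + a₂) * Space.top-weight L) ≤⟨ *-monoʳ-≤ (a₃ * M) (up l ne) ⟩
    a₃ * M * (suc a₂ * Space.up-weight L l) ≡⟨ swap (a₃ * M) (suc a₂) _ ⟩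
    suc a₂ * (a₃ * M * Space.up-weight L l)              ∎))
  (subst₂ (λ τ ρ → γ ≤ a₃ * M * τ + M * ρ) (sym τ≡) (sym ρ≡)
    (≤-trans (*-monoʳ-≤ (w * M) (+-monoʳ-≤ (a₁ * a₂ * a₃) h≤ρ)) (≤-reflexive (lemma₅ w M a₁ a₂ a₃))))
  where
  open ≤-Reasoning
  M γ : ℕ
  M = pow a₃ m₃
  γ = w * M * (a₁ * a₂ * a₃ + h)
  1+a₂≤ : suc a₂ ≤ a₁ * a₂
  1+a₂≤ = ≤-trans (≤-trans (≤-reflexive (+-comm 1 a₂)) (+-monoˡ-≤ 1 (m≤n+m a₂ a₁))) ρ≤τ
  γ≤ : γ ≤ w * M * (a₁ * a₂ * a₃ + a₃)
  γ≤ = *-monoʳ-≤ (w * M) (+-monoʳ-≤ (a₁ * a₂ * a₃) h≤a₃)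
  lemma₁ : ∀ w M a₁ a₂ a₃ → w * M * (a₁ * a₂ * a₃ + a₃) ≡ a₃ * M * (w * (a₁ * a₂ + 1))
  lemma₁ = solve-∀
  lemma₂ : ∀ w M a₁ a₂ a₃ → w * M * (a₁ * a₂ * a₃ + a₃) + w * M * (a₁ + a₂) * a₃ ≡ a₃ * M * (w * (a₁ * a₂) + w * (a₁ + a₂ + 1))
  lemma₂ = solve-∀
  lemma₃ : ∀ w M a₁ a₂ a₃ h → suc a₂ * (w * M * (a₁ * a₂ * a₃ + h)) ≡ w * M * (suc a₂ * (a₁ * a₂ * a₃) + suc a₂ * h)
  lemma₃ = solve-∀
  lemma₄ : ∀ w M a₁ a₂ a₃ → w * M * (suc a₂ * (a₁ * a₂ * a₃) + a₁ * a₂ * a₃) ≡ a₃ * M * ((2 + a₂) * (w * (a₁ * a₂)))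
  lemma₄ = solve-∀
  lemma₅ : ∀ w M a₁ a₂ a₃ → w * M * (a₁ * a₂ * a₃ + (a₁ + a₂ + 1)) ≡ a₃ * M * (w * (a₁ * a₂)) + M * (w * (a₁ + a₂ + 1))
  lemma₅ = solve-∀
  swap : ∀ x y z → x * (y * z) ≡ y * (x * z)
  swap = solve-∀

-- Gaps between primes

two∣ : ∀ x → (2 ∣ x) ⊎ (2 ∣ 1 + x)
two∣ zero    = inj₁ (2 ∣0)
two∣ (suc x) with two∣ x
... | inj₁ d = inj₂ (∣m∣n⇒∣m+n ∣-refl d)
... | inj₂ d = inj₁ d

three∣ : ∀ x → (3 ∣ x) ⊎ (3 ∣ 1 + x) ⊎ (3 ∣ 2 + x)
three∣ zero    = inj₁ (3 ∣0)
three∣ (suc x) with three∣ x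
... | inj₁ d        = inj₂ (inj₂ (∣m∣n⇒∣m+n ∣-refl d))
... | inj₂ (inj₁ d) = inj₁ d
... | inj₂ (inj₂ d) = inj₂ (inj₁ d)

prime-∤ : ∀ {d p} → Prime p → 1 < d → d < p → ¬ (d ∣ p)
prime-∤ pp 1<d d<p d∣p with prime⇒irreducible pp d∣p
... | inj₁ e = <⇒≢ 1<d (sym e)
... | inj₂ e = <⇒≢ d<p e

prime-gap₂ : ∀ {x y} → Prime x → Prime y → 2 < x → x < y → 2 + x ≤ y
prime-gap₂ {x} {y} px py 2<x x<y with m≤n⇒m<n∨m≡n x<y
... | inj₁ lt   = lt
... | inj₂ refl with two∣ x
...   | inj₁ d = contradiction d (prime-∤ px (s≤s (s≤s z≤n)) 2<x)
... | inj₂ d = contradiction d (prime-∤ py (s≤s (s≤s z≤n)) (≤-trans 2<x (n≤1+n x)))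

-- One of x, x + 2, x + 4 is a multiple of 3, and odd gaps fail by parity; i and j are the excesses
-- of the two gaps over 2.
prime-gap₆ : ∀ {x y z} → Prime x → Prime y → Prime z → 3 < x → x < y → y < z → 6 + x ≤ z
prime-gap₆ {x} {y} {z} px py pz 3<x x<y y<z
  with m≤n⇒∃[o]m+o≡n (prime-gap₂ px py (<⇒≤ 3<x) x<y)
... | i , refl with m≤n⇒∃[o]m+o≡n (prime-gap₂ py pz (<-trans (<⇒≤ 3<x) x<y) y<z)
...   | j , refl = go i j px py pz
  where
  2≤ : ∀ {k} → 2 ≤ 2 + k
  2≤ = s≤s (s≤s z≤n)
  go : ∀ i j → Prime x → Prime (2 + x + i) → Prime (2 + (2 + x + i) + j) → 6 + x ≤ 2 + (2 + x + i) + j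
  go zero zero px py pz with three∣ x
  ... | inj₁ d        = contradiction d (prime-∤ px 2≤ 3<x)
  ... | inj₂ (inj₁ d) = contradiction (subst (3 ∣_) (cong (4 +_) (sym (trans (+-identityʳ _) (+-identityʳ x)))) (∣m∣n⇒∣m+n (∣-refl {3}) d)) (prime-∤ pz 2≤ (s≤s (s≤s (s≤s (s≤s z≤n)))))
  ... | inj₂ (inj₂ d) = contradiction (subst (3 ∣_) (cong (2 +_) (sym (+-identityʳ x))) d) (prime-∤ py 2≤ (≤-trans 3<x (≤-trans (m≤n+m x 2) (≤-reflexive (cong (2 +_) (sym (+-identityʳ x)))))))
  go zero (suc zero) px py pz with two∣ x
  ... | inj₁ d = contradiction d (prime-∤ px 2≤ (<⇒≤ 3<x))
  ... | inj₂ d = contradiction (subst (2 ∣_) (cong (4 +_) (trans (+-comm 1 x) (cong (_+ 1) (sym (+-identityʳ x))))) (∣m∣n⇒∣m+n (divides 2 refl) d)) (prime-∤ pz 2≤ (s≤s (s≤s (s≤s z≤n))))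
  go (suc zero) zero px py pz with two∣ x
  ... | inj₁ d = contradiction d (prime-∤ px 2≤ (<⇒≤ 3<x))
  ... | inj₂ d = contradiction (subst (2 ∣_) (cong (2 +_) (+-comm 1 x)) (∣m∣n⇒∣m+n (∣-refl {2}) d)) (prime-∤ py 2≤ (s≤s (s≤s (≤-trans (≤-trans (s≤s z≤n) 3<x) (m≤m+n x 1)))))
  go zero (suc (suc j)) _ _ _ = ≤-witness j (lemma x j)
    where
    lemma : ∀ x j → 6 + x + j ≡ 2 + (2 + x + 0) + (2 + j)
    lemma = solve-∀
  go (suc zero) (suc j) _ _ _ = ≤-witness j (lemma x j)
    where
    lemma : ∀ x j → 6 + x + j ≡ 2 + (2 + x + 1) + (1 + j)
    lemma = solve-∀
  go (suc (suc i)) j _ _ _ = ≤-witness (i + j) (lemma x i j)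
    where
    lemma : ∀ x i j → 6 + x + (i + j) ≡ 2 + (2 + x + (2 + i)) + j
    lemma = solve-∀

-- The variables c, d, a, b are p_i − 1 from p₂ on, and x, y, z, w measure their excess over the least values which the gaps
-- between primes allow; then each difference of the two sides has nonnegative coefficients.  The names begin with p₁
-- (three′ for r = 5).

two-pos : ∀ {c a b} x y z → 2 + x ≡ c → 2 + c + y ≡ a → 2 + a + z ≡ b → 1 ≤ 1 * c
two-pos x y z refl refl refl = ≤-witness _ (identity x y z)
  where
  identity : ∀ x y z → 1 + (1 + x) ≡ 1 * (2 + x)
  identity = solve-∀

two-s : ∀ {c a b} x y z → 2 + x ≡ c → 2 + c + y ≡ a → 2 + a + z ≡ b → 1 + c + 1 ≤ 2 * (1 * c)
two-s x y z refl refl refl = ≤-witness _ (identity x y z)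
  where
  identity : ∀ x y z → 1 + (2 + x) + 1 + (x) ≡ 2 * (1 * (2 + x))
  identity = solve-∀

two-t : ∀ {c a b} x y z → 2 + x ≡ c → 2 + c + y ≡ a → 2 + a + z ≡ b → 1 * c ≤ 2 * (1 + c + 1)
two-t x y z refl refl refl = ≤-witness _ (identity x y z)
  where
  identity : ∀ x y z → 1 * (2 + x) + (6 + x) ≡ 2 * (1 + (2 + x) + 1)
  identity = solve-∀

two-γ : ∀ {c a b} x y z → 2 + x ≡ c → 2 + c + y ≡ a → 2 + a + z ≡ b → 1 + grid-z a b (1 * c) (1 + c + 1) ≤ a * b * (1 * c + 1)
two-γ x y z refl refl refl = ≤-witness _ (identity x y z)
  where
  identity : ∀ x y z → 1 + ((2 + (2 + x) + y) * ((2 + (2 + (2 + x) + y) + z) * (1 * (2 + x)) + (1 + (2 + x) + 1)) + ((1 * (2 + x)) + (1 + (2 + x) + 1))) + (1 + 6 * y + 4 * z + x * y + x * z + y * y + y * z) ≡ (2 + (2 + x) + y) * (2 + (2 + (2 + x) + y) + z) * (1 * (2 + x) + 1)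
  identity = solve-∀

two-half : ∀ {c a b} x y z → 2 + x ≡ c → 2 + c + y ≡ a → 2 + a + z ≡ b → 1 * c ≤ 1 + c + 1
two-half x y z refl refl refl = ≤-witness _ (identity x y z)
  where
  identity : ∀ x y z → 1 * (2 + x) + (2) ≡ 1 + (2 + x) + 1
  identity = solve-∀

two-up₁ : ∀ {c a b} x y z → 2 + x ≡ c → 2 + c + y ≡ a → 2 + a + z ≡ b → 1 + (1 + c) * ((1 + a) * (grid-z a b (1 * c) (1 + c + 1))) ≤ (1 + a) * (a * b * ((1 + (1 + c)) * (1 * c))) + (1 + c) * (a * b * (1 * c))
two-up₁ x y z refl refl refl = ≤-witness _ (identity x y z)
  where
  identity : ∀ x y z → 1 + (1 + (2 + x)) * ((1 + (2 + (2 + x) + y)) * ((2 + (2 + x) + y) * ((2 + (2 + (2 + x) + y) + z) * (1 * (2 + x)) + (1 + (2 + x) + 1)) + ((1 * (2 + x)) + (1 + (2 + x) + 1)))) + (53 + 122 * x + 82 * y + 64 * z + 67 * x * x + 97 * x * y + 64 * x * z + 24 * y * y + 24 * y * z + 14 * x * x * x + 31 * x * x * y + 20 * x * x * z + 19 * x * y * y + 18 * x * y * z + 2 * y * y * y + 2 * y * y * z + x * x * x * x + 3 * x * x * x * y + 2 * x * x * x * z + 3 * x * x * y * y + 3 * x * x * y * z + x * y * y * y + x * y * y * z) ≡ (1 + (2 + (2 + x) + y)) * ((2 + (2 + x) + y) * (2 + (2 + (2 + x) + y) + z) * ((1 + (1 + (2 + x))) * (1 * (2 + x)))) + (1 + (2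 + x)) * ((2 + (2 + x) + y) * (2 + (2 + (2 + x) + y) + z) * (1 * (2 + x)))
  identity = solve-∀

two-up₂ : ∀ {c a b} x y z → 2 + x ≡ c → 2 + c + y ≡ a → 2 + a + z ≡ b → 1 + (1 + c) * (2 * (grid-z a b (1 * c) (1 + c + 1))) ≤ 2 * (a * b * ((1 + (1 + c)) * (1 * c))) + (1 + c) * (a * ((1 * c) + (1 + c + 1)))
two-up₂ x y z refl refl refl = ≤-witness _ (identity x y z)
  where
  identity : ∀ x y z → 1 + (1 + (2 + x)) * (2 * ((2 + (2 + x) + y) * ((2 + (2 + (2 + x) + y) + z) * (1 * (2 + x)) + (1 + (2 + x) + 1)) + ((1 * (2 + x)) + (1 + (2 + x) + 1)))) + (35 + 50 * x + 34 * y + 16 * z + 18 * x * x + 26 * x * y + 12 * x * z + 4 * y * y + 4 * y * z + 2 * x * x * x + 4 * x * x * y + 2 * x * x * z + 2 * x * y * y + 2 * x * y * z) ≡ 2 * ((2 + (2 + x) + y) * (2 + (2 + (2 + x) + y) + z) * ((1 + (1 + (2 + x))) * (1 * (2 + x)))) + (1 + (2 + x)) * ((2 + (2 + x) + y) * ((1 * (2 + x)) + (1 + (2 + x) + 1)))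
  identity = solve-∀

three-pos : ∀ {c a b} x y z → 4 + x ≡ c → 2 + c + y ≡ a → 6 + c + z ≡ b → 1 ≤ 2 * c
three-pos x y z refl refl refl = ≤-witness _ (identity x y z)
  where
  identity : ∀ x y z → 1 + (7 + 2 * x) ≡ 2 * (4 + x)
  identity = solve-∀

three-s : ∀ {c a b} x y z → 4 + x ≡ c → 2 + c + y ≡ a → 6 + c + z ≡ b → 2 + c + 1 ≤ 2 * (2 * c)
three-s x y z refl refl refl = ≤-witness _ (identity x y z)
  where
  identity : ∀ x y z → 2 + (4 + x) + 1 + (9 + 3 * x) ≡ 2 * (2 * (4 + x))
  identity = solve-∀

three-t : ∀ {c a b} x y z → 4 + x ≡ c → 2 + c + y ≡ a → 6 + c + z ≡ b → 2 * c ≤ 2 * (2 + c + 1)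
three-t x y z refl refl refl = ≤-witness _ (identity x y z)
  where
  identity : ∀ x y z → 2 * (4 + x) + (6) ≡ 2 * (2 + (4 + x) + 1)
  identity = solve-∀

-- The gap 6 matters: for c, a, b = 4, 6, 8 the two sides would be 442 and 432.
three-γ : ∀ {c a b} x y z → 4 + x ≡ c → 2 + c + y ≡ a → 6 + c + z ≡ b → 1 + grid-z a b (2 * c) (2 + c + 1) ≤ a * b * (2 * c + 1)
three-γ x y z refl refl refl = ≤-witness _ (identity x y z)
  where
  identity : ∀ x y z → 1 + ((2 + (4 + x) + y) * ((6 + (4 + x) + z) * (2 * (4 + x)) + (2 + (4 + x) + 1)) + ((2 * (4 + x)) + (2 + (4 + x) + 1))) + (2 + 3 * y + 6 * z + x * z + y * z) ≡ (2 + (4 + x) + y) * (6 + (4 + x) + z) * (2 * (4 + x) + 1)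
  identity = solve-∀

three-up : ∀ {c a b} x y z → 4 + x ≡ c → 2 + c + y ≡ a → 6 + c + z ≡ b → 1 + (1 + c) * (grid-z a b (2 * c) (2 + c + 1)) ≤ a * b * ((1 + (1 + c)) * (2 * c))
three-up x y z refl refl refl = ≤-witness _ (identity x y z)
  where
  identity : ∀ x y z → 1 + (1 + (4 + x)) * ((2 + (4 + x) + y) * ((6 + (4 + x) + z) * (2 * (4 + x)) + (2 + (4 + x) + 1)) + ((2 * (4 + x)) + (2 + (4 + x) + 1))) + (194 + 111 * x + 45 * y + 48 * z + 19 * x * x + 16 * x * y + 20 * x * z + 8 * y * z + x * x * x + x * x * y + 2 * x * x * z + 2 * x * y * z) ≡ (2 + (4 + x) + y) * (6 + (4 + x) + z) * ((1 + (1 + (4 + x))) * (2 * (4 + x)))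
  identity = solve-∀

three′-pos : ∀ {c d a b} x y z w → 4 + x ≡ c → 2 + c + y ≡ d → 2 + d + z ≡ a → 6 + d + w ≡ b → 1 ≤ 2 * c * d
three′-pos x y z w refl refl refl refl = ≤-witness _ (identity x y z w)
  where
  identity : ∀ x y z w → 1 + (47 + 20 * x + 8 * y + 2 * x * x + 2 * x * y) ≡ 2 * (4 + x) * (2 + (4 + x) + y)
  identity = solve-∀

three′-s : ∀ {c d a b} x y z w → 4 + x ≡ c → 2 + c + y ≡ d → 2 + d + z ≡ a → 6 + d + w ≡ b → 2 * c + 2 * d + c * d + 2 + c + d + 1 ≤ 2 * (2 * c * d)
three′-s x y z w refl refl refl refl = ≤-witness _ (identity x y z w)
  where
  identity : ∀ x y z w → 2 * (4 + x) + 2 * (2 + (4 + x) + y) + (4 + x) * (2 + (4 + x) + y) + 2 + (4 + x) + (2 + (4 + x) + y) + 1 + (39 + 24 * x + 9 * y + 3 * x * x + 3 * x * y) ≡ 2 * (2 * (4 + x) * (2 + (4 + x) + y))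
  identity = solve-∀

three′-t : ∀ {c d a b} x y z w → 4 + x ≡ c → 2 + c + y ≡ d → 2 + d + z ≡ a → 6 + d + w ≡ b → 2 * c * d ≤ 2 * (2 * c + 2 * d + c * d + 2 + c + d + 1)
three′-t x y z w refl refl refl refl = ≤-witness _ (identity x y z w)
  where
  identity : ∀ x y z w → 2 * (4 + x) * (2 + (4 + x) + y) + (66 + 12 * x + 6 * y) ≡ 2 * (2 * (4 + x) + 2 * (2 + (4 + x) + y) + (4 + x) * (2 + (4 + x) + y) + 2 + (4 + x) + (2 + (4 + x) + y) + 1)
  identity = solve-∀

three′-up : ∀ {c d a b} x y z w → 4 + x ≡ c → 2 + c + y ≡ d → 2 + d + z ≡ a → 6 + d + w ≡ b → 1 + (1 + d) * (grid-z a b (2 * c * d) (2 * c + 2 * d + c * d + 2 + c + d + 1)) ≤ a * b * ((1 + (1 + d)) * (2 * c * d))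
three′-up x y z w refl refl refl refl = ≤-witness _ (identity x y z w)
  where
  identity : ∀ x y z w → 1 + (1 + (2 + (4 + x) + y)) * ((2 + (2 + (4 + x) + y) + z) * ((6 + (2 + (4 + x) + y) + w) * (2 * (4 + x) * (2 + (4 + x) + y)) + (2 * (4 + x) + 2 * (2 + (4 + x) + y) + (4 + x) * (2 + (4 + x) + y) + 2 + (4 + x) + (2 + (4 + x) + y) + 1)) + ((2 * (4 + x) * (2 + (4 + x) + y)) + (2 * (4 + x) + 2 * (2 + (4 + x) + y) + (4 + x) * (2 + (4 + x) + y) + 2 + (4 + x) + (2 + (4 + x) + y) + 1))) + (680 + 384 * w + 772 * x + 271 * y + 177 * z + 208 * w * x + 112 * w * y + 48 * w * z + 230 * x * x + 261 * x * y + 119 * x * z + 31 * y * y + 38 * y * z + 36 * w * x * x + 44 * w * x * y + 20 * w * x * z + 8 * w * y * y + 8 * w * y * z + 26 * x * x * x + 53 * x * x * y + 21 * x * x * z + 28 * x * y * y + 22 * x * y * z + y * y * y + y * y * z + 2 * w * x * x * x + 4 * w * x * x * y + 2 * w * x * x * z + 2 * w * x * y * y + 2 * w * x * y * z + x * x * x * x + 3 * x * x * x * y + x * x * x * z + 3 * x * x * y * y + 2 * x * x * y * z + x * y * y * y + x * y * y * z) ≡ (2 + (2 + (4 + x) + y) + z) * (6 + (2 + (4 + x) + y) + w) * ((1 + (1 + (2 + (4 + x) + y))) * (2 * (4 + x) * (2 + (4 + x) + y)))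
  identity = solve-∀

-- If p₂ and p₃ are not twins, the excess in the cut bound can be the full c + 3 = a₁ + a₂ + 1.
three′-wide : ∀ {c d a b} x y z w → 4 + x ≡ c → 3 + c + y ≡ d → 2 + d + z ≡ a → 6 + d + w ≡ b → 1 + grid-z a b (2 * c * d) (2 * c + 2 * d + c * d + 2 + c + d + 1) ≤ a * b * (2 * c * d + (2 + c + 1))
three′-wide x y z w refl refl refl refl = ≤-witness _ (identity x y z w)
  where
  identity : ∀ x y z w → 1 + ((2 + (3 + (4 + x) + y) + z) * ((6 + (3 + (4 + x) + y) + w) * (2 * (4 + x) * (3 + (4 + x) + y)) + (2 * (4 + x) + 2 * (3 + (4 + x) + y) + (4 + x) * (3 + (4 + x) + y) + 2 + (4 + x) + (3 + (4 + x) + y) + 1)) + ((2 * (4 + x) * (3 + (4 + x) + y)) + (2 * (4 + x) + 2 * (3 + (4 + x) + y) + (4 + x) * (3 + (4 + x) + y) + 2 + (4 + x) + (3 + (4 + x) + y) + 1))) + (122 + 63 * w + 15 * x + 12 * y + 27 * z + 16 * w * x + 7 * w * y + 7 * w * z + 3 * x * z + w * x * x + w * x * y + w * x * z) ≡ (2 + (3 + (4 + x) + y) + z) * (6 + (3 + (4 + x) + y) + w) * (2 * (4 + x) * (3 + (4 + x) + y) + (2 + (4 + x) + 1))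
  identity = solve-∀

-- For twins the excess is only d = c + 2, and at the least a and b the sides differ by 7 c + 32 -
-- c². The condition is (c - 10)(c + 3) ≤ 0, that is p₂ ≤ 11.
three′-narrow : ∀ {a b} c z w → c * c ≤ 7 * c + 30 → 6 + c + z ≡ a → 8 + c + w ≡ b → 1 + grid-z a b (2 * c * (2 + c)) (2 * c + 2 * (2 + c) + c * (2 + c) + 2 + c + (2 + c) + 1) ≤ a * b * (2 * c * (2 + c) + (2 + c))
three′-narrow c z w le refl refl = +-cancelʳ-≤ (c * c) _ _ (≤-trans (+-monoʳ-≤ (1 + grid-z (6 + c + z) (8 + c + w) (2 * c * (2 + c)) (2 * c + 2 * (2 + c) + c * (2 + c) + 2 + c + (2 + c) + 1)) le) (≤-witness _ (identity c z w)))
  where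
  identity : ∀ c z w → 1 + ((6 + c + z) * ((8 + c + w) * (2 * c * (2 + c)) + (2 * c + 2 * (2 + c) + c * (2 + c) + 2 + c + (2 + c) + 1)) + ((2 * c * (2 + c)) + (2 * c + 2 * (2 + c) + c * (2 + c) + 2 + c + (2 + c) + 1))) + (7 * c + 30) + (2 + 12 * w + 7 * z + 8 * c * w + 2 * c * z + 2 * w * z + c * c * w + c * w * z) ≡ (6 + c + z) * (8 + c + w) * (2 * c * (2 + c) + (2 + c)) + c * c
  identity = solve-∀

-- 3/2 · 12/11 · 14/13 · 16/15 is less than 2, and larger factors only decrease the product.
eleven : ∀ {c d a} x y z → 11 + x ≡ c → 2 + c + y ≡ d → 2 + d + z ≡ a → 1 * 3 * (1 + c) * (1 + d) * (1 + a) ≤ 2 * (1 * 2 * c * d * a)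
eleven x y z refl refl refl = ≤-witness _ (identity x y z)
  where
  identity : ∀ x y z → 1 * 3 * (1 + (11 + x)) * (1 + (2 + (11 + x) + y)) * (1 + (2 + (2 + (11 + x) + y) + z)) + (516 + 260 * x + 152 * y + 68 * z + 30 * x * x + 38 * x * y + 18 * x * z + 8 * y * y + 8 * y * z + x * x * x + 2 * x * x * y + x * x * z + x * y * y + x * y * z) ≡ 2 * (1 * 2 * (11 + x) * (2 + (11 + x) + y) * (2 + (2 + (11 + x) + y) + z))
  identity = solve-∀

five₃ : ∀ {a₁ a₂ a₃} x y z → 4 + x ≡ a₁ → 1 + a₁ + y ≡ a₂ → 1 + a₂ + z ≡ a₃ → 1 * (1 + a₁) * (1 + a₂) * (1 + a₃) ≤ 2 * (1 * a₁ * a₂ * a₃)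
five₃ x y z refl refl refl = ≤-witness _ (identity x y z)
  where
  identity : ∀ x y z → 1 * (1 + (4 + x)) * (1 + (1 + (4 + x) + y)) * (1 + (1 + (1 + (4 + x) + y) + z)) + (30 + 41 * x + 23 * y + 10 * z + 12 * x * x + 15 * x * y + 7 * x * z + 3 * y * y + 3 * y * z + x * x * x + 2 * x * x * y + x * x * z + x * y * y + x * y * z) ≡ 2 * (1 * (4 + x) * (1 + (4 + x) + y) * (1 + (1 + (4 + x) + y) + z))
  identity = solve-∀

-- From 5 on, even consecutive integers suffice: 5/4 · 6/5 · 7/6 · 8/7 telescopes to exactly 2.
five₄ : ∀ {a₁ a₂ a₃ a₄} x y z w → 4 + x ≡ a₁ → 1 + a₁ + y ≡ a₂ → 1 + a₂ + z ≡ a₃ → 1 + a₃ + w ≡ a₄ → 1 * (1 + a₁) * (1 + a₂) * (1 + a₃) * (1 + a₄) ≤ 2 * (1 * a₁ * a₂ * a₃ * a₄)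
five₄ x y z w refl refl refl refl = ≤-witness _ (identity x y z w)
  where
  identity : ∀ x y z w → 1 * (1 + (4 + x)) * (1 + (1 + (4 + x) + y)) * (1 + (1 + (1 + (4 + x) + y) + z)) * (1 + (1 + (1 + (1 + (4 + x) + y) + z) + w)) + (30 * w + 210 * x + 126 * y + 70 * z + 41 * w * x + 23 * w * y + 10 * w * z + 107 * x * x + 146 * x * y + 89 * x * z + 39 * y * y + 49 * y * z + 10 * z * z + 12 * w * x * x + 15 * w * x * y + 7 * w * x * z + 3 * w * y * y + 3 * w * y * z + 18 * x * x * x + 39 * x * x * y + 25 * x * x * z + 24 * x * y * y + 31 * x * y * z + 7 * x * z * z + 3 * y * y * y + 6 * y * y * z + 3 * y * z * z + w * x * x * x + 2 * w * x * x * y + w * x * x * z + w * x * y * y + w * x * y * z + x * x * x * x + 3 * x * x * x * y + 2 * x * x * x * z + 3 * x * x * y * y + 4 * x * x * y * z + x * x * z * z + x * y * y * y + 2 * x * y * y * z + x * y * z * z) ≡ 2 * (1 * (4 + x) * (1 + (4 + x) + y) * (1 + (1 + (4 + x) + y) + z) * (1 + (1 + (1 + (4 + x) + y) + z) + w))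
  identity = solve-∀

-- Cut-sets of the power graph

open import Data.Fin.Subset using (Subset; _∈_; _∉_; ∣_∣; _⊆_)
open import Data.Fin.Subset.Properties using (_∈?_; p⊂q⇒∣p∣<∣q∣; ⊆-antisym)
open import Data.Vec using (tabulate; lookup; []; _∷_)
open import Data.Vec.Properties using (lookup∘tabulate; []=⇒lookup; lookup⇒[]=) renaming (≡-dec to Vec-≡-dec)

-- Meant for reachability outside the cut-set: deciding it under a double negation is enough,
-- because the goal, an equality of subsets, is decidable.
¬¬-decide : ∀ n (P : Fin n → Set) → ¬ ¬ (∀ x → Dec (P x))
¬¬-decide zero    P k = k λ ()
¬¬-decide (suc n) P k = ¬¬-excluded-middle λ d → ¬¬-decide n (P ∘ suc) λ ds → k λ { zero → d ; (suc x) → ds x }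

power⇒∣ : ∀ {n} {x y : Fin n} → IsPowerOf n y x → gcd (toℕ x) n ∣ toℕ y
power⇒∣ {n} {x} {y} (k , q , e) = ∣m+n∣m⇒∣n
  (subst (gcd (toℕ x) n ∣_) e (∣n⇒∣m*n k (gcd[m,n]∣m (toℕ x) n)))
  (∣n⇒∣m*n q (gcd[m,n]∣n (toℕ x) n))

-- Bézout. When x has the negative coefficient -u, it is replaced by u (n - 1), which is congruent
-- modulo n.
∣⇒power : ∀ {n} {x y : Fin n} → gcd (toℕ x) n ∣ toℕ y → IsPowerOf n y x
∣⇒power {n} {x} {y} (divides c y≡) with Bézout.identity (gcd-GCD (toℕ x) n)
... | Bézout.+- u v eq = c * u , c * v , (begin
  c * u * toℕ x                       ≡⟨ *-assoc c u (toℕ x) ⟩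
  c * (u * toℕ x)                     ≡⟨ cong (c *_) (sym eq) ⟩
  c * (gcd (toℕ x) n + v * n)         ≡⟨ lemma c (gcd (toℕ x) n) v n ⟩
  c * v * n + c * gcd (toℕ x) n       ≡⟨ cong (c * v * n +_) (sym y≡) ⟩
  c * v * n + toℕ y                   ∎)
  where
  open ≡-Reasoning
  lemma : ∀ c d v n → c * (d + v * n) ≡ c * v * n + c * d
  lemma = solve-∀
... | Bézout.-+ u v eq = k , Q ∸ toℕ y , +-cancelʳ-≡ (toℕ y * n) _ _ (begin
  k * toℕ x + toℕ y * n               ≡⟨ key ⟩
  Q * n + toℕ y ≡⟨ cong (λ z → z * n + toℕ y) (sym (m∸n+n≡m y≤Q)) ⟩
  (Q ∸ toℕ y + toℕ y) * n + toℕ y     ≡⟨ lemma′ (Q ∸ toℕ y) (toℕ y) n (toℕ y) ⟩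
  (Q ∸ toℕ y) * n + toℕ y + toℕ y * n ∎)
  where
  open ≡-Reasoning
  k Q : ℕ
  k = c * u * pred n
  Q = c * v * pred n
  sn : suc (pred n) ≡ n
  sn = suc-pred n {{>-nonZero (≤-<-trans z≤n (Fin.toℕ<n x))}}
  lemma : ∀ c u m x d → c * u * m * x + c * d * suc m ≡ c * m * (d + u * x) + c * d
  lemma = solve-∀
  lemma″ : ∀ c m v n → c * m * (v * n) ≡ c * v * m * n
  lemma″ = solve-∀
  lemma′ : ∀ a b n y → (a + b) * n + y ≡ a * n + y + b * n
  lemma′ = solve-∀
  key : k * toℕ x + toℕ y * n ≡ Q * n + toℕ y
  key = begin
    k * toℕ x + toℕ y * n ≡⟨ cong₂ (λ y n → k * toℕ x + y * n) y≡ (sym sn) ⟩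
    k * toℕ x + c * gcd (toℕ x) n * suc (pred n) ≡⟨ lemma c u (pred n) (toℕ x) (gcd (toℕ x) n) ⟩
    c * pred n * (gcd (toℕ x) n + u * toℕ x) + c * gcd (toℕ x) n ≡⟨ cong₂ (λ s y → c * pred n * s + y) eq (sym y≡) ⟩
    c * pred n * (v * n) + toℕ y ≡⟨ cong (_+ toℕ y) (lemma″ c (pred n) v n) ⟩
    Q * n + toℕ y                                               ∎
  -- Needed to subtract y n from both sides of `key`; Q < y would give n ≤ y.
  y≤Q : toℕ y ≤ Q
  y≤Q = ≮⇒≥ λ Q<y → <⇒≱ (Fin.toℕ<n y) (+-cancelˡ-≤ (Q * n) n (toℕ y)
    (≤-trans (≤-reflexive (+-comm (Q * n) n)) (≤-trans (*-monoˡ-≤ n Q<y) (≤-trans (m≤n+m _ (k * toℕ x)) (≤-reflexive key)))))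

path-snoc : ∀ {n X u x y} → Path n X u x → Adj n x y → y ∉ X → Path n X u y
path-snoc (stay u∉)     adj y∉ = step u∉ adj (stay y∉)
path-snoc (step u∉ a p) adj y∉ = step u∉ a (path-snoc p adj y∉)

∣∣≡sum : ∀ {n} (X : Subset n) → ∣ X ∣ ≡ sum (λ i → ⟦ lookup X i ⟧)
∣∣≡sum []          = refl
∣∣≡sum (true ∷ X)  = cong suc (∣∣≡sum X)
∣∣≡sum (false ∷ X) = ∣∣≡sum X

sum-mono : ∀ {n} {f g : Fin n → ℕ} → (∀ i → f i ≤ g i) → sum f ≤ sum g
sum-mono {zero}  h = z≤n
sum-mono {suc n} h = +-mono-≤ (h zero) (sum-mono (h ∘ suc))

module Graph {n : ℕ} {G : Space} (Mod : Model n G) where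
  open Space G using (_≽_; ∑; separator) renaming (_≟_ to _≟ᴳ_)
  open Model Mod

  ϑ : Fin n → Pt G
  ϑ x = θ (toℕ x)

  ⟨_⟩ : (Pt G → Bool) → Subset n
  ⟨ ζ ⟩ = tabulate (ζ ∘ ϑ)

  ∈⟨⟩ : ∀ ζ {x} → ζ (ϑ x) ≡ true → x ∈ ⟨ ζ ⟩
  ∈⟨⟩ ζ {x} e = lookup⇒[]= x ⟨ ζ ⟩ (trans (lookup∘tabulate (ζ ∘ ϑ) x) e)

  ⟨⟩∈ : ∀ ζ {x} → x ∈ ⟨ ζ ⟩ → ζ (ϑ x) ≡ true
  ⟨⟩∈ ζ {x} m = trans (sym (lookup∘tabulate (ζ ∘ ϑ) x)) ([]=⇒lookup m)

  ∉⟨⟩ : ∀ ζ {x} → ζ (ϑ x) ≡ false → x ∉ ⟨ ζ ⟩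
  ∉⟨⟩ ζ e m = true≢false (⟨⟩∈ ζ m) e

  ∣⟨⟩∣ : ∀ ζ → ∣ ⟨ ζ ⟩ ∣ ≡ ∑ (λ x → ⟦ ζ x ⟧)
  ∣⟨⟩∣ ζ = trans (∣∣≡sum ⟨ ζ ⟩) (trans (sum-cong-≗ {n} (λ i → cong ⟦_⟧ (lookup∘tabulate (ζ ∘ ϑ) i))) (∑-θ _))

  ≽⇒adj : ∀ {x y} → x ≢ y → ϑ x ≽ ϑ y → Adj n x y
  ≽⇒adj ne r = ne , inj₁ (∣⇒power (≽⇒∣ r))

  adj⇒≽ : ∀ {x y} → Adj n x y → ϑ x ≽ ϑ y ⊎ ϑ y ≽ ϑ x
  adj⇒≽ (_ , inj₁ p) = inj₁ (∣⇒≽ (power⇒∣ p))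
  adj⇒≽ (_ , inj₂ p) = inj₂ (∣⇒≽ (power⇒∣ p))

  -- Outside ζ the colour does not change along an edge, hence not along a path.
  colouring-cut : ∀ ζ (colour : Pt G → Bool) →
    (∀ x y → ζ x ≡ false → ζ y ≡ false → x ≽ y → colour x ≡ colour y) →
    ∀ u v → ζ (ϑ u) ≡ false → ζ (ϑ v) ≡ false → colour (ϑ u) ≢ colour (ϑ v) → CutSet n ⟨ ζ ⟩
  colouring-cut ζ colour const u v ζu ζv ne = u , v , ∉⟨⟩ ζ ζu , ∉⟨⟩ ζ ζv , ne ∘ along
    where
    out : ∀ {x} → x ∉ ⟨ ζ ⟩ → ζ (ϑ x) ≡ false
    out x∉ = not-true⇒false (x∉ ∘ ∈⟨⟩ ζ)
    start : ∀ {x y} → Path n ⟨ ζ ⟩ x y → x ∉ ⟨ ζ ⟩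
    start (stay x∉)     = x∉
    start (step x∉ _ _) = x∉
    along : ∀ {x y} → Path n ⟨ ζ ⟩ x y → colour (ϑ x) ≡ colour (ϑ y)
    along (stay _) = refl
    along (step {w = w} x∉ adj p) with adj⇒≽ adj
    ... | inj₁ r = trans (const _ _ (out x∉) (out (start p)) r) (along p)
    ... | inj₂ r = trans (sym (const _ _ (out (start p)) (out x∉) r)) (along p)

  -- `X` need not be a union of classes. A class counts for a side as soon as one of its elements
  -- outside `X` lies there; a class counted for neither side is contained in `X`, so the loss in
  -- the lattice is at most the size of `X`.
  module _ {X : Subset n} {u v : Fin n} (u∉ : u ∉ X) (v∉ : v ∉ X) (cut : ¬ Path n X u v)
           (reach? : ∀ x → Dec (Path n X u x)) where
    private
      a? : ∀ l → Dec (∃[ x ] (ϑ x ≡ l × x ∉ X × Path n X u x))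
      a? l = Fin.any? λ x → (ϑ x ≟ᴳ l) ×-dec ¬? (x ∈? X) ×-dec reach? x
      b? : ∀ l → Dec (∃[ x ] (ϑ x ≡ l × x ∉ X × ¬ Path n X u x))
      b? l = Fin.any? λ x → (ϑ x ≟ᴳ l) ×-dec ¬? (x ∈? X) ×-dec ¬? (reach? x)

    component rest : Pt G → Bool
    component l = does (a? l)
    rest l      = does (b? l)

    component-nonempty : Nonempty G component
    component-nonempty = ϑ u , dec-true (a? _) (u , refl , u∉ , stay u∉)

    rest-nonempty : Nonempty G rest
    rest-nonempty = ϑ v , dec-true (b? _) (v , refl , v∉ , cut)

    component-separated : Separated G component rest
    component-separated l l′ p q with does-true (a? l) p | does-true (b? l′) q
    ... | x , refl , x∉ , r | y , refl , y∉ , ¬r =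
        (λ x≽y → ¬r (path-snoc r (≽⇒adj x≢y x≽y) y∉))
      , (λ y≽x → ¬r (path-snoc r (swap (≽⇒adj (x≢y ∘ sym) y≽x)) y∉))
      where
      x≢y : x ≢ y
      x≢y refl = ¬r r
      swap : ∀ {x y} → Adj n y x → Adj n x y
      swap (ne , inj₁ p) = ne ∘ sym , inj₂ p
      swap (ne , inj₂ p) = ne ∘ sym , inj₁ p

    outside⇒∈ : ∀ x → component (ϑ x) ≡ false → rest (ϑ x) ≡ false → x ∈ X
    outside⇒∈ x p q with x ∈? X
    ... | yes x∈ = x∈
    ... | no x∉ with reach? x
    ...   | yes r = contradiction (x , refl , x∉ , r) (does-false (a? _) p)
    ...   | no ¬r = contradiction (x , refl , x∉ , ¬r) (does-false (b? _) q)

    separator≤∣X∣ : ∑ (separator component rest) ≤ ∣ X ∣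
    separator≤∣X∣ = subst₂ _≤_ (∑-θ (separator component rest)) (sym (∣∣≡sum X)) (sum-mono {n} λ x → ⟦⟧-mono λ e →
      let p , q = split (component (ϑ x)) (rest (ϑ x)) e in []=⇒lookup (outside⇒∈ x p q))
      where
      split : ∀ b c → not (b ∨ c) ≡ true → b ≡ false × c ≡ false
      split false false _ = refl , refl

  ⊇∧≤⇒≡ : ∀ {X} ζ → (∀ x → ζ (ϑ x) ≡ true → x ∈ X) → ∣ X ∣ ≤ ∣ ⟨ ζ ⟩ ∣ → X ≡ ⟨ ζ ⟩
  ⊇∧≤⇒≡ {X} ζ sup le = ⊆-antisym X⊆ (sup _ ∘ ⟨⟩∈ ζ)
    where
    X⊆ : X ⊆ ⟨ ζ ⟩
    X⊆ {x} x∈ with x ∈? ⟨ ζ ⟩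
    ... | yes m = m
    ... | no m = contradiction (p⊂q⇒∣p∣<∣q∣ ((λ {y} → sup y ∘ ⟨⟩∈ ζ) , x , x∈ , m)) (≤⇒≯ le)

module GridGraph {L : Space} {a m b : ℕ} (hyps : GridHyps L a m b) {n : ℕ} (Mod : Model n (Grid.G L a m b)) where
  open Grid L a m b
  open Graph Mod

  -- Minimality against the two candidates refutes both strict outcomes of `separation`; in the
  -- others `X` contains a candidate and is no larger.
  min-cut : CutSet n ⟨ ζr ⟩ → CutSet n ⟨ ζm ⟩ → ∀ X → MinCutSet n X → X ≡ ⟨ ζr ⟩ ⊎ X ≡ ⟨ ζm ⟩
  min-cut cutr cutm X ((u , v , u∉ , v∉ , ¬path) , minimal) =
    decidable-stable (Vec-≡-dec _≟ᵇ_ X ⟨ ζr ⟩ ⊎-dec Vec-≡-dec _≟ᵇ_ X ⟨ ζm ⟩) λ ¬goal →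
      ¬¬-decide n (Path n X u) λ reach? → ¬goal (decided reach?)
    where
    ≤r : ∣ X ∣ ≤ ∣ ⟨ ζr ⟩ ∣
    ≤r = minimal _ cutr
    ≤m : ∣ X ∣ ≤ ∣ ⟨ ζm ⟩ ∣
    ≤m = minimal _ cutm
    decided : (∀ x → Dec (Path n X u x)) → X ≡ ⟨ ζr ⟩ ⊎ X ≡ ⟨ ζm ⟩
    decided reach? with separation hyps (component u∉ v∉ ¬path reach?) (rest u∉ v∉ ¬path reach?)
                          (component-separated u∉ v∉ ¬path reach?) (component-nonempty u∉ v∉ ¬path reach?) (rest-nonempty u∉ v∉ ¬path reach?)
                        | separator≤∣X∣ u∉ v∉ ¬path reach?
    ... | inj₁ lt | le = contradiction (≤-trans lt (≤-trans le (≤-trans ≤r (≤-reflexive (trans (∣⟨⟩∣ ζr) (ζr-weight hyps)))))) (<-irrefl refl)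
    ... | inj₂ (inj₁ lt) | le = contradiction (≤-trans lt (≤-trans le (≤-trans ≤m (≤-reflexive (∣⟨⟩∣ ζm))))) (<-irrefl refl)
    ... | inj₂ (inj₂ (inj₁ (p , q))) | _ = inj₁ (⊇∧≤⇒≡ ζr (λ x e → outside⇒∈ u∉ v∉ ¬path reach? x (p _ e) (q _ e)) ≤r)
    ... | inj₂ (inj₂ (inj₂ (p , q))) | _ = inj₂ (⊇∧≤⇒≡ ζm (λ x e → outside⇒∈ u∉ v∉ ¬path reach? x (p _ e) (q _ e)) ≤m)

-- Orders, subgroups and totients in terms of divisibility

*-div : ∀ c D .{{_ : NonZero D}} → (c * D) div D ≡ c
*-div c (suc d) = m*n/n≡m c (suc d)

factor>0 : ∀ {n} (x : Fin n) {y z} → n ≡ y * z → 0 < y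
factor>0 x {zero}  e = contradiction (sym e) (<⇒≢ (≤-<-trans z≤n (Fin.toℕ<n x)))
factor>0 x {suc y} e = s≤s z≤n

InS⇔∣ : ∀ {n} D .{{_ : NonZero D}} {x : Fin n} → D ∣ n →
        (InS n (n div D) x → D ∣ toℕ x) × (D ∣ toℕ x → InS n (n div D) x)
InS⇔∣ {n} D {x} (divides c n≡) =
    (λ s → *-cancelˡ-∣ c {{>-nonZero (factor>0 x n≡)}} (subst₂ (λ u v → u ∣ v * toℕ x) n≡ div≡ s))
  , (λ d → subst₂ (λ u v → u ∣ v * toℕ x) (sym n≡) (sym div≡) (*-monoʳ-∣ c d))
  where
  div≡ : n div D ≡ c
  div≡ = trans (cong (_div D) n≡) (*-div c D)

-- The order of x is n / gcd(x, n): if n divides k x, it divides gcd(k x, k n) = k gcd(x, n).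
InE⇔gcd : ∀ {n} g .{{_ : NonZero g}} {x : Fin n} → g ∣ n →
          (InE n (n div g) x → gcd (toℕ x) n ≡ g) × (gcd (toℕ x) n ≡ g → InE n (n div g) x)
InE⇔gcd {n} g {x} (divides c n≡) with gcd[m,n]∣n (toℕ x) n
... | divides d n≡d = to , from
  where
  h : ℕ
  h = gcd (toℕ x) n
  div≡ : n div g ≡ c
  div≡ = trans (cong (_div g) n≡) (*-div c g)
  h≢0 : NonZero h
  h≢0 = >-nonZero (factor>0 x (trans n≡d (*-comm d h)))
  order-h : HasOrder n x d
  order-h = factor>0 x n≡d
          , subst (_∣ d * toℕ x) (sym n≡d) (*-monoʳ-∣ d (gcd[m,n]∣m (toℕ x) n))
          , λ k k>0 n∣ → ∣⇒≤ {{>-nonZero k>0}} (*-cancelʳ-∣ h {{h≢0}} (subst₂ _∣_ n≡d refl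
              (subst (n ∣_) (sym (c*gcd[m,n]≡gcd[cm,cn] k (toℕ x) n)) (gcd-greatest n∣ (n∣m*n k)))))
  to : InE n (n div g) x → h ≡ g
  to (c>0 , n∣ , least) = *-cancelˡ-≡ h g d {{>-nonZero (factor>0 x n≡d)}} (trans (sym n≡d) (trans n≡ (cong (_* g) (sym d≡c))))
    where
    d≡c : d ≡ c
    d≡c = ≤-antisym (proj₂ (proj₂ order-h) c (subst (0 <_) div≡ c>0) (subst (λ y → n ∣ y * toℕ x) div≡ n∣))
                    (≤-trans (≤-reflexive (sym div≡)) (least d (proj₁ order-h) (proj₁ (proj₂ order-h))))
  from : h ≡ g → InE n (n div g) x
  from h≡g = subst (λ y → HasOrder n x y) (trans d≡c (sym div≡)) order-h
    where
    d≡c : d ≡ c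
    d≡c = *-cancelʳ-≡ d c g (trans (cong (d *_) (sym h≡g)) (trans (sym n≡d) n≡))

castModel : ∀ {n n′ L} → n ≡ n′ → Model n L → Model n′ L
castModel {L = L} e Mod = record
  { θ        = M.θ
  ; periodic = subst (λ n → ∀ x → M.θ (x + n) ≡ M.θ x) e M.periodic
  ; ∑-θ      = subst (λ n → ∀ f → ∑< n (f ∘ M.θ) ≡ Space.∑ L f) e M.∑-θ
  ; ∣⇒≽ = subst (λ n → ∀ {x y} → gcd x n ∣ y → Space._≽_ L (M.θ x) (M.θ y)) e M.∣⇒≽
  ; ≽⇒∣ = subst (λ n → ∀ {x y} → Space._≽_ L (M.θ x) (M.θ y) → gcd x n ∣ y) e M.≽⇒∣
  ; top⇒1    = subst (λ n → ∀ {x} → M.θ x ≡ Space.top L → gcd x n ≡ 1) e M.top⇒1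
  ; 1⇒top    = subst (λ n → ∀ {x} → gcd x n ≡ 1 → M.θ x ≡ Space.top L) e M.1⇒top
  }
  where module M = Model Mod

φ-* : ∀ {a b L K} → Model a L → Model b K → Coprime a b → .{{_ : NonZero b}} → φ (a * b) ≡ φ a * φ b
φ-* {a} {b} {L} {K} A B cop = trans (φ-model (A ⊗ᴹ B ∣ cop))
  (trans (⊗-top-weight L K) (trans (*-comm (Space.top-weight K) (Space.top-weight L)) (cong₂ _*_ (sym (φ-model A)) (sym (φ-model B)))))

prodTo-cong : ∀ r {f g : ℕ → ℕ} → (∀ i → 1 ≤ i → i ≤ r → f i ≡ g i) → prodTo f r ≡ prodTo g r
prodTo-cong zero    h = refl
prodTo-cong (suc r) h = cong₂ _*_ (prodTo-cong r λ i 1≤i i≤r → h i 1≤i (m≤n⇒m≤1+n i≤r)) (h (suc r) (s≤s z≤n) ≤-refl)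

prodTo-* : ∀ r f g → prodTo (λ i → f i * g i) r ≡ prodTo f r * prodTo g r
prodTo-* zero    f g = refl
prodTo-* (suc r) f g = trans (cong (_* (f (suc r) * g (suc r))) (prodTo-* r f g)) (lemma (prodTo f r) (prodTo g r) (f (suc r)) (g (suc r)))
  where
  lemma : ∀ u v x y → u * v * (x * y) ≡ u * x * (v * y)
  lemma = solve-∀

prodTo-pos : ∀ r f → (∀ i → 1 ≤ f i) → 1 ≤ prodTo f r
prodTo-pos zero    f h = ≤-refl
prodTo-pos (suc r) f h = *-mono-≤ (prodTo-pos r f h) (h (suc r))

∣prodTo : ∀ r f {i} → 1 ≤ i → i ≤ r → f i ∣ prodTo f r
∣prodTo zero    f 1≤i i≤0 = contradiction (≤-trans 1≤i i≤0) λ ()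
∣prodTo (suc r) f {i} 1≤i i≤ with m≤n⇒m<n∨m≡n i≤
... | inj₁ (s≤s i≤r) = ∣m⇒∣m*n (f (suc r)) (∣prodTo r f 1≤i i≤r)
... | inj₂ refl      = n∣m*n (prodTo f r)

prime∣^ : ∀ {p q} → Prime p → ∀ s → p ∣ q ^ s → p ∣ q
prime∣^ pp zero    d = contradiction (subst Prime (∣1⇒≡1 d) pp) ¬prime[1]
prime∣^ {q = q} pp (suc s) d with euclidsLemma q (q ^ s) pp d
... | inj₁ d = d
... | inj₂ d = prime∣^ pp s d

prime∣prime : ∀ {p q} → Prime p → Prime q → p ∣ q → p ≡ q
prime∣prime pp qq d with prime⇒irreducible qq d
... | inj₁ refl = contradiction pp ¬prime[1]
... | inj₂ e    = e

-- An increasing family of primes and the lattice of its first members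

module Family (a : ℕ → ℕ) (r : ℕ)
  (primes : ∀ {i} → 1 ≤ i → i ≤ r → Prime (suc (a i)))
  (increasing : ∀ {i j} → 1 ≤ i → i < j → j ≤ r → a i < a j) where

  q : ℕ → ℕ
  q i = suc (a i)

  q∣q : ∀ {i j} → 1 ≤ i → i ≤ r → 1 ≤ j → j ≤ r → q i ∣ q j → i ≡ j
  q∣q {i} {j} 1≤i i≤r 1≤j j≤r d with <-cmp i j | suc-injective (prime∣prime (primes 1≤i i≤r) (primes 1≤j j≤r) d)
  ... | tri< lt _ _ | e = contradiction e (<⇒≢ (increasing 1≤i lt j≤r))
  ... | tri≈ _ e _  | _ = e
  ... | tri> _ _ lt | e = contradiction (sym e) (<⇒≢ (increasing 1≤j lt i≤r))

  q-coprime : ∀ {i j} → 1 ≤ i → i ≤ r → 1 ≤ j → j ≤ r → i ≢ j → ∀ s → Coprime (q i) (q j ^ s)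
  q-coprime {i} {j} 1≤i i≤r 1≤j j≤r ne s = gcd≡1⇒coprime
    (prime∤⇒gcd≡1 (primes 1≤j j≤r) (λ d → ne (sym (q∣q 1≤j j≤r 1≤i i≤r d))) s)

  module Exponents (m : ℕ → ℕ) where

    N : ℕ → ℕ
    N = prodTo (λ i → q i ^ suc (m i))

    q∣N : ∀ k {j} → k ≤ r → 1 ≤ j → j ≤ r → q j ∣ N k → j ≤ k
    q∣N zero k≤r 1≤j j≤r d = contradiction (subst Prime (∣1⇒≡1 d) (primes 1≤j j≤r)) ¬prime[1]
    q∣N (suc k) k≤r 1≤j j≤r d with euclidsLemma (N k) _ (primes 1≤j j≤r) d
    ... | inj₁ d = m≤n⇒m≤1+n (q∣N k (≤-trans (n≤1+n k) k≤r) 1≤j j≤r d)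
    ... | inj₂ d = ≤-reflexive (q∣q 1≤j j≤r (s≤s z≤n) k≤r (prime∣^ (primes 1≤j j≤r) (suc (m (suc k))) d))

    N-coprime : ∀ {k j} → k < j → j ≤ r → ∀ s → Coprime (N k) (q j ^ s)
    N-coprime {k} {j} k<j j≤r s = gcd≡1⇒coprime (prime∤⇒gcd≡1 (primes 1≤j j≤r) (λ d → <⇒≱ k<j (q∣N k (≤-trans (<⇒≤ k<j) j≤r) 1≤j j≤r d)) s)
      where 1≤j = ≤-trans (s≤s z≤n) k<j

    -- `Lattice k` has k + 1 chains; with k = r - 3 it is the layer, and the last two chains remain
    -- for the grid.
    Lattice : ℕ → Space
    Lattice zero    = Chain (a 1) (suc (m 1))
    Lattice (suc k) = Lattice k ⊗ Chain (a (2 + k)) (suc (m (2 + k)))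

    lattice-model : ∀ k → suc k ≤ r → Model (N (suc k)) (Lattice k)
    lattice-model zero 1≤r = castModel (sym (*-identityˡ (q 1 ^ suc (m 1)))) (PrimePower.model (a 1) (primes ≤-refl 1≤r) (suc (m 1)))
    lattice-model (suc k) k<r = (lattice-model k (≤-trans (n≤1+n _) k<r)
      ⊗ᴹ PrimePower.model (a (2 + k)) (primes (s≤s z≤n) k<r) (suc (m (2 + k)))
      ∣ N-coprime ≤-refl k<r (suc (m (2 + k)))) {{m^n≢0 (q (2 + k)) (suc (m (2 + k)))}}

    -- P is the product of the first k primes, Φ its totient, and W the common factor: N = W P and
    -- φ(N) = W Φ.
    W Φ P : ℕ → ℕ
    W = prodTo (λ i → q i ^ m i)
    Φ = prodTo a
    P = prodTo q

    N≡ : ∀ k → N k ≡ W k * P k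
    N≡ k = trans (prodTo-cong k λ i _ _ → *-comm (q i) (q i ^ m i)) (prodTo-* k (λ i → q i ^ m i) q)

    φ-q : ∀ {j} → 1 ≤ j → j ≤ r → ∀ s → φ (q j ^ suc s) ≡ q j ^ s * a j
    φ-q {j} 1≤j j≤r s = trans (φ-model (PrimePower.model (a j) (primes 1≤j j≤r) (suc s))) (trans (chain-top-weight (a j) s) (*-comm (a j) _))

    φ-N : ∀ k → suc k ≤ r → φ (N (suc k)) ≡ W (suc k) * Φ (suc k)
    φ-N zero 1≤r = trans (cong φ (*-identityˡ (q 1 ^ suc (m 1)))) (trans (φ-q ≤-refl 1≤r (m 1)) (sym (cong₂ _*_ (*-identityˡ (q 1 ^ m 1)) (*-identityˡ (a 1)))))
    φ-N (suc k) k<r = trans (φ-* (lattice-model k (≤-trans (n≤1+n _) k<r)) (PrimePower.model (a (2 + k)) (primes (s≤s z≤n) k<r) (suc (m (2 + k))))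
                               (N-coprime ≤-refl k<r (suc (m (2 + k)))) {{m^n≢0 (q (2 + k)) (suc (m (2 + k)))}})
                      (trans (cong₂ _*_ (φ-N k (≤-trans (n≤1+n _) k<r)) (φ-q (s≤s z≤n) k<r (m (2 + k))))
                             (lemma (W (suc k)) (Φ (suc k)) (q (2 + k) ^ m (2 + k)) (a (2 + k))))
      where
      lemma : ∀ u v x y → u * v * (x * y) ≡ u * x * (v * y)
      lemma = solve-∀

    lattice-top-weight : ∀ k → suc k ≤ r → Space.top-weight (Lattice k) ≡ W (suc k) * Φ (suc k)
    lattice-top-weight k k<r = trans (sym (φ-model (lattice-model k k<r))) (φ-N k k<r)

    lattice-weight : ∀ k → suc k ≤ r → Space.top-weight (Lattice k) + Space.rest-weight (Lattice k) ≡ W (suc k) * P (suc k)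
    lattice-weight k k<r = trans (sym (Space.∑-1 (Lattice k))) (trans (sym (Model.∑-θ (lattice-model k k<r) (λ _ → 1)))
      (trans (∑<-const (N (suc k)) 1) (trans (*-identityʳ _) (N≡ (suc k)))))

    lattice-upBound : ∀ k → suc k ≤ r → Space.UpBound (Lattice k) (q (suc k))
    lattice-upBound zero    1≤r = chain-upBound (a 1) (m 1)
    lattice-upBound (suc k) k<r = ⊗-upBound (Lattice k) (Chain (a (2 + k)) (suc (m (2 + k)))) {q (2 + k)}
      (upBound-mono (Lattice k) {q (suc k)} {q (2 + k)} (s≤s (<⇒≤ (increasing (s≤s z≤n) ≤-refl k<r))) (lattice-upBound k (≤-trans (n≤1+n _) k<r)))
      (chain-upBound (a (2 + k)) (m (2 + k)))

    prime-divisor : ∀ k x → k ≤ r → gcd x (N k) ≡ 1 ⊎ (∃[ i ] (1 ≤ i × i ≤ k × q i ∣ x))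
    prime-divisor zero    x k≤r = inj₁ (gcd-zeroʳ x)
    prime-divisor (suc k) x k≤r with prime-divisor k x (≤-trans (n≤1+n k) k≤r) | q (suc k) ∣? x
    ... | _ | yes d = inj₂ (suc k , s≤s z≤n , ≤-refl , d)
    ... | inj₂ (i , 1≤i , i≤k , d) | no _ = inj₂ (i , 1≤i , m≤n⇒m≤1+n i≤k , d)
    ... | inj₁ e | no ¬d = inj₁ (∣1⇒≡1 (subst (gcd x (N (suc k)) ∣_)
            (cong₂ _*_ e (prime∤⇒gcd≡1 (primes (s≤s z≤n) k≤r) ¬d (suc (m (suc k))))) (gcd-*-∣ x (N k) _)))

  private
    module Unit = Exponents (λ _ → 0)

    Unit-N : ∀ j → Unit.N j ≡ prodTo q j
    Unit-N j = prodTo-cong j λ i _ _ → *-identityʳ (q i)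

  φ-primorial : ∀ j → suc j ≤ r → φ (prodTo q (suc j)) ≡ prodTo a (suc j)
  φ-primorial j j<r = trans (cong φ (sym (Unit-N (suc j)))) (trans (Unit.φ-N j j<r) (trans (cong (_* prodTo a (suc j)) (ones (suc j))) (*-identityˡ _)))
    where
    ones : ∀ j → Unit.W j ≡ 1
    ones zero    = refl
    ones (suc j) = trans (*-identityʳ _) (ones j)

  -- For the value at p₁⋯p_r / p_{r-1} in β, a product that skips one prime.
  φ-primorial-* : ∀ k {j} → suc k < j → j ≤ r → φ (prodTo q (suc k) * q j) ≡ prodTo a (suc k) * a j
  φ-primorial-* k {j} k<j j≤r = trans (cong φ (cong₂ _*_ (sym (Unit-N (suc k))) (sym (*-identityʳ (q j)))))
    (trans (φ-* (Unit.lattice-model k k<r) (PrimePower.model (a j) (primes 1≤j j≤r) 1) (Unit.N-coprime k<j j≤r 1) {{m^n≢0 (q j) 1}})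
           (cong₂ _*_ (trans (cong φ (Unit-N (suc k))) (φ-primorial k k<r)) (trans (Unit.φ-q 1≤j j≤r 0) (+-identityʳ (a j)))))
    where
    1≤j = ≤-trans (s≤s z≤n) k<j
    k<r = ≤-trans (<⇒≤ k<j) j≤r

-- The two candidate cut-sets: elements, disconnection and size

open import Data.Integer as ℤ using (+_)
import Data.Integer.Properties as ℤ
import Data.Integer.Tactic.RingSolver as ℤSolver

module ChainDepth (a : ℕ) (pp : Prime (suc a)) where
  open PrimePower a pp

  depth-last : ∀ m x → depth a m x ≡ fromℕ m → suc a ^ m ∣ x
  depth-last m x e = subst (_∣ x) (trans (gcd-depth m x) (cong (suc a ^_) (trans (cong toℕ e) (Fin.toℕ-fromℕ m)))) (gcd[m,n]∣m x (suc a ^ m))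

  last-depth : ∀ m x → suc a ^ m ∣ x → depth a m x ≡ fromℕ m
  last-depth m x d = Fin.toℕ-injective (trans (≤-antisym (Fin.toℕ≤pred[n] (depth a m x)) (≮⇒≥ λ lt → <⇒≢ (^-monoʳ-< (suc a) 1<p lt)
      (trans (sym (gcd-depth m x)) (∣-antisym (gcd[m,n]∣n x (suc a ^ m)) (gcd-greatest d ∣-refl))))) (sym (Fin.toℕ-fromℕ m)))

  depth-nonzero : ∀ m x → depth a (suc m) x ≢ zero → suc a ∣ x
  depth-nonzero m x ne with suc a ∣? x
  ... | yes d = d
  ... | no _  = contradiction refl ne

  nonzero-depth : ∀ m x → suc a ∣ x → depth a (suc m) x ≢ zero
  nonzero-depth m x d with suc a ∣? x
  ... | yes _ = λ ()
  ... | no ¬d = contradiction d ¬d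

module GridSets (L : Space) (a m b : ℕ) where
  open Grid L a m b
  private
    module L = Space L
    last = fromℕ (suc m)

  ζr-true : ∀ l j v → ζr (l , j , v) ≡ true → (v ≡ zero × j ≡ zero × l ≡ L.top) ⊎ (v ≢ zero × (j ≢ zero ⊎ l ≢ L.top))
  ζr-true l j v e with v Fin.≟ zero | j Fin.≟ zero | L.top? l
  ... | yes p | yes q | yes r = inj₁ (p , q , r)
  ... | no p  | no q  | _     = inj₂ (p , inj₁ q)
  ... | no p  | yes q | no r  = inj₂ (p , inj₂ r)

  true-ζr : ∀ l j v → (v ≡ zero × j ≡ zero × l ≡ L.top) ⊎ (v ≢ zero × (j ≢ zero ⊎ l ≢ L.top)) → ζr (l , j , v) ≡ true
  true-ζr l j v h with v Fin.≟ zero | j Fin.≟ zero | L.top? l | h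
  ... | yes p | yes q | yes r | _ = refl
  ... | yes p | no q  | _     | inj₁ (_ , e , _) = contradiction e q
  ... | yes p | yes q | no r  | inj₁ (_ , _ , e) = contradiction e r
  ... | yes p | _     | _     | inj₂ (e , _) = contradiction p e
  ... | no p  | _     | _     | inj₁ (e , _) = contradiction e p
  ... | no p  | no q  | _     | inj₂ _ = refl
  ... | no p  | yes q | no r  | inj₂ _ = refl
  ... | no p  | yes q | yes r | inj₂ (_ , inj₁ e) = contradiction q e
  ... | no p  | yes q | yes r | inj₂ (_ , inj₂ e) = contradiction r e

  ζm-true : ∀ l j v → ζm (l , j , v) ≡ true → (j ≢ last × v ≡ zero × l ≡ L.top) ⊎ (j ≡ last × (v ≢ zero ⊎ l ≢ L.top))
  ζm-true l j v e with j Fin.≟ last | v Fin.≟ zero | L.top? l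
  ... | no p  | yes q | yes r = inj₁ (p , q , r)
  ... | yes p | no q  | _     = inj₂ (p , inj₁ q)
  ... | yes p | yes q | no r  = inj₂ (p , inj₂ r)

  true-ζm : ∀ l j v → (j ≢ last × v ≡ zero × l ≡ L.top) ⊎ (j ≡ last × (v ≢ zero ⊎ l ≢ L.top)) → ζm (l , j , v) ≡ true
  true-ζm l j v h with j Fin.≟ last | v Fin.≟ zero | L.top? l | h
  ... | no p  | yes q | yes r | _ = refl
  ... | no p  | no q  | _     | inj₁ (_ , e , _) = contradiction e q
  ... | no p  | yes q | no r  | inj₁ (_ , _ , e) = contradiction e r
  ... | no p  | _     | _     | inj₂ (e , _) = contradiction e p
  ... | yes p | _     | _     | inj₁ (e , _) = contradiction p e
  ... | yes p | no q  | _     | inj₂ _ = refl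
  ... | yes p | yes q | no r  | inj₂ _ = refl
  ... | yes p | yes q | yes r | inj₂ (_ , inj₁ e) = contradiction q e
  ... | yes p | yes q | yes r | inj₂ (_ , inj₂ e) = contradiction r e

  not-ζr : ∀ l j v → ζr (l , j , v) ≡ false → v ≡ zero × ¬ (j ≡ zero × l ≡ L.top) ⊎ v ≢ zero × j ≡ zero × l ≡ L.top
  not-ζr l j v e with v Fin.≟ zero | j Fin.≟ zero | L.top? l
  ... | yes p | no q  | _     = inj₁ (p , q ∘ proj₁)
  ... | yes p | yes q | no r  = inj₁ (p , r ∘ proj₂)
  ... | no p  | yes q | yes r = inj₂ (p , q , r)

  not-ζm : ∀ l j v → ζm (l , j , v) ≡ false → j ≡ last × v ≡ zero × l ≡ L.top ⊎ j ≢ last × ¬ (v ≡ zero × l ≡ L.top)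
  not-ζm l j v e with j Fin.≟ last | v Fin.≟ zero | L.top? l
  ... | yes p | yes q | yes r = inj₁ (p , q , r)
  ... | no p  | no q  | _     = inj₂ (p , q ∘ proj₁)
  ... | no p  | yes q | no r  = inj₂ (p , r ∘ proj₂)

  -- Outside ζr the only point with v ≠ 0 is (top, 0, 1); outside ζm the only point with j = last is
  -- (top, last, 0).
  colour-r colour-m : G.Pt → Bool
  colour-r (l , j , v) = does (v Fin.≟ zero)
  colour-m (l , j , v) = does (j Fin.≟ last)

  colour-r-const : ∀ x y → ζr x ≡ false → ζr y ≡ false → x G.≽ y → colour-r x ≡ colour-r y
  colour-r-const (l , j , v) (l′ , j′ , v′) e e′ (l≽ , j≤ , v≤) with not-ζr l j v e | not-ζr l′ j′ v′ e′
  ... | inj₁ (refl , _) | inj₁ (refl , _) = refl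
  ... | inj₁ (refl , ¬top) | inj₂ (_ , refl , refl) = contradiction (Fin.toℕ-injective (n≤0⇒n≡0 j≤) , L.≽-top l≽) ¬top
  ... | inj₂ (v≢ , _) | inj₁ (refl , _) = contradiction (Fin.toℕ-injective (n≤0⇒n≡0 v≤)) v≢
  ... | inj₂ (v≢ , _) | inj₂ (v′≢ , _) = trans (dec-false (v Fin.≟ zero) v≢) (sym (dec-false (v′ Fin.≟ zero) v′≢))

  colour-m-const : ∀ x y → ζm x ≡ false → ζm y ≡ false → x G.≽ y → colour-m x ≡ colour-m y
  colour-m-const (l , j , v) (l′ , j′ , v′) e e′ (l≽ , j≤ , v≤) with not-ζm l j v e | not-ζm l′ j′ v′ e′
  ... | inj₁ (refl , _) | inj₁ (refl , _) = refl
  ... | inj₂ (_ , ¬top) | inj₁ (_ , refl , refl) = contradiction (Fin.toℕ-injective (n≤0⇒n≡0 v≤) , L.≽-top l≽) ¬top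
  ... | inj₁ (refl , _) | inj₂ (j′≢ , _) = contradiction (Fin.toℕ-injective (≤-antisym (Fin.≤fromℕ j′) j≤)) j′≢
  ... | inj₂ (j≢ , _) | inj₂ (j′≢ , _) = trans (dec-false (j Fin.≟ last) j≢) (sym (dec-false (j′ Fin.≟ last) j′≢))

module Core (a m : ℕ → ℕ) (k : ℕ)
  (primes : ∀ {i} → 1 ≤ i → i ≤ 3 + k → Prime (suc (a i)))
  (increasing : ∀ {i j} → 1 ≤ i → i < j → j ≤ 3 + k → a i < a j)
  (m-last : m (3 + k) ≡ 0)
  (hyps : GridHyps (Family.Exponents.Lattice a (3 + k) primes increasing m k) (a (2 + k)) (m (2 + k)) (a (3 + k))) where

  open Family a (3 + k) primes increasing
  open Exponents m

  r i₁ μ A B n : ℕ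
  r  = 3 + k
  i₁ = 2 + k
  μ  = m i₁
  A  = q i₁
  B  = q r
  n  = N r

  open Grid (Lattice k) (a i₁) μ (a r) using (G; ζr; ζm; ζr-weight; ζm-weight; M)
  open GridSets (Lattice k) (a i₁) μ (a r)
  open GridHyps hyps using (τ; ρ; z)

  1≤i₁ : 1 ≤ i₁
  1≤i₁ = s≤s z≤n

  1≤r : 1 ≤ r
  1≤r = s≤s z≤n

  i₁≤r : i₁ ≤ r
  i₁≤r = n≤1+n i₁

  i₁≢r : i₁ ≢ r
  i₁≢r = <⇒≢ ≤-refl

  k<r : suc k ≤ r
  k<r = ≤-trans (n≤1+n _) i₁≤r

  below : ∀ {i} → 1 ≤ i → i ≤ r → i ≤ suc k ⊎ i ≡ i₁ ⊎ i ≡ r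
  below _ i≤ with m≤n⇒m<n∨m≡n i≤
  ... | inj₂ e = inj₂ (inj₂ e)
  ... | inj₁ (s≤s lt) with m≤n⇒m<n∨m≡n lt
  ...   | inj₂ e = inj₂ (inj₁ e)
  ...   | inj₁ (s≤s lt) = inj₁ lt

  n≡ : N (suc k) * (A ^ suc μ * B ^ 1) ≡ n
  n≡ = trans (sym (*-assoc (N (suc k)) (A ^ suc μ) (B ^ 1))) (cong (λ s → N (suc k) * A ^ suc μ * B ^ suc s) (sym m-last))

  module DA = ChainDepth (a i₁) (primes 1≤i₁ i₁≤r)
  module DB = ChainDepth (a r) (primes 1≤r ≤-refl)
  module ModL = Model (lattice-model k k<r)

  ⊤L : Pt (Lattice k)
  ⊤L = Space.top (Lattice k)

  cop-AB : Coprime (A ^ suc μ) (B ^ 1)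
  cop-AB = gcd≡1⇒coprime (prime∤⇒gcd≡1 (primes 1≤r ≤-refl) (λ d → i₁≢r (sym (q∣q 1≤r ≤-refl 1≤i₁ i₁≤r (prime∣^ (primes 1≤r ≤-refl) (suc μ) d)))) 1)

  cop-NAB : Coprime (N (suc k)) (A ^ suc μ * B ^ 1)
  cop-NAB {d} (d∣N , d∣AB) = ∣1⇒≡1 (subst (d ∣_) (cong₂ _*_ (one (N-coprime ≤-refl i₁≤r (suc μ))) (one (N-coprime (s≤s (n≤1+n _)) ≤-refl 1)))
      (∣-trans (∣*⇒∣gcd*gcd d (A ^ suc μ) (B ^ 1) d∣AB) (*-pres-∣ (gcd-mono (A ^ suc μ)) (gcd-mono (B ^ 1)))))
    where
    one : ∀ {x y} → Coprime x y → gcd x y ≡ 1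
    one = coprime⇒gcd≡1
    gcd-mono : ∀ y → gcd d y ∣ gcd (N (suc k)) y
    gcd-mono y = gcd-greatest (∣-trans (gcd[m,n]∣m d y) d∣N) (gcd[m,n]∣n d y)

  grid-model : Model n G
  grid-model = castModel n≡ ((lattice-model k k<r ⊗ᴹ
      (PrimePower.model (a i₁) (primes 1≤i₁ i₁≤r) (suc μ) ⊗ᴹ PrimePower.model (a r) (primes 1≤r ≤-refl) 1 ∣ cop-AB) {{m^n≢0 B 1}}
      ∣ cop-NAB) {{m*n≢0 _ _ {{m^n≢0 A (suc μ)}} {{m^n≢0 B 1}}}})

  open Graph grid-model
  open Model grid-model using (θ; top⇒1; 1⇒top)

  gcd-n : ∀ x → gcd x n ≡ gcd x (N (suc k)) * (A ^ toℕ (depth (a i₁) (suc μ) x) * B ^ toℕ (depth (a r) 1 x))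
  gcd-n x = trans (cong (gcd x) (sym n≡)) (trans (gcd-* x cop-NAB) (cong (gcd x (N (suc k)) *_)
    (trans (gcd-* x cop-AB) (cong₂ _*_ (PrimePower.gcd-depth (a i₁) (primes 1≤i₁ i₁≤r) (suc μ) x) (PrimePower.gcd-depth (a r) (primes 1≤r ≤-refl) 1 x)))))

  last : Fin (suc (suc μ))
  last = fromℕ (suc μ)

  depthA : ℕ → Fin (suc (suc μ))
  depthA = depth (a i₁) (suc μ)

  depthB : ℕ → Fin 2
  depthB = depth (a r) 1

  B∣ : ∀ {x} → depthB x ≢ zero → B ^ 1 ∣ x
  B∣ {x} ne = subst (_∣ x) (sym (*-identityʳ B)) (DB.depth-nonzero 0 x ne)

  ∣n : ∀ {i} → 1 ≤ i → i ≤ r → q i ^ suc (m i) ∣ n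
  ∣n = ∣prodTo r (λ i → q i ^ suc (m i))

  q∣n : ∀ {i} → 1 ≤ i → i ≤ r → q i ∣ n
  q∣n {i} 1≤i i≤r = ∣-trans (m∣m*n (q i ^ m i)) (∣n 1≤i i≤r)

  q*q^∣ : ∀ {i j s y} → 1 ≤ i → i ≤ r → 1 ≤ j → j ≤ r → i ≢ j → q i ∣ y → q j ^ s ∣ y → q i * q j ^ s ∣ y
  q*q^∣ {s = s} 1≤i i≤r 1≤j j≤r ne = coprime-*-∣ (q-coprime 1≤i i≤r 1≤j j≤r ne s)

  coprime⇒¬∣ : ∀ {i x} → 1 ≤ i → i ≤ suc k → q i ∣ x → ModL.θ x ≢ ⊤L
  coprime⇒¬∣ {i} {x} 1≤i i≤k d e = contradiction (subst Prime (∣1⇒≡1 (subst (q i ∣_) (ModL.top⇒1 e)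
      (gcd-greatest d (∣-trans (m∣m*n (q i ^ m i)) (∣prodTo (suc k) (λ i → q i ^ suc (m i)) 1≤i i≤k)))))
      (primes 1≤i (≤-trans i≤k k<r))) ¬prime[1]

  below-prime : ∀ {x} → ModL.θ x ≢ ⊤L → ∃[ i ] (1 ≤ i × i ≤ suc k × q i ∣ x)
  below-prime {x} ne with prime-divisor (suc k) x k<r
  ... | inj₁ e = contradiction (ModL.1⇒top e) ne
  ... | inj₂ h = h

  InS-B : ∀ {i x} → 1 ≤ i → i ≤ r → i ≢ r →
    (InS n (n div (q i * B ^ 1)) x → q i * B ^ 1 ∣ toℕ x) × (q i * B ^ 1 ∣ toℕ x → InS n (n div (q i * B ^ 1)) x)
  InS-B {i} 1≤i i≤r i≢r = InS⇔∣ (q i * B ^ 1) {{m*n≢0 (q i) (B ^ 1) {{_}} {{m^n≢0 B 1}}}}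
    (q*q^∣ {s = 1} 1≤i i≤r 1≤r ≤-refl i≢r (q∣n 1≤i i≤r) (subst (_∣ n) (sym (*-identityʳ B)) (q∣n 1≤r ≤-refl)))

  -- Z_r^1 consists of the x that are coprime to n and of those divisible by p_r and another prime
  -- p_i.
  InZ⇒ζr : ∀ {x} → InZ n r q r 1 x → ζr (ϑ x) ≡ true
  InZ⇒ζr {x} (inj₁ (zero , _ , E)) = true-ζr _ _ _ (inj₁ (cong (proj₂ ∘ proj₂) top≡ , cong (proj₁ ∘ proj₂) top≡ , cong proj₁ top≡))
    where
    top≡ : θ (toℕ x) ≡ Space.top G
    top≡ = 1⇒top (proj₁ (InE⇔gcd 1 (1∣ n)) E)
  InZ⇒ζr (inj₁ (suc _ , s≤s () , _))
  InZ⇒ζr {x} (inj₂ (i , 1≤i , i≤r , i≢r , S)) = true-ζr _ _ _ (inj₂ (DB.nonzero-depth 0 (toℕ x) B∣x , side (below 1≤i i≤r)))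
    where
    d : q i * B ^ 1 ∣ toℕ x
    d = proj₁ (InS-B 1≤i i≤r i≢r) S
    B∣x : B ∣ toℕ x
    B∣x = subst (_∣ toℕ x) (*-identityʳ B) (m*n∣⇒n∣ (q i) (B ^ 1) d)
    q∣x : q i ∣ toℕ x
    q∣x = m*n∣⇒m∣ (q i) (B ^ 1) d
    side : i ≤ suc k ⊎ i ≡ i₁ ⊎ i ≡ r → depthA (toℕ x) ≢ zero ⊎ ModL.θ (toℕ x) ≢ ⊤L
    side (inj₁ i≤k)         = inj₂ (coprime⇒¬∣ 1≤i i≤k q∣x)
    side (inj₂ (inj₁ refl)) = inj₁ (DA.nonzero-depth μ (toℕ x) q∣x)
    side (inj₂ (inj₂ e))    = contradiction e i≢r

  ζr⇒InZ : ∀ {x} → ζr (ϑ x) ≡ true → InZ n r q r 1 x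
  ζr⇒InZ {x} e with ζr-true _ _ _ e
  ... | inj₁ (v≡ , j≡ , l≡) = inj₁ (0 , s≤s z≤n , proj₂ (InE⇔gcd 1 (1∣ n)) (top⇒1 (cong₂ _,_ l≡ (cong₂ _,_ j≡ v≡))))
  ... | inj₂ (v≢ , j≢⊎l≢) = from (divisor j≢⊎l≢)
    where
    divisor : depthA (toℕ x) ≢ zero ⊎ ModL.θ (toℕ x) ≢ ⊤L → ∃[ i ] (1 ≤ i × i ≤ r × i ≢ r × q i ∣ toℕ x)
    divisor (inj₁ j≢) = i₁ , 1≤i₁ , i₁≤r , i₁≢r , DA.depth-nonzero μ (toℕ x) j≢
    divisor (inj₂ l≢) = let i , 1≤i , i≤k , d = below-prime l≢ in i , 1≤i , ≤-trans i≤k k<r , <⇒≢ (s≤s (≤-trans i≤k (n≤1+n _))) , d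
    from : ∃[ i ] (1 ≤ i × i ≤ r × i ≢ r × q i ∣ toℕ x) → InZ n r q r 1 x
    from (i , 1≤i , i≤r , i≢r , d) = inj₂ (i , 1≤i , i≤r , i≢r ,
      proj₂ (InS-B 1≤i i≤r i≢r)
        (q*q^∣ {s = 1} 1≤i i≤r 1≤r ≤-refl i≢r d (B∣ v≢)))

  private
    A^∣n : ∀ {j} → j < suc μ → A ^ j ∣ n
    A^∣n lt = ∣-trans (^-∣-^ A (<⇒≤ lt)) (∣n 1≤i₁ i₁≤r)

  InS-A : ∀ {i x} → 1 ≤ i → i ≤ r → i ≢ i₁ →
    (InS n (n div (q i * A ^ suc μ)) x → q i * A ^ suc μ ∣ toℕ x) × (q i * A ^ suc μ ∣ toℕ x → InS n (n div (q i * A ^ suc μ)) x)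
  InS-A {i} 1≤i i≤r i≢i₁ = InS⇔∣ (q i * A ^ suc μ) {{m*n≢0 (q i) (A ^ suc μ) {{_}} {{m^n≢0 A (suc μ)}}}}
    (q*q^∣ {s = suc μ} 1≤i i≤r 1≤i₁ i₁≤r i≢i₁ (q∣n 1≤i i≤r) (∣n 1≤i₁ i₁≤r))

  -- With A = p_{r-1}, the elements are the x whose gcd with n is A^j for some j ≤ μ, and those
  -- divisible by A^(μ + 1) and by another prime p_i.
  InZ⇒ζm : ∀ {x} → InZ n r q i₁ (suc μ) x → ζm (ϑ x) ≡ true
  InZ⇒ζm {x} (inj₁ (j , j<sμ , E)) = true-ζm _ _ _ (inj₁ (not-last , not-B (depthB (toℕ x) Fin.≟ zero) , not-below (Space.top? (Lattice k) _)))
    where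
    gcd≡ : gcd (toℕ x) n ≡ A ^ j
    gcd≡ = proj₁ (InE⇔gcd (A ^ j) {{m^n≢0 A j}} (A^∣n j<sμ)) E
    only-A : ∀ {i} → 1 ≤ i → i ≤ r → q i ∣ toℕ x → i ≡ i₁
    only-A 1≤i i≤r d = q∣q 1≤i i≤r 1≤i₁ i₁≤r (prime∣^ (primes 1≤i i≤r) j (subst (_ ∣_) gcd≡ (gcd-greatest d (q∣n 1≤i i≤r))))
    not-last : depthA (toℕ x) ≢ last
    not-last e = <⇒≱ (^-monoʳ-< A (PrimePower.1<p (a i₁) (primes 1≤i₁ i₁≤r)) j<sμ)
      (∣⇒≤ {{m^n≢0 A j}} (subst (A ^ suc μ ∣_) gcd≡ (gcd-greatest (DA.depth-last (suc μ) (toℕ x) e) (∣n 1≤i₁ i₁≤r))))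
    not-B : Dec (depthB (toℕ x) ≡ zero) → depthB (toℕ x) ≡ zero
    not-B (yes e) = e
    not-B (no ne) = contradiction (sym (only-A 1≤r ≤-refl (DB.depth-nonzero 0 (toℕ x) ne))) i₁≢r
    not-below : Dec (ModL.θ (toℕ x) ≡ ⊤L) → ModL.θ (toℕ x) ≡ ⊤L
    not-below (yes e) = e
    not-below (no ne) = let i , 1≤i , i≤k , d = below-prime ne in
      contradiction (only-A 1≤i (≤-trans i≤k k<r) d) (<⇒≢ (s≤s i≤k))
  InZ⇒ζm {x} (inj₂ (i , 1≤i , i≤r , i≢i₁ , S)) = true-ζm _ _ _ (inj₂ (DA.last-depth (suc μ) (toℕ x) (m*n∣⇒n∣ (q i) (A ^ suc μ) d) , side (below 1≤i i≤r)))
    where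
    d : q i * A ^ suc μ ∣ toℕ x
    d = proj₁ (InS-A 1≤i i≤r i≢i₁) S
    q∣x : q i ∣ toℕ x
    q∣x = m*n∣⇒m∣ (q i) (A ^ suc μ) d
    side : i ≤ suc k ⊎ i ≡ i₁ ⊎ i ≡ r → depthB (toℕ x) ≢ zero ⊎ ModL.θ (toℕ x) ≢ ⊤L
    side (inj₁ i≤k)         = inj₂ (coprime⇒¬∣ 1≤i i≤k q∣x)
    side (inj₂ (inj₁ e))    = contradiction e i≢i₁
    side (inj₂ (inj₂ refl)) = inj₁ (DB.nonzero-depth 0 (toℕ x) q∣x)

  ζm⇒InZ : ∀ {x} → ζm (ϑ x) ≡ true → InZ n r q i₁ (suc μ) x
  ζm⇒InZ {x} e with ζm-true _ _ _ e
  ... | inj₁ (j≢ , v≡ , l≡) = inj₁ (toℕ (depthA (toℕ x)) , j< , proj₂ (InE⇔gcd (A ^ toℕ (depthA (toℕ x))) {{m^n≢0 A (toℕ (depthA (toℕ x)))}} (A^∣n j<)) gcd≡)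
    where
    j< : toℕ (depthA (toℕ x)) < suc μ
    j< = ≤∧≢⇒< (Fin.toℕ≤pred[n] (depthA (toℕ x))) λ e → j≢ (Fin.toℕ-injective (trans e (sym (Fin.toℕ-fromℕ (suc μ)))))
    gcd≡ : gcd (toℕ x) n ≡ A ^ toℕ (depthA (toℕ x))
    gcd≡ = trans (gcd-n (toℕ x)) (trans (cong₂ (λ g v → g * (A ^ toℕ (depthA (toℕ x)) * B ^ toℕ v)) (ModL.top⇒1 l≡) v≡)
             (trans (*-identityˡ _) (*-identityʳ _)))
  ... | inj₂ (j≡ , v≢⊎l≢) = from (divisor v≢⊎l≢)
    where
    divisor : depthB (toℕ x) ≢ zero ⊎ ModL.θ (toℕ x) ≢ ⊤L → ∃[ i ] (1 ≤ i × i ≤ r × i ≢ i₁ × q i ∣ toℕ x)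
    divisor (inj₁ v≢) = r , 1≤r , ≤-refl , ≢-sym i₁≢r , DB.depth-nonzero 0 (toℕ x) v≢
    divisor (inj₂ l≢) = let i , 1≤i , i≤k , d = below-prime l≢ in i , 1≤i , ≤-trans i≤k k<r , <⇒≢ (s≤s i≤k) , d
    from : ∃[ i ] (1 ≤ i × i ≤ r × i ≢ i₁ × q i ∣ toℕ x) → InZ n r q i₁ (suc μ) x
    from (i , 1≤i , i≤r , i≢i₁ , d) = inj₂ (i , 1≤i , i≤r , i≢i₁ ,
      proj₂ (InS-A 1≤i i≤r i≢i₁)
        (q*q^∣ {s = suc μ} 1≤i i≤r 1≤i₁ i₁≤r i≢i₁ d (DA.depth-last (suc μ) (toℕ x) j≡)))

  private
    A^<n : A ^ suc μ < n
    A^<n = subst (A ^ suc μ <_) n≡ (begin-strict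
      A ^ suc μ <⟨ m<m*n (A ^ suc μ) (B ^ 1) {{m^n≢0 A (suc μ)}} 1<B ⟩
      A ^ suc μ * B ^ 1 ≤⟨ m≤n*m (A ^ suc μ * B ^ 1) (N (suc k)) {{>-nonZero (prodTo-pos (suc k) _ λ i → m^n>0 (q i) (suc (m i)))}} ⟩
      N (suc k) * (A ^ suc μ * B ^ 1)    ∎)
      where
      open ≤-Reasoning
      1<B : 1 < B ^ 1
      1<B = subst (1 <_) (sym (*-identityʳ B)) (PrimePower.1<p (a r) (primes 1≤r ≤-refl))

    B<n : B < n
    B<n = subst (B <_) n≡ (begin-strict
      B                                  ≡⟨ sym (*-identityʳ B) ⟩
      B ^ 1 <⟨ m<m*n (B ^ 1) (A ^ suc μ) {{m^n≢0 B 1}} 1<A ⟩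
      B ^ 1 * A ^ suc μ                  ≡⟨ *-comm (B ^ 1) (A ^ suc μ) ⟩
      A ^ suc μ * B ^ 1 ≤⟨ m≤n*m (A ^ suc μ * B ^ 1) (N (suc k)) {{>-nonZero (prodTo-pos (suc k) _ λ i → m^n>0 (q i) (suc (m i)))}} ⟩
      N (suc k) * (A ^ suc μ * B ^ 1)    ∎)
      where
      open ≤-Reasoning
      1<A : 1 < A ^ suc μ
      1<A = ≤-trans (PrimePower.1<p (a i₁) (primes 1≤i₁ i₁≤r)) (m≤m*n A (A ^ μ) {{m^n≢0 A μ}})

    -- One pair serves both cuts: v is in the class that ζr isolates, u in the class that ζm
    -- isolates, and each is on the other side for the other cut.
    u v : Fin n
    u = fromℕ< A^<n
    v = fromℕ< B<n

    θu : ϑ u ≡ (⊤L , last , zero)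
    θu = trans (cong θ (Fin.toℕ-fromℕ< A^<n)) (cong₂ _,_
      (ModL.1⇒top (trans (gcd-comm _ (N (suc k))) (coprime⇒gcd≡1 (N-coprime ≤-refl i₁≤r (suc μ)))))
      (cong₂ _,_ (DA.last-depth (suc μ) (A ^ suc μ) ∣-refl) (lemma (depthB (A ^ suc μ) Fin.≟ zero))))
      where
      lemma : Dec (depthB (A ^ suc μ) ≡ zero) → depthB (A ^ suc μ) ≡ zero
      lemma (yes e) = e
      lemma (no ne) = contradiction (sym (q∣q 1≤r ≤-refl 1≤i₁ i₁≤r (prime∣^ (primes 1≤r ≤-refl) (suc μ) (DB.depth-nonzero 0 (A ^ suc μ) ne)))) i₁≢r

    θv : ϑ v ≡ (⊤L , zero , suc zero)
    θv = trans (cong θ (Fin.toℕ-fromℕ< B<n)) (cong₂ _,_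
      (ModL.1⇒top (trans (gcd-comm B (N (suc k))) (coprime⇒gcd≡1 (subst (Coprime (N (suc k))) (*-identityʳ B) (N-coprime (s≤s (n≤1+n _)) ≤-refl 1)))))
      (cong₂ _,_ (lemma (depthA B Fin.≟ zero)) (lemma′ (depthB B) (DB.nonzero-depth 0 B ∣-refl))))
      where
      lemma : Dec (depthA B ≡ zero) → depthA B ≡ zero
      lemma (yes e) = e
      lemma (no ne) = contradiction (q∣q 1≤i₁ i₁≤r 1≤r ≤-refl (DA.depth-nonzero μ B ne)) i₁≢r
      lemma′ : ∀ (j : Fin 2) → j ≢ zero → j ≡ suc zero
      lemma′ zero       ne = contradiction refl ne
      lemma′ (suc zero) _  = refl

    by-cases : ∀ {b : Bool} {S T : Set} → (b ≡ true → S ⊎ T) → ¬ S → ¬ T → b ≡ false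
    by-cases h ¬s ¬t = not-true⇒false λ e → [ ¬s , ¬t ]′ (h e)

  ζr-cut : CutSet n ⟨ ζr ⟩
  ζr-cut = colouring-cut ζr colour-r colour-r-const u v
    (trans (cong ζr θu) (by-cases (ζr-true ⊤L last zero) (λ (_ , e , _) → contradiction e λ ()) (λ (e , _) → e refl)))
    (trans (cong ζr θv) (by-cases (ζr-true ⊤L zero (suc zero)) (λ (e , _) → contradiction e λ ()) (λ (_ , e) → [ (λ ne → ne refl) , (λ ne → ne refl) ]′ e)))
    λ e → contradiction (trans (sym (cong colour-r θu)) (trans e (cong colour-r θv))) λ ()

  ζm-cut : CutSet n ⟨ ζm ⟩
  ζm-cut = colouring-cut ζm colour-m colour-m-const u v
    (trans (cong ζm θu) (by-cases (ζm-true ⊤L last zero) (λ (ne , _) → ne refl) (λ (_ , e) → [ (λ ne → ne refl) , (λ ne → ne refl) ]′ e)))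
    (trans (cong ζm θv) (by-cases (ζm-true ⊤L zero (suc zero)) (λ (_ , e , _) → contradiction e λ ()) (λ (e , _) → contradiction e λ ())))
    λ e → contradiction (trans (sym (dec-true (last Fin.≟ last) refl)) (trans (sym (cong colour-m θu)) (trans e (cong colour-m θv)))) λ ()

  private
    P≢0 : ∀ {j} → NonZero (P j)
    P≢0 {j} = >-nonZero (prodTo-pos j q λ _ → s≤s z≤n)

    Wr≡ : W r ≡ W (suc k) * M
    Wr≡ = trans (cong (λ s → W (suc k) * M * B ^ s) m-last) (*-identityʳ _)

    n-div-P : n div P r ≡ W (suc k) * M
    n-div-P = trans (cong (_div P r) (N≡ r)) (trans (*-div (W r) (P r) {{P≢0 {r}}}) Wr≡)

    φn≡ : φ n ≡ W (suc k) * M * (Φ (suc k) * a i₁ * a r)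
    φn≡ = trans (φ-N (2 + k) ≤-refl) (cong (_* Φ r) Wr≡)

    τ≡ : τ ≡ W (suc k) * Φ (suc k)
    τ≡ = lattice-top-weight k k<r

    τ+ρ≡ : τ + ρ ≡ W (suc k) * P (suc k)
    τ+ρ≡ = lattice-weight k k<r

    -- The factor p_a^(s - 1) - 2 in β is -1 for s = 1, so the identity is proved over ℕ with the
    -- negative term on the other side.
    to-ℤ : ∀ y x w f g t → y + w * (f * 2) ≡ x + w * (g + f * t) →
           + y ≡ + x ℤ.+ + w ℤ.* (+ g ℤ.+ + f ℤ.* (+ t ℤ.- + 2))
    to-ℤ y x w f g t e = begin
      + y ≡⟨ lemma₁ (+ y) (+ w) (+ f) ⟩
      + y ℤ.+ + w ℤ.* (+ f ℤ.* + 2) ℤ.- + w ℤ.* (+ f ℤ.* + 2) ≡⟨ cong (ℤ._- (+ w ℤ.* (+ f ℤ.* + 2))) (sym cast-left) ⟩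
      + (y + w * (f * 2)) ℤ.- + w ℤ.* (+ f ℤ.* + 2) ≡⟨ cong (λ s → + s ℤ.- + w ℤ.* (+ f ℤ.* + 2)) e ⟩
      + (x + w * (g + f * t)) ℤ.- + w ℤ.* (+ f ℤ.* + 2) ≡⟨ cong (ℤ._- (+ w ℤ.* (+ f ℤ.* + 2))) cast-right ⟩
      + x ℤ.+ + w ℤ.* (+ g ℤ.+ + f ℤ.* + t) ℤ.- + w ℤ.* (+ f ℤ.* + 2) ≡⟨ lemma₂ (+ x) (+ w) (+ g) (+ f) (+ t) (+ 2) ⟩
      + x ℤ.+ + w ℤ.* (+ g ℤ.+ + f ℤ.* (+ t ℤ.- + 2))                              ∎
      where
      open ≡-Reasoning
      lemma₁ : ∀ y w f → y ≡ y ℤ.+ w ℤ.* (f ℤ.* + 2) ℤ.- w ℤ.* (f ℤ.* + 2)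
      lemma₁ = ℤSolver.solve-∀
      lemma₂ : ∀ x w g f t c → x ℤ.+ w ℤ.* (g ℤ.+ f ℤ.* t) ℤ.- w ℤ.* (f ℤ.* c) ≡ x ℤ.+ w ℤ.* (g ℤ.+ f ℤ.* (t ℤ.- c))
      lemma₂ = ℤSolver.solve-∀
      cast-left : + (y + w * (f * 2)) ≡ + y ℤ.+ + w ℤ.* (+ f ℤ.* + 2)
      cast-left = trans (ℤ.pos-+ y _) (cong (ℤ._+_ (+ y)) (trans (ℤ.pos-* w _) (cong (ℤ._*_ (+ w)) (ℤ.pos-* f 2))))
      cast-right : + (x + w * (g + f * t)) ≡ + x ℤ.+ + w ℤ.* (+ g ℤ.+ + f ℤ.* + t)
      cast-right = trans (ℤ.pos-+ x _) (cong (ℤ._+_ (+ x)) (trans (ℤ.pos-* w _) (cong (ℤ._*_ (+ w)) (trans (ℤ.pos-+ g _) (cong (ℤ._+_ (+ g)) (ℤ.pos-* f t))))))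

    β≡ : ∀ i s {y w g f t} → (n div P r) div (q i ^ (s ∸ 1)) ≡ w → P r div q i ≡ g → φ g ≡ f → q i ^ (s ∸ 1) ≡ t →
         y + w * (f * 2) ≡ φ n + w * (g + f * t) → + y ≡ β n r q i s
    β≡ i s {y} {w} {g} {f} {t} refl refl refl refl e = to-ℤ y (φ n) w f g t e

  ∣ζr∣≡β : + ∣ ⟨ ζr ⟩ ∣ ≡ β n r q r 1
  ∣ζr∣≡β = β≡ r 1 {∣ ⟨ ζr ⟩ ∣} {W (suc k) * M} {P (2 + k)} {Φ (2 + k)} {1}
    (trans (cong (_div 1) n-div-P) (trans (cong (_div 1) (sym (*-identityʳ (W (suc k) * M)))) (*-div (W (suc k) * M) 1)))
    (*-div (P (2 + k)) B) (φ-primorial (suc k) i₁≤r) refl (begin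
      ∣ ⟨ ζr ⟩ ∣ + W₁ * M * (Φ₁ * a i₁ * 2) ≡⟨ cong (_+ W₁ * M * (Φ₁ * a i₁ * 2)) (trans (∣⟨⟩∣ ζr) (ζr-weight hyps)) ⟩
      M * (a i₁ * (a r * τ + ρ) + (τ + ρ)) + W₁ * M * (Φ₁ * a i₁ * 2) ≡⟨ lemma₁ M (a i₁) (a r) τ ρ W₁ Φ₁ ⟩
      M * (a i₁ * (a r * τ + ρ + W₁ * Φ₁) + (τ + ρ)) + W₁ * M * Φ₁ * a i₁ ≡⟨ cong (λ t → M * (a i₁ * (a r * τ + ρ + t) + (τ + ρ)) + W₁ * M * Φ₁ * a i₁) (sym τ≡) ⟩
      M * (a i₁ * (a r * τ + ρ + τ) + (τ + ρ)) + W₁ * M * Φ₁ * a i₁ ≡⟨ lemma₂ M (a i₁) (a r) τ ρ (W₁ * M * Φ₁ * a i₁) ⟩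
      M * (a i₁ * (a r * τ) + suc (a i₁) * (τ + ρ)) + W₁ * M * Φ₁ * a i₁ ≡⟨ cong₂ (λ t s → M * (a i₁ * (a r * t) + suc (a i₁) * s) + W₁ * M * Φ₁ * a i₁) τ≡ τ+ρ≡ ⟩
      M * (a i₁ * (a r * (W₁ * Φ₁)) + suc (a i₁) * (W₁ * P₁)) + W₁ * M * Φ₁ * a i₁ ≡⟨ lemma₃ M (a i₁) (a r) W₁ Φ₁ P₁ ⟩
      W₁ * M * (Φ₁ * a i₁ * a r) + W₁ * M * (P (2 + k) + Φ₁ * a i₁ * 1) ≡⟨ cong (_+ W₁ * M * (P (2 + k) + Φ₁ * a i₁ * 1)) (sym φn≡) ⟩
      φ n + W₁ * M * (P (2 + k) + Φ₁ * a i₁ * 1) ∎)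
    where
    open ≡-Reasoning
    W₁ Φ₁ P₁ : ℕ
    W₁ = W (suc k)
    Φ₁ = Φ (suc k)
    P₁ = P (suc k)
    lemma₁ : ∀ M a b τ ρ W Φ → M * (a * (b * τ + ρ) + (τ + ρ)) + W * M * (Φ * a * 2) ≡ M * (a * (b * τ + ρ + W * Φ) + (τ + ρ)) + W * M * Φ * a
    lemma₁ = solve-∀
    lemma₂ : ∀ M a b τ ρ X → M * (a * (b * τ + ρ + τ) + (τ + ρ)) + X ≡ M * (a * (b * τ) + suc a * (τ + ρ)) + X
    lemma₂ = solve-∀
    lemma₃ : ∀ M a b W Φ P → M * (a * (b * (W * Φ)) + suc a * (W * P)) + W * M * Φ * a ≡ W * M * (Φ * a * b) + W * M * (P * suc a + Φ * a * 1)
    lemma₃ = solve-∀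

  -- Of the two terms (p_r - 1) τ that come from the -2 in β, one completes `ζm-weight` and the
  -- other turns the last column into p_r (τ + ρ).
  ∣ζm∣≡β : + ∣ ⟨ ζm ⟩ ∣ ≡ β n r q i₁ (suc μ)
  ∣ζm∣≡β = β≡ i₁ (suc μ) {∣ ⟨ ζm ⟩ ∣} {W (suc k)} {P (suc k) * B} {Φ (suc k) * a r} {M}
    (trans (cong (_div M) n-div-P) (*-div (W (suc k)) M {{m^n≢0 A μ}}))
    (trans (cong (_div A) (lemma₀ (P (suc k)) A B)) (*-div (P (suc k) * B) A)) (φ-primorial-* k (s≤s (n≤1+n _)) ≤-refl) refl (begin
      ∣ ⟨ ζm ⟩ ∣ + W₁ * (Φ₁ * a r * 2) ≡⟨ cong (_+ W₁ * (Φ₁ * a r * 2)) (∣⟨⟩∣ ζm) ⟩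
      Z + W₁ * (Φ₁ * a r * 2) ≡⟨ lemma₁ Z W₁ Φ₁ (a r) ⟩
      Z + a r * (W₁ * Φ₁) + a r * (W₁ * Φ₁) ≡⟨ cong (λ t → Z + a r * t + a r * t) (sym τ≡) ⟩
      Z + a r * τ + a r * τ ≡⟨ cong (_+ a r * τ) (ζm-weight hyps) ⟩
      A * M * (a r * τ) + (a r * ρ + (τ + ρ)) + a r * τ ≡⟨ lemma₂ (A * M) (a r) τ ρ ⟩
      A * M * (a r * τ) + B * (τ + ρ) ≡⟨ cong₂ (λ t s → A * M * (a r * t) + B * s) τ≡ τ+ρ≡ ⟩
      A * M * (a r * (W₁ * Φ₁)) + B * (W₁ * P₁) ≡⟨ lemma₃ (a i₁) M (a r) W₁ Φ₁ P₁ ⟩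
      W₁ * M * (Φ₁ * a i₁ * a r) + W₁ * (P₁ * B + Φ₁ * a r * M) ≡⟨ cong (_+ W₁ * (P₁ * B + Φ₁ * a r * M)) (sym φn≡) ⟩
      φ n + W₁ * (P₁ * B + Φ₁ * a r * M)                              ∎)
    where
    open ≡-Reasoning
    W₁ Φ₁ P₁ Z : ℕ
    W₁ = W (suc k)
    Φ₁ = Φ (suc k)
    P₁ = P (suc k)
    Z  = Space.∑ G (λ x → ⟦ ζm x ⟧)
    lemma₀ : ∀ P A B → P * A * B ≡ P * B * A
    lemma₀ = solve-∀
    lemma₁ : ∀ Z W Φ b → Z + W * (Φ * b * 2) ≡ Z + b * (W * Φ) + b * (W * Φ)
    lemma₁ = solve-∀
    lemma₂ : ∀ X b τ ρ → X * (b * τ) + (b * ρ + (τ + ρ)) + b * τ ≡ X * (b * τ) + suc b * (τ + ρ)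
    lemma₂ = solve-∀
    lemma₃ : ∀ a M b W Φ P → suc a * M * (b * (W * Φ)) + suc b * (W * P) ≡ W * M * (Φ * a * b) + W * (P * suc b + Φ * b * M)
    lemma₃ = solve-∀

  -- For M = 1 the two sizes differ only by (p_r - p_{r-1}) ρ.
  ∣ζr∣<∣ζm∣ : μ ≡ 0 → ∣ ⟨ ζr ⟩ ∣ < ∣ ⟨ ζm ⟩ ∣
  ∣ζr∣<∣ζm∣ μ≡0 = subst₂ _<_ (sym (trans (∣⟨⟩∣ ζr) (ζr-weight hyps))) (sym (∣⟨⟩∣ ζm)) (+-cancelʳ-< (a r * τ) _ _ (begin-strict
    M * z + a r * τ ≡⟨ cong (λ M → M * z + a r * τ) M≡1 ⟩
    1 * z + a r * τ ≡⟨ lemma (a i₁) (a r) τ ρ ⟩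
    A * 1 * (a r * τ) + (a i₁ * ρ + (τ + ρ)) <⟨ +-monoʳ-< (A * 1 * (a r * τ)) (+-monoˡ-< (τ + ρ) (*-monoˡ-< ρ {{ρ≢0 ρ refl}} (increasing 1≤i₁ ≤-refl ≤-refl))) ⟩
    A * 1 * (a r * τ) + (a r * ρ + (τ + ρ)) ≡⟨ cong (λ M → A * M * (a r * τ) + (a r * ρ + (τ + ρ))) (sym M≡1) ⟩
    A * M * (a r * τ) + (a r * ρ + (τ + ρ)) ≡⟨ sym (ζm-weight hyps) ⟩
    Space.∑ G (λ x → ⟦ ζm x ⟧) + a r * τ                       ∎))
    where
    open ≤-Reasoning
    open GridHyps hyps using (1≤τ; τ≤2ρ)
    M≡1 : M ≡ 1
    M≡1 = cong (A ^_) μ≡0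
    lemma : ∀ a b τ ρ → 1 * (a * (b * τ + ρ) + (τ + ρ)) + b * τ ≡ suc a * 1 * (b * τ) + (a * ρ + (τ + ρ))
    lemma = solve-∀
    ρ≢0 : ∀ s → s ≡ ρ → NonZero s
    ρ≢0 zero e = contradiction (≤-trans 1≤τ (≤-trans τ≤2ρ (≤-reflexive (cong (2 *_) (sym e))))) λ ()
    ρ≢0 (suc _) _ = _

  min-cut-sets : ∀ X → MinCutSet n X →
    ((X ≐ InZ n r q r 1) × + ∣ X ∣ ≡ β n r q r 1) ⊎
    (μ ≢ 0 × (X ≐ InZ n r q i₁ (suc μ)) × + ∣ X ∣ ≡ β n r q i₁ (suc μ))
  min-cut-sets X min = [ inj₁ ∘ is-ζr , inj₂ ∘ is-ζm ]′ (GridGraph.min-cut {Lattice k} {a i₁} {μ} {a r} hyps {n} grid-model ζr-cut ζm-cut X min)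
    where
    is-ζr : X ≡ ⟨ ζr ⟩ → (X ≐ InZ n r q r 1) × + ∣ X ∣ ≡ β n r q r 1
    is-ζr e = subst (_≐ InZ n r q r 1) (sym e) (λ x → (λ h → ζr⇒InZ {x} (⟨⟩∈ ζr h)) , (λ h → ∈⟨⟩ ζr (InZ⇒ζr {x} h))) , trans (cong (λ Y → + ∣ Y ∣) e) ∣ζr∣≡β
    is-ζm : X ≡ ⟨ ζm ⟩ → μ ≢ 0 × (X ≐ InZ n r q i₁ (suc μ)) × + ∣ X ∣ ≡ β n r q i₁ (suc μ)
    is-ζm e = (λ μ≡0 → <⇒≱ (∣ζr∣<∣ζm∣ μ≡0) (subst (λ Y → ∣ Y ∣ ≤ ∣ ⟨ ζr ⟩ ∣) e (proj₂ min ⟨ ζr ⟩ ζr-cut)))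
            , subst (_≐ InZ n r q i₁ (suc μ)) (sym e) (λ x → (λ h → ζm⇒InZ {x} (⟨⟩∈ ζm h)) , (λ h → ∈⟨⟩ ζm (InZ⇒ζm {x} h)))
            , trans (cong (λ Y → + ∣ Y ∣) e) ∣ζm∣≡β

-- The weights t, s and the cut bound g are those of L divided by their common factor; q is the largest prime of L.
Good : (t s g q a b : ℕ) → Set
Good t s g q a b =
  1 ≤ t × s ≤ 2 * t × t ≤ 2 * s × grid-z a b t s < a * b * g ×
  (q * grid-z a b t s < a * b * ((1 + q) * t) ⊎
   (2 * g ≡ t + s × t ≤ s ×
    q * (suc a * grid-z a b t s) < suc a * (a * b * ((1 + q) * t)) + q * (a * b * t) ×
    q * (2 * grid-z a b t s) < 2 * (a * b * ((1 + q) * t)) + q * (a * (t + s))))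

-- The up-weight inequality alone fails for c, a, b = 2, 4, 6, where it would read 210 < 192. The
-- cut bound c + 1 is half of t + s, so the second alternative is available.
good-2 : ∀ {c a b} → 2 ≤ c → 2 + c ≤ a → 2 + a ≤ b → Good (1 * c) (1 + c + 1) (1 * c + 1) (1 + c) a b
good-2 {c} hc ha hb =
  let x , c≡ = m≤n⇒∃[o]m+o≡n hc
      y , a≡ = m≤n⇒∃[o]m+o≡n ha
      z , b≡ = m≤n⇒∃[o]m+o≡n hb
  in two-pos x y z c≡ a≡ b≡ , two-s x y z c≡ a≡ b≡ , two-t x y z c≡ a≡ b≡ , two-γ x y z c≡ a≡ b≡ ,
     inj₂ (twice c , two-half x y z c≡ a≡ b≡ , two-up₁ x y z c≡ a≡ b≡ , two-up₂ x y z c≡ a≡ b≡)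
  where
  twice : ∀ c → 2 * (1 * c + 1) ≡ 1 * c + (1 + c + 1)
  twice = solve-∀

good-3 : ∀ {c a b} → 4 ≤ c → 2 + c ≤ a → 6 + c ≤ b → Good (2 * c) (2 + c + 1) (2 * c + 1) (1 + c) a b
good-3 hc ha hb =
  let x , c≡ = m≤n⇒∃[o]m+o≡n hc
      y , a≡ = m≤n⇒∃[o]m+o≡n ha
      z , b≡ = m≤n⇒∃[o]m+o≡n hb
  in three-pos x y z c≡ a≡ b≡ , three-s x y z c≡ a≡ b≡ , three-t x y z c≡ a≡ b≡ , three-γ x y z c≡ a≡ b≡ ,
     inj₁ (three-up x y z c≡ a≡ b≡)

-- (e + 1)(c + 1)(d + 1) - e c d: the number of non-generators for three primes.
rest₃ : ℕ → ℕ → ℕ → ℕ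
rest₃ e c d = e * c + e * d + c * d + e + c + d + 1

-- The excess h is the larger value that `three-chains-cutBound` admits, the minimum of d and c + 3;
-- only the twin case d = c + 2 uses c ≤ 10.
good-3′ : ∀ {c d a b} → 4 ≤ c → 2 + c ≤ d → 2 + d ≤ a → 6 + d ≤ b → 6 + c ≤ a → 8 + c ≤ b → c ≤ 10 →
  ∃[ h ] (h ≤ d × h ≤ 2 + c + 1 × Good (2 * c * d) (rest₃ 2 c d) (2 * c * d + h) (1 + d) a b)
good-3′ {c} {d} {a} {b} hc hd ha hb ha′ hb′ c≤10 = by-gap (m≤n⇒m<n∨m≡n hd)
  where
  assemble : ∀ h → grid-z a b (2 * c * d) (rest₃ 2 c d) < a * b * (2 * c * d + h) →
    Good (2 * c * d) (rest₃ 2 c d) (2 * c * d + h) (1 + d) a b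
  assemble h hγ =
    let x , c≡ = m≤n⇒∃[o]m+o≡n hc
        y , d≡ = m≤n⇒∃[o]m+o≡n hd
        z , a≡ = m≤n⇒∃[o]m+o≡n ha
        w , b≡ = m≤n⇒∃[o]m+o≡n hb
    in three′-pos x y z w c≡ d≡ a≡ b≡ , three′-s x y z w c≡ d≡ a≡ b≡ , three′-t x y z w c≡ d≡ a≡ b≡ , hγ ,
       inj₁ (three′-up x y z w c≡ d≡ a≡ b≡)
  wide : 3 + c ≤ d → grid-z a b (2 * c * d) (rest₃ 2 c d) < a * b * (2 * c * d + (2 + c + 1))
  wide hd =
    let x , c≡ = m≤n⇒∃[o]m+o≡n hc
        y , d≡ = m≤n⇒∃[o]m+o≡n hd
        z , a≡ = m≤n⇒∃[o]m+o≡n ha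
        w , b≡ = m≤n⇒∃[o]m+o≡n hb
    in three′-wide x y z w c≡ d≡ a≡ b≡
  c*c≤ : c * c ≤ 7 * c + 30
  c*c≤ = ≤-trans (*-monoˡ-≤ c c≤10) (≤-trans (≤-reflexive (sym (split c))) (+-monoʳ-≤ (7 * c) (*-monoʳ-≤ 3 c≤10)))
    where
    split : ∀ c → 7 * c + 3 * c ≡ 10 * c
    split = solve-∀
  narrow : grid-z a b (2 * c * (2 + c)) (rest₃ 2 c (2 + c)) < a * b * (2 * c * (2 + c) + (2 + c))
  narrow =
    let z , a≡ = m≤n⇒∃[o]m+o≡n ha′
        w , b≡ = m≤n⇒∃[o]m+o≡n hb′
    in three′-narrow c z w c*c≤ a≡ b≡
  by-gap : 2 + c < d ⊎ 2 + c ≡ d → ∃[ h ] (h ≤ d × h ≤ 2 + c + 1 × Good (2 * c * d) (rest₃ 2 c d) (2 * c * d + h) (1 + d) a b)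
  by-gap (inj₁ 3+c≤d) = 2 + c + 1 , ≤-trans (≤-reflexive (+-comm (2 + c) 1)) 3+c≤d , ≤-refl , assemble (2 + c + 1) (wide 3+c≤d)
  by-gap (inj₂ 2+c≡d) = 2 + c , hd , m≤m+n (2 + c) 1 ,
    assemble (2 + c) (subst (λ d → grid-z a b (2 * c * d) (rest₃ 2 c d) < a * b * (2 * c * d + (2 + c))) 2+c≡d narrow)

module Hypotheses (a : ℕ → ℕ) (r : ℕ)
  (primes : ∀ {i} → 1 ≤ i → i ≤ r → Prime (suc (a i)))
  (increasing : ∀ {i j} → 1 ≤ i → i < j → j ≤ r → a i < a j)
  (m : ℕ → ℕ) where
  open Family a r primes increasing
  open Exponents m

  private
    Φ₂ : Φ 2 ≡ a 1 * a 2
    Φ₂ = cong (_* a 2) (*-identityˡ (a 1))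

    W₂ : pow (a 1) (m 1) * pow (a 2) (m 2) ≡ W 2
    W₂ = cong (_* q 2 ^ m 2) (sym (*-identityˡ (q 1 ^ m 1)))

    1≤W : ∀ k → 1 ≤ W k
    1≤W k = prodTo-pos k (λ i → q i ^ m i) λ i → pow-pos (a i) (m i)

    P₂ : ∀ x y → 1 * suc x * suc y ≡ x * y + (x + y + 1)
    P₂ = solve-∀

    P₃ : ∀ x y z → 1 * suc x * suc y * suc z ≡ x * y * z + (x * y + x * z + y * z + x + y + z + 1)
    P₃ = solve-∀

    cut₂ : 2 ≤ r → 1 ≤ a 1 → suc (a 1) ≤ a 1 * a 2 → CutBound (Lattice 1) (W 2 * (a 1 * a 2 + 1))
    cut₂ _ h h′ = subst (λ w → CutBound (Lattice 1) (w * (a 1 * a 2 + 1))) W₂ (two-chains-cutBound (a 1) (m 1) (a 2) (m 2) h h′)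

    weight₂ : 2 ≤ r → Space.top-weight (Lattice 1) + Space.rest-weight (Lattice 1) ≡ W 2 * (a 1 * a 2 + (a 1 + a 2 + 1))
    weight₂ 2≤r = trans (lattice-weight 1 2≤r) (cong (W 2 *_) (P₂ (a 1) (a 2)))

    top₂ : 2 ≤ r → Space.top-weight (Lattice 1) ≡ W 2 * (a 1 * a 2)
    top₂ 2≤r = trans (lattice-top-weight 1 2≤r) (cong (W 2 *_) Φ₂)

  hyps₂ : ∀ {α μ β} → 2 ≤ r → 4 ≤ α → 2 + α ≤ β → 1 ≤ a 1 → suc (a 1) ≤ a 1 * a 2 →
    Good (a 1 * a 2) (a 1 + a 2 + 1) (a 1 * a 2 + 1) (suc (a 2)) α β → GridHyps (Lattice 1) α μ β
  hyps₂ 2≤r hα hβ h h′ (g₁ , g₂ , g₃ , g₄ , g₅) = scaled-hyps (Lattice 1) _ _ _ (W 2) (a 1 * a 2) (a 1 + a 2 + 1) (a 1 * a 2 + 1) (suc (a 2))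
    (1≤W 2) (s≤s z≤n) (top₂ 2≤r) (weight₂ 2≤r) (lattice-upBound 1 2≤r) (cut₂ 2≤r h h′) hα hβ g₁ g₂ g₃ g₄ g₅

  hyps₃ : ∀ {α μ β h} → 3 ≤ r → 4 ≤ α → 2 + α ≤ β → 1 ≤ a 1 → suc (a 1) ≤ a 1 * a 2 → a 1 + a 2 + 1 ≤ a 1 * a 2 →
    h ≤ a 3 → h ≤ a 1 + a 2 + 1 →
    Good (a 1 * a 2 * a 3) (rest₃ (a 1) (a 2) (a 3)) (a 1 * a 2 * a 3 + h) (suc (a 3)) α β → GridHyps (Lattice 2) α μ β
  hyps₃ {h = h} 3≤r hα hβ h₁ h₂ h₃ h₄ h₅ (g₁ , g₂ , g₃ , g₄ , g₅) =
    scaled-hyps (Lattice 2) _ _ _ (W 3) (a 1 * a 2 * a 3) (rest₃ (a 1) (a 2) (a 3)) (a 1 * a 2 * a 3 + h) (suc (a 3))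
      (1≤W 3) (s≤s z≤n)
      (trans (lattice-top-weight 2 3≤r) (cong (λ x → W 3 * (x * a 3)) Φ₂))
      (trans (lattice-weight 2 3≤r) (cong (W 3 *_) (P₃ (a 1) (a 2) (a 3))))
      (lattice-upBound 2 3≤r)
      (three-chains-cutBound (Lattice 1) (W 2) (a 1) (a 2) (a 3) (m 3) h (lattice-upBound 1 2≤r) (cut₂ 2≤r h₁ h₂) (top₂ 2≤r) rest₂ h₃ h₄ h₅)
      hα hβ g₁ g₂ g₃ g₄ g₅
    where
    2≤r : 2 ≤ r
    2≤r = ≤-trans (n≤1+n 2) 3≤r
    rest₂ : Space.rest-weight (Lattice 1) ≡ W 2 * (a 1 + a 2 + 1)
    rest₂ = +-cancelˡ-≡ (Space.top-weight (Lattice 1)) _ _ (trans (weight₂ 2≤r)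
      (trans (*-distribˡ-+ (W 2) (a 1 * a 2) (a 1 + a 2 + 1)) (cong (λ x → x + W 2 * (a 1 + a 2 + 1)) (sym (top₂ 2≤r)))))

InZ-cong : ∀ {n r p p′ a s x} → (∀ i → 1 ≤ i → i ≤ r → p i ≡ p′ i) → 1 ≤ a → a ≤ r → InZ n r p a s x → InZ n r p′ a s x
InZ-cong {n} {x = x} h 1≤a a≤r (inj₁ (j , j<s , E)) = inj₁ (j , j<s , subst (λ c → InE n (n div (c ^ j)) x) (h _ 1≤a a≤r) E)
InZ-cong {n} {s = s} {x} h 1≤a a≤r (inj₂ (i , 1≤i , i≤r , i≢a , S)) =
  inj₂ (i , 1≤i , i≤r , i≢a , subst₂ (λ b c → InS n (n div (b * c ^ s)) x) (h i 1≤i i≤r) (h _ 1≤a a≤r) S)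

β-cong : ∀ {r p p′ a} n s → (∀ i → 1 ≤ i → i ≤ r → p i ≡ p′ i) → 1 ≤ a → a ≤ r → β n r p a s ≡ β n r p′ a s
β-cong {r} n s h 1≤a a≤r = cong₂ formula (prodTo-cong r h) (h _ 1≤a a≤r)
  where
  formula : ℕ → ℕ → ℤ.ℤ
  formula P c = + φ n ℤ.+ (+ ((n div P) div (c ^ (s ∸ 1)))) ℤ.* (+ (P div c) ℤ.+ (+ φ (P div c)) ℤ.* ((+ (c ^ (s ∸ 1))) ℤ.- (+ 2)))

connectivity≡ : ∀ {n X κ} → MinCutSet n X → IsConnectivity n κ → κ ≡ ∣ X ∣
connectivity≡ (cut , minimal) ((Y , cutY , refl) , least) = ≤-antisym (least _ cut) (minimal Y cutY)

-- The theorem in terms of the given primes and exponents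

module Conclusion (k : ℕ) (p e : ℕ → ℕ)
  (isPrime : ∀ i → 1 ≤ i → i ≤ 3 + k → Prime (p i))
  (incr : ∀ i j → 1 ≤ i → i < j → j ≤ 3 + k → p i < p j)
  (e≥1 : ∀ i → 1 ≤ i → i ≤ 3 + k → 1 ≤ e i)
  (e-last : e (3 + k) ≡ 1) where

  a m : ℕ → ℕ
  a i = pred (p i)
  m i = pred (e i)

  q≡p : ∀ i → 1 ≤ i → i ≤ 3 + k → suc (a i) ≡ p i
  q≡p i 1≤i i≤r = suc-pred (p i) {{prime⇒nonZero (isPrime i 1≤i i≤r)}}

  e≡ : ∀ i → 1 ≤ i → i ≤ 3 + k → suc (m i) ≡ e i
  e≡ i 1≤i i≤r = suc-pred (e i) {{>-nonZero (e≥1 i 1≤i i≤r)}}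

  primes : ∀ {i} → 1 ≤ i → i ≤ 3 + k → Prime (suc (a i))
  primes 1≤i i≤r = subst Prime (sym (q≡p _ 1≤i i≤r)) (isPrime _ 1≤i i≤r)

  increasing : ∀ {i j} → 1 ≤ i → i < j → j ≤ 3 + k → a i < a j
  increasing 1≤i i<j j≤r = s≤s⁻¹ (subst₂ _<_ (sym (q≡p _ 1≤i (≤-trans (<⇒≤ i<j) j≤r))) (sym (q≡p _ (≤-trans 1≤i (<⇒≤ i<j)) j≤r)) (incr _ _ 1≤i i<j j≤r))

  open Family a (3 + k) primes increasing public
  open Exponents m public
  open Hypotheses a (3 + k) primes increasing m public

  gap₂ : ∀ {i j} → 1 ≤ i → i < j → j ≤ 3 + k → 2 ≤ a i → 2 + a i ≤ a j
  gap₂ 1≤i i<j j≤r h = s≤s⁻¹ (prime-gap₂ (primes 1≤i (≤-trans (<⇒≤ i<j) j≤r)) (primes (≤-trans 1≤i (<⇒≤ i<j)) j≤r) (s≤s h) (s≤s (increasing 1≤i i<j j≤r)))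

  gap₆ : ∀ {i} → 1 ≤ i → 2 + i ≤ 3 + k → 3 ≤ a i → 6 + a i ≤ a (2 + i)
  gap₆ {i} 1≤i i≤r h = s≤s⁻¹ (prime-gap₆ (primes 1≤i (≤-trans (m≤n+m i 2) i≤r)) (primes (s≤s z≤n) (≤-trans (n≤1+n (1 + i)) i≤r)) (primes (s≤s z≤n) i≤r)
    (s≤s h) (s≤s (increasing 1≤i ≤-refl (≤-trans (n≤1+n (1 + i)) i≤r))) (s≤s (increasing (s≤s z≤n) ≤-refl i≤r)))

  φ< : 2 * φ (prodTo p (2 + k)) < prodTo p (2 + k) → 2 * prodTo a (2 + k) < prodTo q (2 + k)
  φ< = subst₂ (λ x y → 2 * x < y) (trans (cong φ p≡q) (φ-primorial (1 + k) (n≤1+n _))) p≡q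
    where
    p≡q : prodTo p (2 + k) ≡ prodTo q (2 + k)
    p≡q = prodTo-cong (2 + k) λ i 1≤i i≤ → sym (q≡p i 1≤i (≤-trans i≤ (n≤1+n _)))

  conclusion : GridHyps (Lattice k) (a (2 + k)) (m (2 + k)) (a (3 + k)) →
    ∀ n → n ≡ prodTo (λ i → p i ^ e i) (3 + k) → (X : Subset n) → MinCutSet n X →
    let r = 3 + k; i = 2 + k in
    ((X ≐ InZ n r p i (e i) ⊎ X ≐ InZ n r p r 1)
      × (∀ κ → IsConnectivity n κ → + κ ≡ β n r p i (e i) ⊎ + κ ≡ β n r p r 1))
    × (e i ≡ 1 → X ≐ InZ n r p r 1 × (∀ κ → IsConnectivity n κ → + κ ≡ β n r p r 1))
  conclusion hyps n n≡ X min = at-N n (trans n≡ (prodTo-cong (3 + k) λ i 1≤i i≤r → cong₂ _^_ (sym (q≡p i 1≤i i≤r)) (sym (e≡ i 1≤i i≤r)))) X min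
    where
    r i : ℕ
    r = 3 + k
    i = 2 + k
    i≤r : i ≤ r
    i≤r = n≤1+n _
    p≡q : ∀ j → 1 ≤ j → j ≤ r → p j ≡ q j
    p≡q j 1≤j j≤r = sym (q≡p j 1≤j j≤r)
    result : ∀ n → n ≡ N r → (X : Subset n) → MinCutSet n X →
      ((X ≐ InZ n r q r 1) × + ∣ X ∣ ≡ β n r q r 1) ⊎ (m i ≢ 0 × (X ≐ InZ n r q i (suc (m i))) × + ∣ X ∣ ≡ β n r q i (suc (m i)))
    result _ refl = Core.min-cut-sets a m k primes increasing (cong pred e-last) hyps
    transfer : ∀ {n j s} {X : Subset n} → 1 ≤ j → j ≤ r → X ≐ InZ n r q j s → X ≐ InZ n r p j s
    transfer 1≤j j≤r h x = InZ-cong (q≡p) 1≤j j≤r ∘ proj₁ (h x) , proj₂ (h x) ∘ InZ-cong p≡q 1≤j j≤r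
    at-N : ∀ n → n ≡ N r → (X : Subset n) → MinCutSet n X →
      ((X ≐ InZ n r p i (e i) ⊎ X ≐ InZ n r p r 1)
        × (∀ κ → IsConnectivity n κ → + κ ≡ β n r p i (e i) ⊎ + κ ≡ β n r p r 1))
      × (e i ≡ 1 → X ≐ InZ n r p r 1 × (∀ κ → IsConnectivity n κ → + κ ≡ β n r p r 1))
    at-N n n≡N X min with result n n≡N X min
    ... | inj₁ (X≐ , size) = (inj₂ X≐′ , λ κ c → inj₂ (κ≡ κ c)) , λ _ → X≐′ , κ≡
      where
      X≐′ : X ≐ InZ n r p r 1
      X≐′ = transfer {n} {r} {1} {X} (s≤s z≤n) ≤-refl X≐
      κ≡ : ∀ κ → IsConnectivity n κ → + κ ≡ β n r p r 1
      κ≡ κ c = trans (cong (+_) (connectivity≡ min c)) (trans size (β-cong n 1 q≡p (s≤s z≤n) ≤-refl))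
    ... | inj₂ (m≢0 , X≐ , size) = (inj₁ X≐′ , λ κ c → inj₁ (κ≡ κ c)) , λ e≡1 → contradiction (cong pred e≡1) m≢0
      where
      X≐′ : X ≐ InZ n r p i (e i)
      X≐′ = subst (λ s → X ≐ InZ n r p i s) (e≡ i (s≤s z≤n) i≤r) (transfer {n} {i} {suc (m i)} {X} (s≤s z≤n) i≤r X≐)
      κ≡ : ∀ κ → IsConnectivity n κ → + κ ≡ β n r p i (e i)
      κ≡ κ c = trans (cong (+_) (connectivity≡ min c)) (trans size
        (trans (cong (β n r q i) (e≡ i (s≤s z≤n) i≤r)) (β-cong n (e i) q≡p (s≤s z≤n) i≤r)))

small-prime : ∀ {a} → Prime (suc a) → ¬ (4 ≤ a) → a ≡ 1 ⊎ a ≡ 2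
small-prime {zero} pp _ = contradiction pp ¬prime[1]
small-prime {suc zero} _ _ = inj₁ refl
small-prime {suc (suc zero)} _ _ = inj₂ refl
small-prime {suc (suc (suc zero))} pp _ = contradiction (divides 2 refl) (prime-∤ pp (s≤s (s≤s z≤n)) (s≤s (s≤s (s≤s z≤n))))
small-prime {suc (suc (suc (suc a)))} _ h = contradiction (s≤s (s≤s (s≤s (s≤s z≤n)))) h

dense₃ : ∀ {a₁ a₂ a₃} → 4 ≤ a₁ → a₁ < a₂ → a₂ < a₃ → 1 * (1 + a₁) * (1 + a₂) * (1 + a₃) ≤ 2 * (1 * a₁ * a₂ * a₃)
dense₃ h₁ h₂ h₃ =
  let x , e₁ = m≤n⇒∃[o]m+o≡n h₁
      y , e₂ = m≤n⇒∃[o]m+o≡n h₂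
      z , e₃ = m≤n⇒∃[o]m+o≡n h₃
  in five₃ x y z e₁ e₂ e₃

dense₄ : ∀ {a₁ a₂ a₃ a₄} → 4 ≤ a₁ → a₁ < a₂ → a₂ < a₃ → a₃ < a₄ →
  1 * (1 + a₁) * (1 + a₂) * (1 + a₃) * (1 + a₄) ≤ 2 * (1 * a₁ * a₂ * a₃ * a₄)
dense₄ h₁ h₂ h₃ h₄ =
  let x , e₁ = m≤n⇒∃[o]m+o≡n h₁
      y , e₂ = m≤n⇒∃[o]m+o≡n h₂
      z , e₃ = m≤n⇒∃[o]m+o≡n h₃
      w , e₄ = m≤n⇒∃[o]m+o≡n h₄
  in five₄ x y z w e₁ e₂ e₃ e₄

second-bound : ∀ {c d a} → 2 + c ≤ d → 2 + d ≤ a → 2 * (1 * 2 * c * d * a) < 1 * 3 * (1 + c) * (1 + d) * (1 + a) → c ≤ 10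
second-bound {c} hd ha lt with c ≤? 10
... | yes h = h
... | no h  =
  let x , c≡ = m≤n⇒∃[o]m+o≡n (≰⇒> h)
      y , d≡ = m≤n⇒∃[o]m+o≡n hd
      z , a≡ = m≤n⇒∃[o]m+o≡n ha
  in contradiction (eleven x y z c≡ d≡ a≡) (<⇒≱ lt)

theorem1p4 : (n r : ℕ) (p e : ℕ → ℕ)
    → (r ≡ 4 ⊎ r ≡ 5)
    → (∀ i → 1 ≤ i → i ≤ r → Prime (p i))
    → (∀ i j → 1 ≤ i → i < j → j ≤ r → p i < p j)
    → (∀ i → 1 ≤ i → i ≤ r → 1 ≤ e i)
    → n ≡ prodTo (λ i → p i ^ e i) r
    → e r ≡ 1
    → 2 * φ (prodTo p (r ∸ 1)) < prodTo p (r ∸ 1)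
    → (X : Subset n) → MinCutSet n X
    → (p 1 ≡ 2 ⊎ p 1 ≡ 3)
    × (r ≡ 4 →
    ((X ≐ InZ n r p 3 (e 3) ⊎ X ≐ InZ n r p 4 1)
    × (∀ k → IsConnectivity n k → + k ≡ β n r p 3 (e 3) ⊎ + k ≡ β n r p 4 1))
    × (e 3 ≡ 1 → X ≐ InZ n r p 4 1 × (∀ k → IsConnectivity n k → + k ≡ β n r p 4 1)))
    × (r ≡ 5 → p 1 ≡ 3 →
    ((X ≐ InZ n r p 4 (e 4) ⊎ X ≐ InZ n r p 5 1)
    × (∀ k → IsConnectivity n k → + k ≡ β n r p 4 (e 4) ⊎ + k ≡ β n r p 5 1))
    × (e 4 ≡ 1 → X ≐ InZ n r p 5 1 × (∀ k → IsConnectivity n k → + k ≡ β n r p 5 1)))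
theorem1p4 n _ p e (inj₁ refl) isPrime incr e≥1 n≡ e₄≡1 φ<½ X min =
  [ inj₁ ∘ p₁≡ , inj₂ ∘ p₁≡ ]′ first , (λ _ → conclusion hyps n n≡ X min) , λ ()
  where
  open Conclusion 1 p e isPrime incr e≥1 e₄≡1
  1≤4 2≤4 3≤4 : _
  1≤4 = s≤s {0} {3} z≤n
  2≤4 = s≤s (s≤s {0} {2} z≤n)
  3≤4 = s≤s (s≤s (s≤s {0} {1} z≤n))
  first : a 1 ≡ 1 ⊎ a 1 ≡ 2
  first = small-prime (primes ≤-refl 1≤4) λ h → <⇒≱ (φ< φ<½)
    (dense₃ h (increasing ≤-refl ≤-refl 2≤4) (increasing (s≤s z≤n) ≤-refl 3≤4))
  p₁≡ : ∀ {b} → a 1 ≡ b → p 1 ≡ suc b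
  p₁≡ e = trans (sym (q≡p 1 ≤-refl 1≤4)) (cong suc e)
  a₁<a₂ : a 1 < a 2
  a₁<a₂ = increasing ≤-refl ≤-refl 2≤4
  hyps : GridHyps (Lattice 1) (a 3) (m 3) (a 4)
  hyps = by-first first
    where
    by-first : a 1 ≡ 1 ⊎ a 1 ≡ 2 → GridHyps (Lattice 1) (a 3) (m 3) (a 4)
    by-first (inj₁ e) = hyps₂ 2≤4 (≤-trans (+-monoʳ-≤ 2 2≤a₂) h₃) h₄ (≤-reflexive (sym e))
        (subst (λ b → suc b ≤ b * a 2) (sym e) (≤-trans 2≤a₂ (≤-reflexive (sym (*-identityˡ (a 2))))))
        (subst (λ b → Good (b * a 2) (b + a 2 + 1) (b * a 2 + 1) (suc (a 2)) (a 3) (a 4)) (sym e) (good-2 2≤a₂ h₃ h₄))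
      where
      2≤a₂ : 2 ≤ a 2
      2≤a₂ = subst (_< a 2) e a₁<a₂
      h₃ : 2 + a 2 ≤ a 3
      h₃ = gap₂ (s≤s z≤n) ≤-refl 3≤4 2≤a₂
      h₄ : 2 + a 3 ≤ a 4
      h₄ = gap₂ (s≤s z≤n) ≤-refl ≤-refl (≤-trans 2≤a₂ (<⇒≤ (increasing (s≤s z≤n) ≤-refl 3≤4)))
    by-first (inj₂ e) = hyps₂ 2≤4 (≤-trans 4≤a₂ (≤-trans (m≤n+m (a 2) 2) h₃)) h₄ (≤-trans (s≤s z≤n) (≤-reflexive (sym e)))
        (subst (λ b → suc b ≤ b * a 2) (sym e) (≤-trans (s≤s (s≤s (s≤s z≤n))) (*-monoʳ-≤ 2 4≤a₂)))
        (subst (λ b → Good (b * a 2) (b + a 2 + 1) (b * a 2 + 1) (suc (a 2)) (a 3) (a 4)) (sym e)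
          (good-3 4≤a₂ h₃ (gap₆ (s≤s z≤n) ≤-refl (≤-trans (n≤1+n 3) 4≤a₂))))
      where
      4≤a₂ : 4 ≤ a 2
      4≤a₂ = subst (λ b → 2 + b ≤ a 2) e (gap₂ ≤-refl ≤-refl 2≤4 (≤-reflexive (sym e)))
      2≤a₂ : 2 ≤ a 2
      2≤a₂ = ≤-trans (s≤s (s≤s z≤n)) 4≤a₂
      h₃ : 2 + a 2 ≤ a 3
      h₃ = gap₂ (s≤s z≤n) ≤-refl 3≤4 2≤a₂
      h₄ : 2 + a 3 ≤ a 4
      h₄ = gap₂ (s≤s z≤n) ≤-refl ≤-refl (≤-trans 2≤a₂ (<⇒≤ (increasing (s≤s z≤n) ≤-refl 3≤4)))
theorem1p4 n _ p e (inj₂ refl) isPrime incr e≥1 n≡ e₅≡1 φ<½ X min =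
  [ inj₁ ∘ p₁≡ , inj₂ ∘ p₁≡ ]′ first , (λ ()) , λ _ p₁≡3 → conclusion (hyps (cong pred p₁≡3)) n n≡ X min
  where
  open Conclusion 2 p e isPrime incr e≥1 e₅≡1
  1≤5 2≤5 3≤5 4≤5 : _
  1≤5 = s≤s {0} {4} z≤n
  2≤5 = s≤s (s≤s {0} {3} z≤n)
  3≤5 = s≤s (s≤s (s≤s {0} {2} z≤n))
  4≤5 = s≤s (s≤s (s≤s (s≤s {0} {1} z≤n)))
  first : a 1 ≡ 1 ⊎ a 1 ≡ 2
  first = small-prime (primes ≤-refl 1≤5) λ h → <⇒≱ (φ< φ<½)
    (dense₄ h (increasing ≤-refl ≤-refl 2≤5) (increasing (s≤s z≤n) ≤-refl 3≤5) (increasing (s≤s z≤n) ≤-refl 4≤5))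
  p₁≡ : ∀ {b} → a 1 ≡ b → p 1 ≡ suc b
  p₁≡ e = trans (sym (q≡p 1 ≤-refl 1≤5)) (cong suc e)
  hyps : a 1 ≡ 2 → GridHyps (Lattice 2) (a 4) (m 4) (a 5)
  hyps e =
    -- The gap 6 is used for p₃, p₄, p₅ and for p₂, p₃, p₄; the hypothesis on φ enters as c ≤ 10.
    let h , h≤d , h≤ρ , good = good-3′ 4≤c h₃ h₄ (gap₆ (s≤s z≤n) ≤-refl 3≤d) (gap₆ (s≤s z≤n) 4≤5 3≤c)
                                 (≤-trans (+-monoʳ-≤ 2 (gap₆ (s≤s z≤n) 4≤5 3≤c)) h₅)
                                 (second-bound h₃ h₄ (subst (λ b → 2 * (1 * b * a 2 * a 3 * a 4) < 1 * suc b * suc (a 2) * suc (a 3) * suc (a 4)) e (φ< φ<½)))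
    in hyps₃ {h = h} 3≤5 (≤-trans 4≤c (≤-trans (m≤n+m (a 2) 4) (≤-trans (+-monoʳ-≤ 2 h₃) h₄))) h₅ (≤-trans (s≤s z≤n) (≤-reflexive (sym e)))
         (subst (λ b → suc b ≤ b * a 2) (sym e) (≤-trans (s≤s (s≤s (s≤s z≤n))) (*-monoʳ-≤ 2 4≤c)))
         (subst (λ b → b + a 2 + 1 ≤ b * a 2) (sym e) ρ≤τ)
         h≤d (subst (λ b → h ≤ b + a 2 + 1) (sym e) h≤ρ)
         (subst (λ b → Good (b * a 2 * a 3) (rest₃ b (a 2) (a 3)) (b * a 2 * a 3 + h) (suc (a 3)) (a 4) (a 5)) (sym e) good)
    where
    4≤c : 4 ≤ a 2
    4≤c = subst (λ b → 2 + b ≤ a 2) e (gap₂ ≤-refl ≤-refl 2≤5 (≤-reflexive (sym e)))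
    3≤c : 3 ≤ a 2
    3≤c = ≤-trans (n≤1+n 3) 4≤c
    3≤d : 3 ≤ a 3
    3≤d = ≤-trans 3≤c (<⇒≤ (increasing (s≤s z≤n) ≤-refl 3≤5))
    h₃ : 2 + a 2 ≤ a 3
    h₃ = gap₂ (s≤s z≤n) ≤-refl 3≤5 (<⇒≤ 3≤c)
    h₄ : 2 + a 3 ≤ a 4
    h₄ = gap₂ (s≤s z≤n) ≤-refl 4≤5 (<⇒≤ 3≤d)
    h₅ : 2 + a 4 ≤ a 5
    h₅ = gap₂ (s≤s z≤n) ≤-refl ≤-refl (≤-trans (<⇒≤ 3≤d) (<⇒≤ (increasing (s≤s z≤n) ≤-refl 4≤5)))
    ρ≤τ : 2 + a 2 + 1 ≤ 2 * a 2
    ρ≤τ = ≤-trans (≤-reflexive (trans (+-comm (2 + a 2) 1) (+-comm 3 (a 2)))) (+-monoʳ-≤ (a 2) (≤-trans 3≤c (≤-reflexive (sym (+-identityʳ (a 2))))))
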